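{- For every finite set $AP$, the following three classes of tree languages of Kripke trees over $AP$ coincide, and the translations between the corresponding formalisms are effective: (i) the languages $\mathcal{L}(\varphi)$ of MCL sentences $\varphi$ such that $\mathcal{L}(\varphi)$ is bisimulation-closed (the bisimulation-invariant fragment of MCL); (ii) the languages of CDL formulas; (iii) the languages of symmetric HGTA over $2^{AP}$.
   Context: Trees: a tree is a nonempty prefix-closed $T\subseteq D^*$ (root $\varepsilon$, children $w\cdot d$), non-blocking if each node has a child; descendant of $w$: $w\cdot u$. Kripke tree over $AP$: non-blocking tree with $\mathit{Lab}:T\to2^{AP}$. Infinite path from $w$: $\pi(0)=w$, $\pi(k+1)$ a child of $\pi(k)$. Bisimulation between $(T,\mathit{Lab})$ and $(T',\mathit{Lab}')$: a relation $R\subseteq T\times T'$ such that for $(w,w')\in R$: $\mathit{Lab}(w)=\mathit{Lab}'(w')$, every child of $w$ is related to some child of $w'$, and every child of $w'$ is related to some child of $w$; the trees are bisimilar if such $R$ contains $(\varepsilon,\varepsilon)$. A language is bisimulation-closed if it contains, with any tree, all trees bisimilar to it. MCL: $\varphi::=p(x)\mid x\le y\mid x\in X\mid\neg\varphi\mid\varphi\wedge\varphi\mid\exists x.\varphi\mid\exists^CX.\varphi$, with $p(x)$ iff $p\in\mathit{Lab}(x)$, $x\le y$ iff $y$ is a descendant of $x$, $\exists^CX$ ranging over chains (sets of pairwise $\le$-comparable nodes); $\mathcal{L}(\varphi)$ = Kripke trees satisfying the sentence. CDL: state formulas $\varphi::=\top\mid p\mid\neg\varphi\mid\varphi\wedge\varphi\mid\mathsf{E}\psi\mid\mathsf{D}^1\varphi$;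 path formulas $\psi::=\varphi\mid\neg\psi\mid\psi\wedge\psi\mid\langle\mathcal{N}\rangle\psi$ where $\mathcal{N}=(2^{AP},Q,\delta,q_0,F,\tau)$ is a nondeterministic finite automaton on finite words with accepting set $F$ and $\tau$ maps states to path formulas. $(\mathcal{T},w)\models p$ iff $p\in\mathit{Lab}(w)$; $(\mathcal{T},w)\models\mathsf{E}\psi$ iff $(\mathcal{T},\pi,0)\models\psi$ for some infinite path $\pi$ from $w$; $(\mathcal{T},w)\models\mathsf{D}^1\varphi$ iff some child of $w$ satisfies $\varphi$; $(\mathcal{T},\pi,i)\models\varphi$ iff $(\mathcal{T},\pi(i))\models\varphi$; $(\mathcal{T},\pi,i)\models\langle\mathcal{N}\rangle\psi$ iff there is $j\ge i$ with $(\mathcal{T},\pi,j)\models\psi$ and an accepting run $q_i\dots q_j$ ($q_i=q_0$, $q_j\in F$) on $\mathit{Lab}(\pi(i))\cdots\mathit{Lab}(\pi(j-1))$ with $(\mathcal{T},\pi,k)\models\tau(q_k)$ for all $k\in[i,j]$. $\mathcal{L}(\varphi)$: trees whose root satisfies $\varphi$. Symmetric HGTA: $(\Sigma,Q,\delta,q_0,\mathsf{H},\mathsf{H}_\exists,\Omega)$ where $\delta(q,a)$ are symmetric graded $Q$-constraints $\theta::=\top\mid\bot\mid\theta\vee\theta\mid\theta\wedge\theta\mid\Diamond\alpha\mid\Box\alpha$ ($\alpha$ positive Boolean over $Q$), interpreted on one-step interpretations $(S,I)$, $I:S\to2^Q$: $\Diamond\alpha$ iff some $s$ has $I(s)\models\alpha$,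 $\Box\alpha$ iff all $s$ have $I(s)\models\alpha$; $\Omega:Q\to\mathbb{N}$. A run on a non-blocking tree: a $(Q\times T)$-labelled tree with root label $(q_0,\varepsilon)$ such that each node labelled $(q,w)$ has children labelled exactly by $(q',w')$, $w'$ a child of $w$, $q'\in I(w')$, for some $I$ with $(\text{children of }w,I)\models\delta(q,\mathit{Lab}(w))$; accepting iff on every infinite branch the maximal colour occurring infinitely often is even. Hesitant structure: $\mathsf{H}=\langle Q_1,\dots,Q_n\rangle$ ordered partition of $Q$ into nonempty components (order $i$), each transient, existential (those in $\mathsf{H}_\exists$) or universal: transient: $\delta(q,a)$, $q\in Q_i$, mentions only states of order $<i$; existential: $\delta(q,a)$ is a disjunction of conjunctions $\Diamond q'\wedge\mathsf{Con}(A)$ ($q'\in Q_i$, $\mathsf{Con}(A)$ a conjunction of atoms mentioning only states of order $<i$); universal: a conjunction of disjunctions $\Box q'\vee\mathsf{Dis}(A)$ likewise; $\Omega$ on existential components has values in $\{m-1,m\}$, $m$ even, on universal ones in $\{m-1,m\}$, $m$ odd. -}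

module Defs where

open import Level using (Level; Lift; 0ℓ) renaming (suc to lsuc)
open import Data.Nat using (ℕ; zero; suc; _+_; _≤_; _<_; _∸_)
open import Data.Nat.Properties using ()
open import Data.Fin using (Fin; toℕ)
open import Data.Fin.Subset using (Subset; _∈_)
open import Data.Bool using (Bool; true; false)
open import Data.List using (List; []; _∷ʳ_; _++_)
open import Data.Product using (Σ; _×_; _,_; proj₁; proj₂)
open import Data.Sum using (_⊎_)
open import Data.Unit using (⊤)
open import Data.Empty using (⊥)
open import Data.Vec.Functional using () renaming (_∷_ to _∷ᶠ_)
open import Relation.Nullary using (¬_)
open import Relation.Binary.PropositionalEquality using (_≡_)

-- Kripke trees over AP = Fin n.  A tree is a nonempty prefix-closed
-- T ⊆ D* (as a predicate on List D, w · d written w ∷ʳ d), non-blocking,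
-- with a labelling Lab into 2^AP = Subset n.  The direction set D is
-- an arbitrary (small) type.

record KTree (n : ℕ) : Set₁ where
  field
    D        : Set
    T        : List D → Set
    root     : T []
    prefix   : ∀ u v → T (u ++ v) → T u
    nonblock : ∀ w → T w → Σ D λ d → T (w ∷ʳ d)
    Lab      : List D → Subset n

_≼_ : {D : Set} → List D → List D → Set
_≼_ {D} u v = Σ (List D) λ s → v ≡ u ++ s

record Path {n : ℕ} (K : KTree n) (w : List (KTree.D K)) : Set where
  open KTree K
  field
    π     : ℕ → List D
    start : π 0 ≡ w
    inT   : ∀ i → T (π i)
    step  : ∀ i → Σ D λ d → π (suc i) ≡ π i ∷ʳ d

record Bisim {n : ℕ} (K K' : KTree n) : Set₁ where
  private
    module A = KTree K
    module B = KTree K'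
  field
    R     : List A.D → List B.D → Set
    inT   : ∀ w w' → R w w' → A.T w × B.T w'
    root  : R [] []
    lab   : ∀ w w' → R w w' → A.Lab w ≡ B.Lab w'
    forth : ∀ w w' → R w w' → ∀ d → A.T (w ∷ʳ d) →
            Σ B.D λ d' → B.T (w' ∷ʳ d') × R (w ∷ʳ d) (w' ∷ʳ d')
    back  : ∀ w w' → R w w' → ∀ d' → B.T (w' ∷ʳ d') →
            Σ A.D λ d → A.T (w ∷ʳ d) × R (w ∷ʳ d) (w' ∷ʳ d')

BisimClosed : {n : ℕ} {ℓ : Level} → (KTree n → Set ℓ) → Set (lsuc 0ℓ Level.⊔ ℓ)
BisimClosed {n} L = (K K' : KTree n) → Bisim K K' → L K → L K'

_≐_ : {n : ℕ} {a b : Level} → (KTree n → Set a) → (KTree n → Set b) → Set (lsuc 0ℓ Level.⊔ a Level.⊔ b)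
_≐_ {n} L₁ L₂ = (K : KTree n) → (L₁ K → L₂ K) × (L₂ K → L₁ K)

-- MCL (de Bruijn: m first-order variables, k chain variables)

data MCL (n : ℕ) : ℕ → ℕ → Set where
  prop  : ∀ {m k} → Fin n → Fin m → MCL n m k
  leq   : ∀ {m k} → Fin m → Fin m → MCL n m k
  mem   : ∀ {m k} → Fin m → Fin k → MCL n m k
  neg   : ∀ {m k} → MCL n m k → MCL n m k
  and   : ∀ {m k} → MCL n m k → MCL n m k → MCL n m k
  ex1   : ∀ {m k} → MCL n (suc m) k → MCL n m k
  exC   : ∀ {m k} → MCL n m (suc k) → MCL n m k

MCLSentence : ℕ → Set
MCLSentence n = MCL n 0 0

module MCLSem {n : ℕ} (K : KTree n) where
  open KTree K

  IsChain : (List D → Set) → Set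
  IsChain X = (∀ w → X w → T w) × (∀ u v → X u → X v → (u ≼ v) ⊎ (v ≼ u))

  sat : ∀ {m k} → (Fin m → List D) → (Fin k → (List D → Set)) → MCL n m k → Set₁
  sat ρ σ (prop p x) = Lift (lsuc 0ℓ) (p ∈ Lab (ρ x))
  sat ρ σ (leq x y)  = Lift (lsuc 0ℓ) (ρ x ≼ ρ y)
  sat ρ σ (mem x X)  = Lift (lsuc 0ℓ) (σ X (ρ x))
  sat ρ σ (neg φ)    = ¬ sat ρ σ φ
  sat ρ σ (and φ ψ)  = sat ρ σ φ × sat ρ σ ψ
  sat ρ σ (ex1 φ)    = Σ (List D) λ w → Lift (lsuc 0ℓ) (T w) × sat (w ∷ᶠ ρ) σ φ
  sat ρ σ (exC φ)    = Σ (List D → Set) λ X → Lift (lsuc 0ℓ) (IsChain X) × sat ρ (X ∷ᶠ σ) φ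

LMCL : {n : ℕ} → MCLSentence n → KTree n → Set₁
LMCL φ K = MCLSem.sat K (λ ()) (λ ()) φ

mutual
  data CDL (n : ℕ) : Set where
    tt   : CDL n
    prop : Fin n → CDL n
    neg  : CDL n → CDL n
    and  : CDL n → CDL n → CDL n
    E    : CDLPath n → CDL n
    D1   : CDL n → CDL n

  data CDLPath (n : ℕ) : Set where
    st   : CDL n → CDLPath n
    neg  : CDLPath n → CDLPath n
    and  : CDLPath n → CDLPath n → CDLPath n
    diam : NFA n → CDLPath n → CDLPath n

  -- NFA over alphabet 2^AP with k states, transition relation δ,
  -- initial state q₀, accepting set F and state labelling τ
  data NFA (n : ℕ) : Set where
    nfa : (k : ℕ) → (Fin k → Subset n → Subset k) → Fin k → Subset k →
          (Fin k → CDLPath n) → NFA n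

module CDLSem {n : ℕ} (K : KTree n) where
  open KTree K
  mutual
    satS : List D → CDL n → Set
    satS w tt        = ⊤
    satS w (prop p)  = p ∈ Lab w
    satS w (neg φ)   = ¬ satS w φ
    satS w (and φ ψ) = satS w φ × satS w ψ
    satS w (E ψ)     = Σ (Path K w) λ π → satP π 0 ψ
    satS w (D1 φ)    = Σ D λ d → T (w ∷ʳ d) × satS (w ∷ʳ d) φ

    satP : ∀ {w} → Path K w → ℕ → CDLPath n → Set
    satP π i (st φ)    = satS (Path.π π i) φ
    satP π i (neg ψ)   = ¬ satP π i ψ
    satP π i (and ψ χ) = satP π i ψ × satP π i χ
    satP π i (diam (nfa k δ q₀ F τ) ψ) =
      Σ ℕ λ j → i ≤ j × satP π j ψ ×
      Σ (ℕ → Fin k) λ q → q i ≡ q₀ × q j ∈ F ×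
        (∀ l → i ≤ l → l < j → q (suc l) ∈ δ (q l) (Lab (Path.π π l))) ×
        (∀ l → i ≤ l → l ≤ j → satP π l (τ (q l)))

LCDL : {n : ℕ} → CDL n → KTree n → Set
LCDL φ K = CDLSem.satS K [] φ

data PB (k : ℕ) : Set where
  atom : Fin k → PB k
  ptt  : PB k
  pff  : PB k
  pand : PB k → PB k → PB k
  por  : PB k → PB k → PB k

data Con (k : ℕ) : Set where
  c⊤ : Con k
  c⊥ : Con k
  cor  : Con k → Con k → Con k
  cand : Con k → Con k → Con k
  ◇ : PB k → Con k
  □ : PB k → Con k

satPB : ∀ {k} → Subset k → PB k → Set
satPB S (atom q)   = q ∈ S
satPB S ptt        = ⊤
satPB S pff        = ⊥
satPB S (pand α β) = satPB S α × satPB S β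
satPB S (por α β)  = satPB S α ⊎ satPB S β

satCon : ∀ {k} (S : Set) → (S → Subset k) → Con k → Set
satCon S I c⊤         = ⊤
satCon S I c⊥         = ⊥
satCon S I (cor θ η)  = satCon S I θ ⊎ satCon S I η
satCon S I (cand θ η) = satCon S I θ × satCon S I η
satCon S I (◇ α)      = Σ S λ s → satPB (I s) α
satCon S I (□ α)      = ∀ s → satPB (I s) α

data AllPB {k : ℕ} (P : Fin k → Set) : PB k → Set where
  atom : ∀ {q} → P q → AllPB P (atom q)
  ptt  : AllPB P ptt
  pff  : AllPB P pff
  pand : ∀ {α β} → AllPB P α → AllPB P β → AllPB P (pand α β)
  por  : ∀ {α β} → AllPB P α → AllPB P β → AllPB P (por α β)

data AllCon {k : ℕ} (P : Fin k → Set) : Con k → Set where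
  c⊤   : AllCon P c⊤
  c⊥   : AllCon P c⊥
  cor  : ∀ {θ η} → AllCon P θ → AllCon P η → AllCon P (cor θ η)
  cand : ∀ {θ η} → AllCon P θ → AllCon P η → AllCon P (cand θ η)
  ◇    : ∀ {α} → AllPB P α → AllCon P (◇ α)
  □    : ∀ {α} → AllPB P α → AllCon P (□ α)

data ConjLow {k : ℕ} (Low : Fin k → Set) : Con k → Set where
  c⊤   : ConjLow Low c⊤
  cand : ∀ {θ η} → ConjLow Low θ → ConjLow Low η → ConjLow Low (cand θ η)
  ◇    : ∀ {α} → AllPB Low α → ConjLow Low (◇ α)
  □    : ∀ {α} → AllPB Low α → ConjLow Low (□ α)

data DisjLow {k : ℕ} (Low : Fin k → Set) : Con k → Set where
  c⊥  : DisjLow Low c⊥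
  cor : ∀ {θ η} → DisjLow Low θ → DisjLow Low η → DisjLow Low (cor θ η)
  ◇   : ∀ {α} → AllPB Low α → DisjLow Low (◇ α)
  □   : ∀ {α} → AllPB Low α → DisjLow Low (□ α)

data ExForm {k : ℕ} (Cur Low : Fin k → Set) : Con k → Set where
  c⊥   : ExForm Cur Low c⊥
  cor  : ∀ {θ η} → ExForm Cur Low θ → ExForm Cur Low η → ExForm Cur Low (cor θ η)
  term : ∀ {q' θ} → Cur q' → ConjLow Low θ → ExForm Cur Low (cand (◇ (atom q')) θ)

data UnForm {k : ℕ} (Cur Low : Fin k → Set) : Con k → Set where
  c⊤   : UnForm Cur Low c⊤
  cand : ∀ {θ η} → UnForm Cur Low θ → UnForm Cur Low η → UnForm Cur Low (cand θ η)
  term : ∀ {q' θ} → Cur q' → DisjLow Low θ → UnForm Cur Low (cor (□ (atom q')) θ)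

Even Odd : ℕ → Set
Even m = Σ ℕ λ h → m ≡ h + h
Odd m  = Σ ℕ λ h → m ≡ suc (h + h)

-- Hesitant structure: ordered partition given by ord : Q → Fin c
-- (component Q_i = ord⁻¹(i), order i), surjective so components are
-- nonempty; hE i = true iff component i ∈ H_∃.

module _ {n k c : ℕ} (δ : Fin k → Subset n → Con k) (ord : Fin k → Fin c)
         (hE : Fin c → Bool) (Ω : Fin k → ℕ) where

  InComp : Fin c → Fin k → Set
  InComp i q = ord q ≡ i

  Lower : Fin c → Fin k → Set
  Lower i q = toℕ (ord q) < toℕ i

  Transient Existential Universal : Fin c → Set
  Transient i   = ∀ q a → InComp i q → AllCon (Lower i) (δ q a)
  Existential i = (∀ q a → InComp i q → ExForm (InComp i) (Lower i) (δ q a)) ×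
                  Σ ℕ λ m → Even m × (∀ q → InComp i q → (Ω q ≡ m ∸ 1) ⊎ (Ω q ≡ m))
  Universal i   = (∀ q a → InComp i q → UnForm (InComp i) (Lower i) (δ q a)) ×
                  Σ ℕ λ m → Odd m × (∀ q → InComp i q → (Ω q ≡ m ∸ 1) ⊎ (Ω q ≡ m))

  Hesitant : Set
  Hesitant = ∀ i → Transient i ⊎ (hE i ≡ true × Existential i) ⊎ (hE i ≡ false × Universal i)

record HGTA (n : ℕ) : Set where
  field
    k        : ℕ
    δ        : Fin k → Subset n → Con k
    q₀       : Fin k
    c        : ℕ
    ord      : Fin k → Fin c
    ordSurj  : ∀ i → Σ (Fin k) λ q → ord q ≡ i
    hE       : Fin c → Bool
    Ω        : Fin k → ℕ
    hesitant : Hesitant δ ord hE Ω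

module _ {n : ℕ} (A : HGTA n) (K : KTree n) where
  open HGTA A
  open KTree K

  record Run : Set₁ where
    field
      R      : Set
      Tr     : List R → Set
      rootR  : Tr []
      prefR  : ∀ u v → Tr (u ++ v) → Tr u
      lab    : List R → Fin k × List D
      rootLab : lab [] ≡ (q₀ , [])
      step   : ∀ x → Tr x →
        let q = proj₁ (lab x) ; w = proj₂ (lab x) in
        Σ (D → Subset k) λ I →
          satCon (Σ D λ d → T (w ∷ʳ d)) (λ s → I (proj₁ s)) (δ q (Lab w)) ×
          (∀ r → Tr (x ∷ʳ r) → Σ D λ d → Σ (Fin k) λ q' →
              T (w ∷ʳ d) × q' ∈ I d × lab (x ∷ʳ r) ≡ (q' , w ∷ʳ d)) ×
          (∀ d q' → T (w ∷ʳ d) → q' ∈ I d →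
              Σ R λ r → Tr (x ∷ʳ r) × lab (x ∷ʳ r) ≡ (q' , w ∷ʳ d))

  Accepting : Run → Set
  Accepting ρ =
    (β : ℕ → List R) → β 0 ≡ [] →
    (∀ i → Tr (β i)) → (∀ i → Σ R λ r → β (suc i) ≡ β i ∷ʳ r) →
    Σ ℕ λ m → Even m ×
      (∀ i → Σ ℕ λ j → i ≤ j × Ω (proj₁ (lab (β j))) ≡ m) ×
      (Σ ℕ λ i → ∀ j → i ≤ j → Ω (proj₁ (lab (β j))) ≤ m)
    where open Run ρ

LHGTA : {n : ℕ} → HGTA n → KTree n → Set₁
LHGTA A K = Σ (Run A K) (Accepting A K)

{-# OPTIONS --safe #-}
module Submission where

-- All translations pass through a hub logic Y: Boolean combinations of "some path carries an
-- accepting run of a Büchi automaton", the tests on the transitions being formulas of Y.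
-- Büchi automata with tests are closed under Boolean operations because, by Ramsey's theorem, every
-- word factorises as s·e·e·e… into profiles (transition relations) with e idempotent, and acceptance
-- depends on s and e only; hence nested path formulas of CDL can be compiled away.
-- Conversely acceptance is expressed in CDL without determinisation: the condition "eventually
-- e·e·e…" is recognised by infinitely many returns to positions with merging profiles.
-- For MCL, a bisimulation-invariant sentence is evaluated on the ω-expansion of the tree, where a
-- chain is projected away by running an automaton along a path through it: off this path the chain
-- is empty, and the children not on the path can be told apart by the chains they contain.
-- An automaton is accepting from a state of an existential component iff some path carries a good
-- sequence of terms, and from a state of a universal component iff no path carries a bad one.

open import Defs
open import Level using (Lift; lift; lower; 0ℓ; _⊔_) renaming (suc to lsuc)
open import Axiom.ExcludedMiddle using (ExcludedMiddle)
open import Data.Bool using (Bool; true; false; if_then_else_; not; _∧_; _∨_)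
open import Data.Bool.Properties using (not-involutive) renaming (_≟_ to _≟ᵇ_)
open import Data.Empty using (⊥; ⊥-elim)
open import Data.Fin using (Fin; zero; suc; toℕ; fromℕ; fromℕ<; _↑ˡ_; _↑ʳ_)
import Data.Fin.Properties as Finₚ
open import Data.Fin.Subset using (Subset) renaming (_∈_ to _∈ˢ_)
open import Data.List using (List; []; _∷_; _++_; _∷ʳ_; length; map; concatMap; lookup; allFin; cartesianProductWith)
import Data.List.Properties as Listₚ
open import Data.List.Membership.Propositional using (_∈_; lose)
open import Data.List.Membership.Propositional.Properties
  using (∈-map⁺; ∈-++⁺ˡ; ∈-++⁺ʳ; ∈-allFin; ∈-concatMap⁺; ∈-cartesianProductWith⁺)
open import Data.List.Relation.Unary.Any as Any using (Any; here; there)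
import Data.List.Relation.Unary.Any.Properties as Anyₚ
open import Data.List.Relation.Unary.All as All using (All; []; _∷_)
import Data.List.Relation.Unary.All.Properties as Allₚ
open import Data.Maybe using (Maybe; just; nothing)
open import Data.Nat using (ℕ; zero; suc; _+_; _≤_; _<_; _∸_; z≤n; s≤s; _≤′_; ≤′-refl; ≤′-step)
  renaming (_⊔_ to _⊔ⁿ_)
import Data.Nat.Properties as ℕₚ
open import Data.Product using (Σ; _×_; _,_; proj₁; proj₂)
open import Data.Sum using (_⊎_; inj₁; inj₂; [_,_]′)
open import Data.Unit using (⊤; tt)
open import Data.Vec using (Vec; []; _∷_; tabulate) renaming (lookup to vlookup)
open import Data.Vec.Functional using () renaming (_∷_ to _∷ᶠ_)
import Data.Vec.Properties as Vecₚ
open import Function using (_∘_; id)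
open import Relation.Nullary using (¬_; Dec; yes; no; does)
open import Relation.Nullary.Decidable using (map′; dec-true; dec-false; decidable-stable)
open import Relation.Binary using (DecidableEquality; Tri; tri<; tri≈; tri>)
open import Relation.Binary.PropositionalEquality
  using (_≡_; _≢_; refl; sym; trans; cong; cong₂; subst; subst₂)
open import Relation.Binary.PropositionalEquality.Properties using () renaming (setoid to ≡-setoid)

-- The three translations form a cycle from MCL to CDL to HGTA and back to MCL. Each is a plain
-- function; excluded middle is an argument of the correctness proofs alone. Hence the functions
-- work only with finite Boolean data such as profiles and normal forms, while paths, runs and
-- factorisations occur only in the proofs.
--
-- In `Y` negation is available at nodes but not along a path, so every negation of a path property
-- is paid for by complementing a Büchi automaton. This also covers obligations at infinitely many
-- positions: a violation is one guessed position, and complementing the guessing automaton yields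
-- the universal statement.
--
-- The obstacle for MCL is that `Y` cannot say that two children differ, whereas a run that leaves
-- the distinguished path has to enter a child other than the next node. Only in the ω-expansion,
-- where every child has infinitely many copies and each chain meets at most one of them, does this
-- inequality become expressible. Bisimulation closure of the sentence serves to carry it between a
-- tree and its expansion.

infix 2 _⟺_
_⟺_ : ∀ {a b} → Set a → Set b → Set (a ⊔ b)
A ⟺ B = (A → B) × (B → A)

⟺-refl : ∀ {a} {A : Set a} → A ⟺ A
⟺-refl = id , id

⟺-sym : ∀ {a b} {A : Set a} {B : Set b} → A ⟺ B → B ⟺ A
⟺-sym (f , g) = g , f

infixr 9 _⟫_
_⟫_ : ∀ {a b c} {A : Set a} {B : Set b} {C : Set c} → A ⟺ B → B ⟺ C → A ⟺ C
(f , g) ⟫ (h , k) = h ∘ f , g ∘ k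

¬-⟺ : ∀ {a b} {A : Set a} {B : Set b} → A ⟺ B → ¬ A ⟺ ¬ B
¬-⟺ (f , g) = (λ na b → na (g b)) , (λ nb a → nb (f a))

×-⟺ : ∀ {a b c d} {A : Set a} {B : Set b} {C : Set c} {D : Set d} →
      A ⟺ B → C ⟺ D → (A × C) ⟺ (B × D)
×-⟺ (f , g) (h , k) = (λ (a , c) → f a , h c) , (λ (b , d) → g b , k d)

⊎-⟺ : ∀ {a b c d} {A : Set a} {B : Set b} {C : Set c} {D : Set d} →
      A ⟺ B → C ⟺ D → (A ⊎ C) ⟺ (B ⊎ D)
⊎-⟺ (f , g) (h , k) = [ inj₁ ∘ f , inj₂ ∘ h ]′ , [ inj₁ ∘ g , inj₂ ∘ k ]′

Σ-⟺ : ∀ {a b c} {A : Set a} {B : A → Set b} {C : A → Set c} →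
      (∀ x → B x ⟺ C x) → Σ A B ⟺ Σ A C
Σ-⟺ e = (λ (x , b) → x , proj₁ (e x) b) , (λ (x , c) → x , proj₂ (e x) c)

Π-⟺ : ∀ {a b c} {A : Set a} {B : A → Set b} {C : A → Set c} →
      (∀ x → B x ⟺ C x) → (∀ x → B x) ⟺ (∀ x → C x)
Π-⟺ e = (λ f x → proj₁ (e x) (f x)) , (λ f x → proj₂ (e x) (f x))

≡→⟺ : ∀ {A B : Set} → A ≡ B → A ⟺ B
≡→⟺ refl = ⟺-refl

does⟺ : ∀ {a} {P : Set a} (d : Dec P) → does d ≡ true ⟺ P
does⟺ (yes p) = (λ _ → p) , (λ _ → refl)
does⟺ (no ¬p) = (λ ()) , (λ p → ⊥-elim (¬p p))

-- Excluded middle and Boolean truth values.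

EM : Set₁
EM = ExcludedMiddle 0ℓ

em-lower : ExcludedMiddle (lsuc 0ℓ) → EM
em-lower em {P} = map′ lower lift (em {Lift (lsuc 0ℓ) P})

truth : EM → Set → Bool
truth em P = does (em {P})

truth⟺ : (em : EM) (P : Set) → truth em P ≡ true ⟺ P
truth⟺ em P = does⟺ (em {P})

¬¬-elim : EM → {P : Set} → ¬ ¬ P → P
¬¬-elim em = decidable-stable em

¬∀→∃¬ : EM → {A : Set} {P : A → Set} → ¬ (∀ x → P x) → Σ A λ x → ¬ P x
¬∀→∃¬ em h = ¬¬-elim em λ n → h λ x → ¬¬-elim em λ np → n (x , np)

¬×⟺ : EM → {A B : Set} → (¬ (A × B)) ⟺ (¬ A ⊎ ¬ B)
¬×⟺ em {A} {B} = to , [ (λ n (a , _) → n a) , (λ n (_ , b) → n b) ]′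
  where
  to : ¬ (A × B) → ¬ A ⊎ ¬ B
  to n with em {A}
  ... | yes a = inj₂ λ b → n (a , b)
  ... | no na = inj₁ na

true≢false : true ≢ false
true≢false ()

bool-ext : {b c : Bool} → (b ≡ true ⟺ c ≡ true) → b ≡ c
bool-ext {true}  {true}  _ = refl
bool-ext {false} {false} _ = refl
bool-ext {true}  {false} (f , _) = sym (f refl)
bool-ext {false} {true}  (_ , g) = g refl

∧-⟺ : {b c : Bool} → (b ∧ c ≡ true) ⟺ (b ≡ true × c ≡ true)
∧-⟺ {true}  = (λ p → refl , p) , proj₂
∧-⟺ {false} = (λ ()) , (λ ())

∨-⟺ : {b c : Bool} → (b ∨ c ≡ true) ⟺ (b ≡ true ⊎ c ≡ true)
∨-⟺ {true}  = (λ _ → inj₁ refl) , (λ _ → refl)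
∨-⟺ {false} = inj₂ , [ (λ ()) , id ]′

not-⟺ : {b : Bool} → (not b ≡ true) ⟺ (¬ b ≡ true)
not-⟺ {true}  = (λ ()) , (λ n → ⊥-elim (n refl))
not-⟺ {false} = (λ _ ()) , (λ _ → refl)

-- Finite types

-- Repetitions in `elems` are allowed, so `A` is only a retract of `Fin size`: `dec` undoes `enc`,
-- but not every index is a code. This is the reason for the normality test in `isL` and for the
-- default case of `view`.
record Finite (A : Set) : Set where
  constructor finite
  field
    elems    : List A
    complete : ∀ a → a ∈ elems

  size : ℕ
  size = length elems

  enc : A → Fin size
  enc a = Any.index (complete a)

  dec : Fin size → A
  dec = lookup elems

  dec-enc : ∀ a → dec (enc a) ≡ a
  dec-enc a = sym (Anyₚ.lookup-index (complete a))

open Finite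

finFin : ∀ k → Finite (Fin k)
finFin k = finite (allFin k) ∈-allFin

finBool : Finite Bool
finBool = finite (true ∷ false ∷ []) λ { true → here refl ; false → there (here refl) }

finMaybe : {A : Set} → Finite A → Finite (Maybe A)
finMaybe fA = finite (nothing ∷ map just (elems fA))
  λ { nothing → here refl ; (just a) → there (∈-map⁺ just (complete fA a)) }

fin⊎ : {A B : Set} → Finite A → Finite B → Finite (A ⊎ B)
fin⊎ fA fB = finite (map inj₁ (elems fA) ++ map inj₂ (elems fB))
  λ { (inj₁ a) → ∈-++⁺ˡ (∈-map⁺ inj₁ (complete fA a))
    ; (inj₂ b) → ∈-++⁺ʳ (map inj₁ (elems fA)) (∈-map⁺ inj₂ (complete fB b)) }

finΣ : {A : Set} {B : A → Set} → Finite A → (∀ a → Finite (B a)) → Finite (Σ A B)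
finΣ fA fB = finite (concatMap (λ a → map (a ,_) (elems (fB a))) (elems fA))
  λ (a , b) → ∈-concatMap⁺ (λ a → map (a ,_) (elems (fB a)))
                (lose (complete fA a) (∈-map⁺ (a ,_) (complete (fB a) b)))

fin× : {A B : Set} → Finite A → Finite B → Finite (A × B)
fin× fA fB = finΣ fA λ _ → fB

finVec : {A : Set} → Finite A → ∀ n → Finite (Vec A n)
finVec fA zero    = finite ([] ∷ []) λ { [] → here refl }
finVec fA (suc n) = finite (cartesianProductWith _∷_ (elems fA) (elems (finVec fA n)))
  λ { (a ∷ v) → ∈-cartesianProductWith⁺ _∷_ (complete fA a) (complete (finVec fA n) v) }

anyF : {A : Set} → Finite A → (A → Bool) → Bool
anyF fA f = does (Any.any? (λ a → f a ≟ᵇ true) (elems fA))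

anyF⟺ : {A : Set} (fA : Finite A) (f : A → Bool) →
        anyF fA f ≡ true ⟺ Σ A λ a → f a ≡ true
anyF⟺ fA f = does⟺ (Any.any? (λ a → f a ≟ᵇ true) (elems fA)) ⟫
  (Any.satisfied , λ (a , p) → lose (complete fA a) p)

vec-ext : {A : Set} {n : ℕ} (u v : Vec A n) → (∀ i → vlookup u i ≡ vlookup v i) → u ≡ v
vec-ext []      []      _ = refl
vec-ext (a ∷ u) (b ∷ v) h = cong₂ _∷_ (h zero) (vec-ext u v (h ∘ suc))

-- Boolean algebras of tests and their models

-- Pure syntax, so that the same automaton constructions apply to formulas of the hub logic, CDL
-- state and path formulas, MCL formulas and tests depending on an extra track. The Boolean laws are
-- imposed only on satisfaction, in `Model`, which keeps the constructions computable.
record Tests : Set₁ where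
  field
    G    : Set
    ttᵍ  : G
    ¬ᵍ_  : G → G
    _∧ᵍ_ : G → G → G

  ffᵍ : G
  ffᵍ = ¬ᵍ ttᵍ

  _∨ᵍ_ : G → G → G
  g ∨ᵍ h = ¬ᵍ ((¬ᵍ g) ∧ᵍ (¬ᵍ h))

  ⌜_⌝ : Bool → G
  ⌜ b ⌝ = if b then ttᵍ else ffᵍ

  orL : {A : Set} → List A → (A → G) → G
  orL []       f = ffᵍ
  orL (a ∷ as) f = f a ∨ᵍ orL as f

  andL : {A : Set} → List A → (A → G) → G
  andL []       f = ttᵍ
  andL (a ∷ as) f = f a ∧ᵍ andL as f

record Model (𝓖 : Tests) : Set₁ where
  open Tests 𝓖
  field
    L   : Set
    _⊨_ : L → G → Set
    ⊨tt : ∀ l → l ⊨ ttᵍ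
    ⊨¬  : ∀ l g → (l ⊨ (¬ᵍ g)) ⟺ (¬ (l ⊨ g))
    ⊨∧  : ∀ l g h → (l ⊨ (g ∧ᵍ h)) ⟺ ((l ⊨ g) × (l ⊨ h))

module ModelProps (em : EM) {𝓖 : Tests} (M : Model 𝓖) where
  open Tests 𝓖
  open Model M

  ⊨ff : ∀ l → ¬ (l ⊨ ffᵍ)
  ⊨ff l p = proj₁ (⊨¬ l ttᵍ) p (⊨tt l)

  ⊨∨ : ∀ l g h → (l ⊨ (g ∨ᵍ h)) ⟺ ((l ⊨ g) ⊎ (l ⊨ h))
  ⊨∨ l g h = ⊨¬ l _ ⟫ ¬-⟺ (⊨∧ l _ _ ⟫ ×-⟺ (⊨¬ l g) (⊨¬ l h)) ⟫
    ¬×⟺ em ⟫ ⊎-⟺ ¬¬⟺ ¬¬⟺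
    where
    ¬¬⟺ : {P : Set} → (¬ ¬ P) ⟺ P
    ¬¬⟺ = ¬¬-elim em , λ p n → n p

  ⊨⌜⌝ : ∀ l b → (l ⊨ ⌜ b ⌝) ⟺ (b ≡ true)
  ⊨⌜⌝ l true  = (λ _ → refl) , (λ _ → ⊨tt l)
  ⊨⌜⌝ l false = (λ p → ⊥-elim (⊨ff l p)) , (λ ())

  ⊨if : ∀ l b g → (l ⊨ (if b then g else ffᵍ)) ⟺ (b ≡ true × (l ⊨ g))
  ⊨if l true  g = (λ h → refl , h) , proj₂
  ⊨if l false g = (λ h → ⊥-elim (⊨ff l h)) , (λ ())

  ⊨orL : ∀ l {A : Set} (as : List A) f → (l ⊨ orL as f) ⟺ Any (λ a → l ⊨ f a) as
  ⊨orL l [] f = (λ p → ⊥-elim (⊨ff l p)) , (λ ())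
  ⊨orL l (a ∷ as) f = ⊨∨ l _ _ ⟫ ⊎-⟺ ⟺-refl (⊨orL l as f) ⟫
    ([ here , there ]′ , λ { (here p) → inj₁ p ; (there q) → inj₂ q })

  ⊨orF : ∀ l {A : Set} (fA : Finite A) f → (l ⊨ orL (elems fA) f) ⟺ Σ A λ a → l ⊨ f a
  ⊨orF l fA f = ⊨orL l (elems fA) f ⟫ (Any.satisfied , λ (a , p) → lose (complete fA a) p)

  ⊨andL : ∀ l {A : Set} (as : List A) f → (l ⊨ andL as f) ⟺ (∀ a → a ∈ as → l ⊨ f a)
  ⊨andL l [] f = (λ _ _ ()) , (λ _ → ⊨tt l)
  ⊨andL l (a ∷ as) f = ⊨∧ l _ _ ⟫ ×-⟺ ⟺-refl (⊨andL l as f) ⟫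
    ((λ { (p , q) _ (here refl) → p ; (p , q) b (there m) → q b m })
    , λ h → h a (here refl) , λ b m → h b (there m))

  ⊨andF : ∀ l {A : Set} (fA : Finite A) f → (l ⊨ andL (elems fA) f) ⟺ (∀ a → l ⊨ f a)
  ⊨andF l fA f = ⊨andL l (elems fA) f ⟫ ((λ h a → h a (complete fA a)) , λ h a _ → h a)

-- Infinite combinatorics

Unbounded : (ℕ → Set) → Set
Unbounded A = ∀ i → Σ ℕ λ j → i ≤ j × A j

sup : ∀ {N} → (Fin N → ℕ) → ℕ
sup {zero}  b = 0
sup {suc N} b = b zero ⊔ⁿ sup (b ∘ suc)

≤sup : ∀ {N} (b : Fin N → ℕ) c → b c ≤ sup b
≤sup b zero    = ℕₚ.m≤m⊔n _ _
≤sup b (suc c) = ℕₚ.≤-trans (≤sup (b ∘ suc) c) (ℕₚ.m≤n⊔m (b zero) _)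

-- If no colour recurred, each would have a bound beyond which it is absent; an element of `A`
-- beyond the maximum of these finitely many bounds has some colour nevertheless.
pigeonhole : EM → ∀ {N} (A : ℕ → Set) (g : ℕ → Fin N) → Unbounded A →
             Σ (Fin N) λ c → Unbounded (λ m → A m × g m ≡ c)
pigeonhole em {N} A g ub = ¬¬-elim em λ none →
  let bound : ∀ c → Σ ℕ λ b → ¬ (Σ ℕ λ j → b ≤ j × A j × g j ≡ c)
      bound c = ¬∀→∃¬ em λ u → none (c , u)
      (j , s≤j , Aj) = ub (sup (proj₁ ∘ bound))
  in proj₂ (bound (g j)) (j , ℕₚ.≤-trans (≤sup (proj₁ ∘ bound) (g j)) s≤j , Aj , refl)

iterate : {X : ℕ → Set} → X 0 → (∀ l → X l → X (suc l)) → ∀ l → X l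
iterate x₀ nx zero    = x₀
iterate x₀ nx (suc l) = nx l (iterate x₀ nx l)

StrictlyIncreasing : (ℕ → ℕ) → Set
StrictlyIncreasing J = ∀ a → J a < J (suc a)

module _ {J : ℕ → ℕ} (inc : StrictlyIncreasing J) where

  inc-mono : ∀ {a b} → a ≤ b → J a ≤ J b
  inc-mono {a} {b} a≤b with ℕₚ.m≤n⇒∃[o]m+o≡n a≤b
  ... | d , refl = go d
    where
    go : ∀ d → J a ≤ J (a + d)
    go zero    = ℕₚ.≤-reflexive (cong J (sym (ℕₚ.+-identityʳ a)))
    go (suc d) = ℕₚ.≤-trans (go d) (ℕₚ.≤-trans (ℕₚ.<⇒≤ (inc (a + d)))
                   (ℕₚ.≤-reflexive (cong J (sym (ℕₚ.+-suc a d)))))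

  inc-≥ : ∀ a → a ≤ J a
  inc-≥ zero    = z≤n
  inc-≥ (suc a) = ℕₚ.≤-trans (s≤s (inc-≥ a)) (inc a)

  inc-strict : ∀ {a b} → a < b → J a < J b
  inc-strict a<b = ℕₚ.≤-trans (inc _) (inc-mono a<b)

  block-unique : ∀ {a b l} → J a ≤ l → l < J (suc a) → J b ≤ l → l < J (suc b) → a ≡ b
  block-unique {a} {b} p q r s with ℕₚ.<-cmp a b
  ... | tri≈ _ e _ = e
  ... | tri< lt _ _ = ⊥-elim (ℕₚ.<-irrefl refl (ℕₚ.<-≤-trans q (ℕₚ.≤-trans (inc-mono lt) r)))
  ... | tri> _ _ gt = ⊥-elim (ℕₚ.<-irrefl refl (ℕₚ.<-≤-trans s (ℕₚ.≤-trans (inc-mono gt) p)))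

-- At each step the remaining positions are thinned out so that all of them get one colour together
-- with the chosen one.
module Ramsey (em : EM) {N : ℕ} (col : ℕ → ℕ → Fin N) where

  abstract
    thin : ∀ A → Unbounded A → Σ ℕ λ h → A h × Σ (Fin N) λ c →
           Unbounded (λ m → (A m × h < m) × col h m ≡ c)
    thin A ub = let (h , _ , Ah) = ub 0 in h , Ah ,
      pigeonhole em (λ m → A m × h < m) (col h) λ i →
        let (j , le , Aj) = ub (i ⊔ⁿ suc h) in
        j , ℕₚ.≤-trans (ℕₚ.m≤m⊔n _ _) le , Aj , ℕₚ.≤-trans (ℕₚ.m≤n⊔m i _) le

  record Stage : Set₁ where
    field
      A     : ℕ → Set
      hd    : ℕ
      hd∈   : A hd
      c     : Fin N
      ub    : Unbounded (λ m → (A m × hd < m) × col hd m ≡ c)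

  open Stage

  mkStage : ∀ A → Unbounded A → Stage
  mkStage A ub = let (h , h∈ , c , ub′) = thin A ub in
    record { A = A ; hd = h ; hd∈ = h∈ ; c = c ; ub = ub′ }

  stage : ℕ → Stage
  stage zero    = mkStage (λ _ → ⊤) λ i → i , ℕₚ.≤-refl , tt
  stage (suc i) = mkStage _ (ub (stage i))

  h : ℕ → ℕ
  h i = hd (stage i)

  shrink : ∀ {i j} → i ≤′ j → ∀ {m} → A (stage j) m → A (stage i) m
  shrink ≤′-refl       p = p
  shrink {i} (≤′-step i≤j) p = shrink {i} i≤j (proj₁ (proj₁ p))

  later : ∀ {i j} → i < j → h i < h j × col (h i) (h j) ≡ c (stage i)
  later {i} {j} i<j =
    let ((_ , lt) , e) = shrink {suc i} {j} (ℕₚ.≤⇒≤′ i<j) {h j} (hd∈ (stage j)) in lt , e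

  abstract
    -- By `later`, the colour of a pair of chosen positions depends on the earlier one alone. A
    -- second use of the pigeonhole principle, now on the stages, keeps those with one common
    -- colour.
    ramsey : Σ (Fin N) λ e → Σ (ℕ → ℕ) λ J → StrictlyIncreasing J ×
             (∀ {a b} → a < b → col (J a) (J b) ≡ e)
    ramsey with pigeonhole em (λ _ → ⊤) (λ i → c (stage i)) (λ i → i , ℕₚ.≤-refl , tt)
    ... | e , ub = e , (λ a → h (n a)) , (λ a → proj₁ (later {n a} {n (suc a)} (n-inc a))) ,
                   λ {a} {b} a<b →
                     trans (proj₂ (later {n a} {n b} (inc-strict n-inc a<b))) (n-col a)
      where
      pos : ℕ → Σ ℕ (λ i → c (stage i) ≡ e)
      pos = iterate (let (j , _ , _ , q) = ub 0 in j , q)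
                    (λ _ (i , _) → let (j , _ , _ , q) = ub (suc i) in j , q)
      n : ℕ → ℕ
      n a = proj₁ (pos a)
      n-inc : StrictlyIncreasing n
      n-inc a = proj₁ (proj₂ (ub (suc (n a))))
      n-col : ∀ a → c (stage (n a)) ≡ e
      n-col a = proj₂ (pos a)

-- Profiles of finite words

_≟ᵛ_ : ∀ {n} → DecidableEquality (Vec Bool n)
_≟ᵛ_ = Vecₚ.≡-dec _≟ᵇ_

module Profile (𝓖 : Tests) (k : ℕ) (δ : Fin k → Fin k → Tests.G 𝓖) (F : Fin k → Bool) where
  open Tests 𝓖

  Entry : Set
  Entry = Fin k × Fin k × Bool

  finEntry : Finite Entry
  finEntry = fin× (finFin k) (fin× (finFin k) finBool)

  Prof : Set
  Prof = Vec Bool (size finEntry)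

  finProf : Finite Prof
  finProf = finVec finBool (size finEntry)

  abstract
    has : Prof → Entry → Bool
    has t x = vlookup t (enc finEntry x)

    mkT : (Entry → Bool) → Prof
    mkT f = tabulate (f ∘ dec finEntry)

    has-mkT : ∀ f x → has (mkT f) x ≡ f x
    has-mkT f x = trans (Vecₚ.lookup∘tabulate (f ∘ dec finEntry) (enc finEntry x))
                        (cong f (dec-enc finEntry x))

    mkT-ext : ∀ {f g} → (∀ x → f x ≡ g x) → mkT f ≡ mkT g
    mkT-ext h = Vecₚ.tabulate-cong (h ∘ dec finEntry)

  finStep : Finite (Fin k × Bool × Bool)
  finStep = fin× (finFin k) (fin× finBool finBool)

  mulAt : Prof → Prof → Entry → (Fin k × Bool × Bool) → Bool
  mulAt t t′ (p , r , c) (q , c₁ , c₂) =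
    has t (p , q , c₁) ∧ has t′ (q , r , c₂) ∧ does (c ≟ᵇ (c₁ ∨ c₂))

  mul : Prof → Prof → Prof
  mul t t′ = mkT λ x → anyF finStep (mulAt t t′ x)

  one : Prof
  one = mkT λ (p , q , c) → does (p Finₚ.≟ q) ∧ not c

  -- Visits to `F` are counted at the source of a transition, in agreement with the half-open
  -- intervals of `Pth`; adjacent factors then neither share nor lose a visit.
  letter : Entry → G
  letter (p , q , c) = δ p q ∧ᵍ ⌜ not c ∨ F p ⌝

  -- The first conjunct rejects vectors outside the image of `mkT`. Profiles are compared as
  -- vectors, and two vectors could agree on every entry without being equal if an entry had several
  -- codes.
  isL : Prof → G
  isL m = ⌜ does (mkT (has m) ≟ᵛ m) ⌝ ∧ᵍ andL (elems finEntry) λ x → if has m x then letter x else ¬ᵍ letter x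

  -- Acceptance of s·e·e·e… from a state of I, for e idempotent.
  lassoAt : Prof → Prof → (Fin k → Bool) → (Fin k × Fin k × Bool) → Bool
  lassoAt s e I (i , q , c) = I i ∧ has (mul s e) (i , q , c) ∧ has e (q , q , true)

  lasso : Prof → Prof → (Fin k → Bool) → Bool
  lasso s e I = anyF finEntry (lassoAt s e I)

  idem : Prof → Bool
  idem e = does (mul e e ≟ᵛ e)

  module Word (em : EM) (M : Model 𝓖) (w : ℕ → Model.L M) where
    open Model M
    open ModelProps em M

    edge : ℕ → Fin k → Fin k → Set
    edge l p q = w l ⊨ δ p q

    Accepts : (Fin k → Bool) → Set
    Accepts I = Σ (ℕ → Fin k) λ ρ → I (ρ 0) ≡ true × (∀ l → edge l (ρ l) (ρ (suc l))) ×
                Unbounded (λ l → F (ρ l) ≡ true)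

    -- The flag true demands a visit to F, the flag false demands nothing.
    Pth : ℕ → ℕ → Entry → Set
    Pth i j (p , q , c) = Σ (ℕ → Fin k) λ ρ → ρ i ≡ p × ρ j ≡ q ×
      (∀ l → i ≤ l → l < j → edge l (ρ l) (ρ (suc l))) ×
      (c ≡ true → Σ ℕ λ l → i ≤ l × l < j × F (ρ l) ≡ true)

    abstract
      ty : ℕ → ℕ → Prof
      ty i j = mkT λ x → truth em (Pth i j x)

      ty⟺ : ∀ i j x → has (ty i j) x ≡ true ⟺ Pth i j x
      ty⟺ i j x = ≡→⟺ (cong (_≡ true) (has-mkT (λ x → truth em (Pth i j x)) x)) ⟫ truth⟺ em _

      ty-unique : ∀ i j f → (∀ x → f x ≡ true ⟺ Pth i j x) → mkT f ≡ ty i j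
      ty-unique i j f h = mkT-ext λ x → bool-ext (h x ⟫ ⟺-sym (truth⟺ em _))

    Pth-cat : ∀ {i j l p q r c₁ c₂} → i ≤ j → j ≤ l →
              Pth i j (p , q , c₁) → Pth j l (q , r , c₂) → Pth i l (p , r , c₁ ∨ c₂)
    Pth-cat {i} {j} {l} {c₁ = c₁} {c₂} i≤j j≤l (ρ , ρi , ρj , ρe , ρf) (σ , σj , σl , σe , σf) =
      τ , trans (τ≤ i i≤j) ρi , trans (τ≥ l j≤l) σl , τe , τf (∨-⟺ {c₁})
      where
      τ : ℕ → Fin k
      τ m with m ℕₚ.<? j
      ... | yes _ = ρ m
      ... | no  _ = σ m
      τ< : ∀ m → m < j → τ m ≡ ρ m
      τ< m m<j with m ℕₚ.<? j
      ... | yes _ = refl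
      ... | no n  = ⊥-elim (n m<j)
      τ≥ : ∀ m → j ≤ m → τ m ≡ σ m
      τ≥ m j≤m with m ℕₚ.<? j
      ... | yes m<j = ⊥-elim (ℕₚ.<⇒≱ m<j j≤m)
      ... | no _    = refl
      τ≤ : ∀ m → m ≤ j → τ m ≡ ρ m
      τ≤ m m≤j with ℕₚ.m≤n⇒m<n∨m≡n m≤j
      ... | inj₁ m<j  = τ< m m<j
      ... | inj₂ refl = trans (τ≥ m ℕₚ.≤-refl) (trans σj (sym ρj))
      τe : ∀ m → i ≤ m → m < l → edge m (τ m) (τ (suc m))
      τe m i≤m m<l with ℕₚ.<-≤-connex m j
      ... | inj₁ m<j = subst₂ (edge m) (sym (τ< m m<j)) (sym (τ≤ (suc m) m<j)) (ρe m i≤m m<j)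
      ... | inj₂ j≤m = subst₂ (edge m) (sym (τ≥ m j≤m)) (sym (τ≥ (suc m) (ℕₚ.m≤n⇒m≤1+n j≤m)))
                         (σe m j≤m m<l)
      τf : (c₁ ∨ c₂ ≡ true ⟺ (c₁ ≡ true ⊎ c₂ ≡ true)) → c₁ ∨ c₂ ≡ true →
           Σ ℕ λ m → i ≤ m × m < l × F (τ m) ≡ true
      τf (f , _) c with f c
      ... | inj₁ c = let (m , i≤m , m<j , Fm) = ρf c in
        m , i≤m , ℕₚ.<-≤-trans m<j j≤l , trans (cong F (τ< m m<j)) Fm
      ... | inj₂ c = let (m , j≤m , m<l , Fm) = σf c in
        m , ℕₚ.≤-trans i≤j j≤m , m<l , trans (cong F (τ≥ m j≤m)) Fm

    Pth-split : ∀ {i j l p r c} → i ≤ j → j ≤ l → Pth i l (p , r , c) →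
                Σ (Fin k × Bool × Bool) λ (q , c₁ , c₂) →
                Pth i j (p , q , c₁) × Pth j l (q , r , c₂) × c ≡ c₁ ∨ c₂
    Pth-split {j = j} {c = c} i≤j j≤l (ρ , ρi , ρl , ρe , ρf) = cut c ρf
      where
      left  = λ m i≤m m<j → ρe m i≤m (ℕₚ.<-≤-trans m<j j≤l)
      right = λ m j≤m m<l → ρe m (ℕₚ.≤-trans i≤j j≤m) m<l
      cut : ∀ c → (c ≡ true → _) → Σ _ λ _ → _ × _ × c ≡ _
      cut false _ = (ρ j , false , false) , (ρ , ρi , refl , left , λ ()) ,
                    (ρ , refl , ρl , right , λ ()) , refl
      cut true h with h refl
      ... | m , i≤m , m<l , Fm with ℕₚ.<-≤-connex m j
      ...   | inj₁ m<j = (ρ j , true , false) , (ρ , ρi , refl , left , λ _ → m , i≤m , m<j , Fm) ,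
                         (ρ , refl , ρl , right , λ ()) , refl
      ...   | inj₂ j≤m = (ρ j , false , true) , (ρ , ρi , refl , left , λ ()) ,
                         (ρ , refl , ρl , right , λ _ → m , j≤m , m<l , Fm) , refl

    ty-mul : ∀ {i j l} → i ≤ j → j ≤ l → mul (ty i j) (ty j l) ≡ ty i l
    ty-mul {i} {j} {l} i≤j j≤l = ty-unique i l _ λ x@(p , r , c) →
      anyF⟺ finStep _ ⟫
      ((λ ((q , c₁ , c₂) , h) →
          let (h₁ , h′) = proj₁ ∧-⟺ h ; (h₂ , h₃) = proj₁ ∧-⟺ h′ in
          subst (λ c → Pth i l (p , r , c)) (sym (proj₁ (does⟺ (c ≟ᵇ (c₁ ∨ c₂))) h₃))
            (Pth-cat i≤j j≤l (proj₁ (ty⟺ i j _) h₁) (proj₁ (ty⟺ j l _) h₂)))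
      , λ π → let ((q , c₁ , c₂) , π₁ , π₂ , e) = Pth-split i≤j j≤l π in
          (q , c₁ , c₂) , proj₂ ∧-⟺ (proj₂ (ty⟺ i j _) π₁ , proj₂ ∧-⟺
            (proj₂ (ty⟺ j l _) π₂ , proj₂ (does⟺ (c ≟ᵇ (c₁ ∨ c₂))) e)))

    ty-one : ∀ i → one ≡ ty i i
    ty-one i = ty-unique i i _ λ (p , q , c) → ∧-⟺ ⟫ ×-⟺ (does⟺ (p Finₚ.≟ q)) (not-⟺ {c}) ⟫
      ((λ { (refl , n) → (λ _ → p) , refl , refl ,
              (λ m i≤m m<i → ⊥-elim (ℕₚ.<⇒≱ m<i i≤m)) , λ c → ⊥-elim (n c) })
      , λ (ρ , ρi , ρi′ , _ , ρf) → trans (sym ρi) ρi′ ,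
          λ c → let (m , i≤m , m<i , _) = ρf c in ℕₚ.<⇒≱ m<i i≤m)

    letter⟺ : ∀ l x → (w l ⊨ letter x) ⟺ Pth l (suc l) x
    letter⟺ l (p , q , c) = ⊨∧ (w l) _ _ ⟫ ×-⟺ ⟺-refl (⊨⌜⌝ (w l) (not c ∨ F p)) ⟫ (to , from)
      where
      between : ∀ {m} → l ≤ m → m < suc l → l ≡ m
      between l≤m (s≤s m≤l) = ℕₚ.≤-antisym l≤m m≤l
      to : edge l p q × not c ∨ F p ≡ true → Pth l (suc l) (p , q , c)
      to (e , f) = ρ , ρl , ρl+ ,
        (λ m l≤m m<l → subst (λ m → edge m (ρ m) (ρ (suc m))) (between l≤m m<l)
           (subst₂ (edge l) (sym ρl) (sym ρl+) e)) ,
        λ { refl → l , ℕₚ.≤-refl , ℕₚ.≤-refl , trans (cong F ρl) f }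
        where
        ρ : ℕ → Fin k
        ρ m with m ℕₚ.≟ l
        ... | yes _ = p
        ... | no _  = q
        ρl : ρ l ≡ p
        ρl with l ℕₚ.≟ l
        ... | yes _ = refl
        ... | no n  = ⊥-elim (n refl)
        ρl+ : ρ (suc l) ≡ q
        ρl+ with suc l ℕₚ.≟ l
        ... | yes e = ⊥-elim (ℕₚ.1+n≢n e)
        ... | no _  = refl
      from : Pth l (suc l) (p , q , c) → edge l p q × not c ∨ F p ≡ true
      from (ρ , refl , refl , ρe , ρf) = ρe l ℕₚ.≤-refl ℕₚ.≤-refl , flag c ρf
        where
        flag : ∀ c → (c ≡ true → _) → not c ∨ F (ρ l) ≡ true
        flag false _ = refl
        flag true h  = let (m , l≤m , m<l , Fm) = h refl in
          subst (λ m → F (ρ m) ≡ true) (sym (between l≤m m<l)) Fm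

    isL⟺ : ∀ l m → (w l ⊨ isL m) ⟺ (m ≡ ty l (suc l))
    isL⟺ l m = ⊨∧ (w l) _ _ ⟫ ×-⟺ (⊨⌜⌝ (w l) _ ⟫ does⟺ (mkT (has m) ≟ᵛ m)) (⊨andF (w l) finEntry _) ⟫
      ((λ (norm , h) → trans (sym norm) (ty-unique l (suc l) (has m) λ x → here⟺ x (h x)))
      , λ { refl → ty-unique l (suc l) _ (ty⟺ l (suc l)) , λ x → there⟺ x })
      where
      here⟺ : ∀ x → (w l ⊨ (if has m x then letter x else ¬ᵍ letter x)) →
              has m x ≡ true ⟺ Pth l (suc l) x
      here⟺ x h with has m x
      ... | true  = (λ _ → proj₁ (letter⟺ l x) h) , λ _ → refl
      ... | false = (λ ()) , λ π → ⊥-elim (proj₁ (⊨¬ (w l) _) h (proj₂ (letter⟺ l x) π))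
      there⟺ : ∀ x → w l ⊨ (if has (ty l (suc l)) x then letter x else ¬ᵍ letter x)
      there⟺ x with has (ty l (suc l)) x | ty⟺ l (suc l) x
      ... | true  | f , _ = proj₂ (letter⟺ l x) (f refl)
      ... | false | _ , g = proj₂ (⊨¬ (w l) _) λ p → true≢false (sym (g (proj₁ (letter⟺ l x) p)))

    record Factor (s e : Prof) : Set where
      field
        J     : ℕ → ℕ
        inc   : StrictlyIncreasing J
        head  : ty 0 (J 0) ≡ s
        block : ∀ a → ty (J a) (J (suc a)) ≡ e
        idemp : mul e e ≡ e

      blocks : ∀ {a b} → a < b → ty (J a) (J b) ≡ e
      blocks {a} {suc b} (s≤s a≤b) with ℕₚ.m≤n⇒m<n∨m≡n a≤b
      ... | inj₂ refl = block a
      ... | inj₁ a<b  = trans (sym (ty-mul (inc-mono inc a≤b) (ℕₚ.<⇒≤ (inc b))))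
                              (trans (cong₂ mul (blocks a<b) (block b)) idemp)

    factorisation : Σ Prof λ s → Σ Prof λ e → Factor s e
    factorisation = s , e , record
      { J = J ; inc = inc ; head = refl ; block = λ a → col ℕₚ.≤-refl
      -- The factors from `J 0` to `J 1`, from `J 1` to `J 2` and from `J 0` to `J 2` all have
      -- colour `e`, whence `e` is idempotent.
      ; idemp = trans (cong₂ mul (sym (col {0} {1} ℕₚ.≤-refl)) (sym (col {1} {2} ℕₚ.≤-refl)))
                  (trans (ty-mul (ℕₚ.<⇒≤ (inc 0)) (ℕₚ.<⇒≤ (inc 1))) (col {0} {2} (s≤s z≤n))) }
      where
      R = Ramsey.ramsey em λ i j → enc finProf (ty i j)
      J = proj₁ (proj₂ R)
      inc = proj₁ (proj₂ (proj₂ R))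
      e = dec finProf (proj₁ R)
      s = ty 0 (J 0)
      col : ∀ {a b} → a < b → ty (J a) (J b) ≡ e
      col a<b = trans (sym (dec-enc finProf _)) (cong (dec finProf) (proj₂ (proj₂ (proj₂ R)) a<b))

    run-Pth : ∀ {ρ} → (∀ l → edge l (ρ l) (ρ (suc l))) → ∀ i j → Pth i j (ρ i , ρ j , false)
    run-Pth {ρ} ρe i j = ρ , refl , refl , (λ l _ _ → ρe l) , λ ()

    -- The global run reads at position `l` the run of the block containing `l`. `At` carries this
    -- block along; consecutive blocks agree at their common boundary, and `block-unique` recovers
    -- the block where the first state or a visit has to be identified.
    glue : {J : ℕ → ℕ} → StrictlyIncreasing J → J 0 ≡ 0 → (r : ℕ → Fin k) → (c : ℕ → Bool) →
           (∀ a → Pth (J a) (J (suc a)) (r a , r (suc a) , c a)) →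
           Σ (ℕ → Fin k) λ ρ → ρ 0 ≡ r 0 × (∀ l → edge l (ρ l) (ρ (suc l))) ×
             (∀ a → c a ≡ true → Σ ℕ λ l → J a ≤ l × F (ρ l) ≡ true)
    glue {J} inc J0 r c π = (λ l → proj₁ (at l)) ,
      start (at 0) ,
      (λ l → proj₂ (step l (at l))) , visit
      where
      At : ℕ → Set
      At l = Σ (Fin k) λ q → Σ ℕ λ a → J a ≤ l × l < J (suc a) × q ≡ proj₁ (π a) l
      step : ∀ l (x : At l) → Σ (At (suc l)) λ y → edge l (proj₁ x) (proj₁ y)
      step l (q , a , ge , lt , refl) with ℕₚ.m≤n⇒m<n∨m≡n lt
      ... | inj₁ lt′ = (_ , a , ℕₚ.m≤n⇒m≤1+n ge , lt′ , refl) ,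
                       proj₁ (proj₂ (proj₂ (proj₂ (π a)))) l ge lt
      ... | inj₂ e   = (_ , suc a , ℕₚ.≤-reflexive (sym e) ,
                          subst (_< J (suc (suc a))) (sym e) (inc (suc a)) , refl) ,
                       subst (edge l (proj₁ (π a) l))
                         (trans (trans (cong (proj₁ (π a)) e) (proj₁ (proj₂ (proj₂ (π a)))))
                           (trans (sym (proj₁ (proj₂ (π (suc a))))) (cong (proj₁ (π (suc a))) (sym e))))
                         (proj₁ (proj₂ (proj₂ (proj₂ (π a)))) l ge lt)
      at : ∀ l → At l
      at = iterate (_ , 0 , ℕₚ.≤-reflexive J0 , subst (_< J 1) J0 (inc 0) , refl)
                   (λ l x → proj₁ (step l x))
      start : (x : At 0) → proj₁ x ≡ r 0
      start (_ , a , ge , lt , refl) with block-unique inc ge lt (ℕₚ.≤-reflexive J0) (subst (_< J 1) J0 (inc 0))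
      ... | refl = trans (cong (proj₁ (π 0)) (sym J0)) (proj₁ (proj₂ (π 0)))
      visit : ∀ a → c a ≡ true → Σ ℕ λ l → J a ≤ l × F (proj₁ (at l)) ≡ true
      visit a ca with proj₂ (proj₂ (proj₂ (proj₂ (π a)))) ca
      ... | l , ge , lt , Fl = l , ge , found (at l)
        where
        found : (x : At l) → F (proj₁ x) ≡ true
        found (_ , b , ge′ , lt′ , refl) with block-unique inc ge′ lt′ ge lt
        ... | refl = Fl

    module _ {s e : Prof} (fac : Factor s e) (I : Fin k → Bool) where
      open Factor fac

      lasso-sound : lasso s e I ≡ true → Accepts I
      lasso-sound h = out (glue {J′} inc′ refl r c π)
        where
        W = proj₁ (anyF⟺ finEntry (lassoAt s e I)) h
        i = proj₁ (proj₁ W)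
        q = proj₁ (proj₂ (proj₁ W))
        Ii = proj₁ (proj₁ ∧-⟺ (proj₂ W))
        h₁ = proj₁ (proj₁ ∧-⟺ (proj₂ (proj₁ (∧-⟺ {I i}) (proj₂ W))))
        h₂ = proj₂ (proj₁ (∧-⟺ {has (mul s e) _}) (proj₂ (proj₁ (∧-⟺ {I i}) (proj₂ W))))
        -- The boundary `J 0` is dropped: block 0 then has the profile `mul s e` that `lasso` speaks
        -- of.
        J′ : ℕ → ℕ
        J′ zero    = 0
        J′ (suc a) = J (suc a)
        inc′ : StrictlyIncreasing J′
        inc′ zero    = ℕₚ.≤-<-trans z≤n (inc 0)
        inc′ (suc a) = inc (suc a)
        r : ℕ → Fin k
        r zero    = i
        r (suc a) = q
        c : ℕ → Bool
        c zero    = proj₂ (proj₂ (proj₁ W))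
        c (suc a) = true
        π : ∀ a → Pth (J′ a) (J′ (suc a)) (r a , r (suc a) , c a)
        π zero    = proj₁ (ty⟺ 0 (J 1) _) (subst (λ t → has t _ ≡ true)
          (trans (cong₂ mul (sym head) (sym (block 0))) (ty-mul z≤n (ℕₚ.<⇒≤ (inc 0)))) h₁)
        π (suc a) = proj₁ (ty⟺ _ _ _) (subst (λ t → has t _ ≡ true) (sym (block (suc a))) h₂)
        out : _ → Accepts I
        out (ρ , ρ0 , ρe , ρF) = ρ , trans (cong I ρ0) Ii , ρe ,
          λ l → let (m , ge , Fm) = ρF (suc l) refl in
            m , ℕₚ.≤-trans (ℕₚ.≤-trans (ℕₚ.n≤1+n l) (inc-≥ inc (suc l))) ge , Fm

      lasso-complete : Accepts I → lasso s e I ≡ true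
      lasso-complete (ρ , Iρ , ρe , ρF) =
        -- Some state `q` recurs at block boundaries. The first boundary `a` is at least 1 so that
        -- the prefix has profile `mul s e`; the second, `b`, lies beyond a visit to `F` after
        -- `J a`, which makes the loop at `q` accepting. All blocks between them multiply to `e`.
        let (q , ub) = pigeonhole em (λ _ → ⊤) (λ a → ρ (J a)) (λ i → i , ℕₚ.≤-refl , tt)
            (a , 1≤a , _ , ρa) = ub 1
            (l , Ja≤l , Fl) = ρF (J a)
            (b , l<b , _ , ρb) = ub (suc l)
            l<Jb = ℕₚ.<-≤-trans l<b (inc-≥ inc b)
            a<b = ℕₚ.≰⇒> λ b≤a → ℕₚ.<⇒≱ l<Jb (ℕₚ.≤-trans (inc-mono inc b≤a) Ja≤l)
            J0≤Ja = inc-mono inc (z≤n {a})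
            s·e : mul s e ≡ ty 0 (J a)
            s·e = trans (cong₂ mul (sym head) (sym (blocks 1≤a))) (ty-mul z≤n J0≤Ja)
        in proj₂ (anyF⟺ finEntry (lassoAt s e I)) ((ρ 0 , q , false) ,
          proj₂ ∧-⟺ (Iρ , proj₂ ∧-⟺
            ( subst (λ t → has t (ρ 0 , q , false) ≡ true) (sym s·e) (proj₂ (ty⟺ _ _ _)
                (subst (λ r → Pth 0 (J a) (ρ 0 , r , false)) ρa (run-Pth ρe 0 (J a))))
            , subst (λ t → has t (q , q , true) ≡ true) (blocks a<b) (proj₂ (ty⟺ _ _ _)
                (ρ , ρa , ρb , (λ l _ _ → ρe l) , λ _ → l , Ja≤l , l<Jb , Fl)))))

      lasso⟺ : lasso s e I ≡ true ⟺ Accepts I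
      lasso⟺ = lasso-sound , lasso-complete

-- Büchi automata with tests on their transitions

record Aut (𝓖 : Tests) (Q : Set) : Set where
  constructor aut
  field
    I : Q → Bool
    δ : Q → Q → Tests.G 𝓖
    F : Q → Bool

NBA : Tests → Set
NBA 𝓖 = Σ ℕ λ k → Aut 𝓖 (Fin k)

Acc : {𝓖 : Tests} (M : Model 𝓖) {Q : Set} → Aut 𝓖 Q → (ℕ → Model.L M) → Set
Acc M {Q} A w = Σ (ℕ → Q) λ ρ → I (ρ 0) ≡ true × (∀ l → w l ⊨ δ (ρ l) (ρ (suc l))) ×
                Unbounded (λ l → F (ρ l) ≡ true)
  where open Aut A
        open Model M

toNBA : {𝓖 : Tests} {Q : Set} → Finite Q → Aut 𝓖 Q → NBA 𝓖
toNBA fQ (aut I δ F) =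
  size fQ , aut (I ∘ dec fQ) (λ i j → δ (dec fQ i) (dec fQ j)) (F ∘ dec fQ)

toNBA⟺ : {𝓖 : Tests} (M : Model 𝓖) {Q : Set} (fQ : Finite Q) (A : Aut 𝓖 Q) (w : ℕ → Model.L M) →
         Acc M (proj₂ (toNBA fQ A)) w ⟺ Acc M A w
toNBA⟺ M fQ (aut I δ F) w =
  (λ (ρ , h₁ , h₂ , h₃) → dec fQ ∘ ρ , h₁ , h₂ , h₃) ,
  λ (ρ , h₁ , h₂ , h₃) → enc fQ ∘ ρ ,
    trans (cong I (dec-enc fQ _)) h₁ ,
    (λ l → subst₂ (λ p q → w l ⊨ δ p q) (sym (dec-enc fQ _)) (sym (dec-enc fQ _)) (h₂ l)) ,
    λ l → let (j , le , Fj) = h₃ l in j , le , trans (cong F (dec-enc fQ _)) Fj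
  where open Model M

eqF : {A : Set} → Finite A → DecidableEquality A
eqF fA a b = map′ (λ e → trans (sym (dec-enc fA a)) (trans (cong (dec fA) e) (dec-enc fA b)))
                  (cong (enc fA)) (enc fA a Finₚ.≟ enc fA b)

-- The automaton guesses a factorisation s·e·e·e… of the word.
module Combine (𝓖 : Tests) (k : ℕ) (δ : Fin k → Fin k → Tests.G 𝓖) (F : Fin k → Bool)
               (β : Bool → Bool → Bool) (I₁ I₂ : Fin k → Bool) where
  open Tests 𝓖
  open Profile 𝓖 k δ F

  -- `inj₁ t`: still in the head, with `t` the profile of the prefix read so far.
  -- `inj₂ (e , t , b)`: committed to `e`, with `t` the profile of the part of the current block
  -- already read; `b` marks the first letter of a block. A new block may begin only if `t` is `e`,
  -- so infinitely many marked states mean infinitely many blocks of profile `e`.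
  State : Set
  State = Prof ⊎ (Prof × Prof × Bool)

  finState : Finite State
  finState = fin⊎ finProf (fin× finProf (fin× finProf finBool))

  extend : Prof → Prof → G
  extend t t′ = orL (elems finProf) λ m → if does (mul t m ≟ᵛ t′) then isL m else ffᵍ

  -- The pair `s`, `e` determines acceptance from both sets of initial states. Any Boolean
  -- combination, complement included, is therefore decided at the moment of committing to `e`.
  good : Prof → Prof → Bool
  good s e = idem e ∧ β (lasso s e I₁) (lasso s e I₂)

  trans-test : State → State → G
  trans-test (inj₁ t) (inj₁ t′) = extend t t′
  trans-test (inj₁ t) (inj₂ (e , t′ , true)) = ⌜ good t e ⌝ ∧ᵍ isL t′
  trans-test (inj₁ t) (inj₂ (e , t′ , false)) = ffᵍ
  trans-test (inj₂ _) (inj₁ _) = ffᵍ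
  trans-test (inj₂ (e , t , _)) (inj₂ (e′ , t′ , true)) =
    ⌜ does (e ≟ᵛ e′) ∧ does (t ≟ᵛ e) ⌝ ∧ᵍ isL t′
  trans-test (inj₂ (e , t , _)) (inj₂ (e′ , t′ , false)) = ⌜ does (e ≟ᵛ e′) ⌝ ∧ᵍ extend t t′

  initial final : State → Bool
  initial (inj₁ t) = does (t ≟ᵛ one)
  initial (inj₂ _) = false
  final (inj₁ _) = false
  final (inj₂ (_ , _ , b)) = b

  combined : Aut 𝓖 State
  combined = aut initial trans-test final

  module Correct (em : EM) (M : Model 𝓖) (w : ℕ → Model.L M) where
    open Model M
    open ModelProps em M
    open Word em M w

    extend⟺ : ∀ l t t′ → (w l ⊨ extend t t′) ⟺ (t′ ≡ mul t (ty l (suc l)))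
    extend⟺ l t t′ = ⊨orF (w l) finProf _ ⟫ (to , from)
      where
      to : (Σ Prof λ m → w l ⊨ (if does (mul t m ≟ᵛ t′) then isL m else ffᵍ)) →
           t′ ≡ mul t (ty l (suc l))
      to (m , h) with mul t m ≟ᵛ t′
      ... | yes refl = cong (mul t) (proj₁ (isL⟺ l m) h)
      ... | no _     = ⊥-elim (⊨ff (w l) h)
      from : t′ ≡ mul t (ty l (suc l)) →
             Σ Prof λ m → w l ⊨ (if does (mul t m ≟ᵛ t′) then isL m else ffᵍ)
      from refl = ty l (suc l) , sub
        where
        sub : w l ⊨ (if does (mul t (ty l (suc l)) ≟ᵛ mul t (ty l (suc l)))
                     then isL (ty l (suc l)) else ffᵍ)
        sub with mul t (ty l (suc l)) ≟ᵛ mul t (ty l (suc l))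
        ... | yes _ = proj₂ (isL⟺ l _) refl
        ... | no n  = ⊥-elim (n refl)

    pre-step : ∀ l t e t′ → (w l ⊨ trans-test (inj₁ t) (inj₂ (e , t′ , true))) ⟺
               (good t e ≡ true × t′ ≡ ty l (suc l))
    pre-step l t e t′ = ⊨∧ (w l) _ _ ⟫ ×-⟺ (⊨⌜⌝ (w l) _) (isL⟺ l t′)

    reset-step : ∀ l e t b e′ t′ →
      (w l ⊨ trans-test (inj₂ (e , t , b)) (inj₂ (e′ , t′ , true))) ⟺
      ((e ≡ e′ × t ≡ e) × t′ ≡ ty l (suc l))
    reset-step l e t b e′ t′ = ⊨∧ (w l) _ _ ⟫ ×-⟺ (⊨⌜⌝ (w l) _ ⟫ ∧-⟺ ⟫
      ×-⟺ (does⟺ (e ≟ᵛ e′)) (does⟺ (t ≟ᵛ e))) (isL⟺ l t′)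

    go-step : ∀ l e t b e′ t′ →
      (w l ⊨ trans-test (inj₂ (e , t , b)) (inj₂ (e′ , t′ , false))) ⟺
      (e ≡ e′ × t′ ≡ mul t (ty l (suc l)))
    go-step l e t b e′ t′ = ⊨∧ (w l) _ _ ⟫ ×-⟺ (⊨⌜⌝ (w l) _ ⟫ does⟺ (e ≟ᵛ e′)) (extend⟺ l t t′)

    from-pre : ∀ l t y → w l ⊨ trans-test (inj₁ t) y → (y ≡ inj₁ (mul t (ty l (suc l)))) ⊎
               Σ Prof λ e → good t e ≡ true × y ≡ inj₂ (e , ty l (suc l) , true)
    from-pre l t (inj₁ t′) h = inj₁ (cong inj₁ (proj₁ (extend⟺ l t t′) h))
    from-pre l t (inj₂ (e , t′ , true)) h = let (gd , eq) = proj₁ (pre-step l t e t′) h in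
      inj₂ (e , gd , cong (λ t → inj₂ (e , t , true)) eq)
    from-pre l t (inj₂ (e , t′ , false)) h = ⊥-elim (⊨ff (w l) h)

    from-block : ∀ l e t b y → w l ⊨ trans-test (inj₂ (e , t , b)) y →
                 (t ≡ e × y ≡ inj₂ (e , ty l (suc l) , true)) ⊎
                 (y ≡ inj₂ (e , mul t (ty l (suc l)) , false))
    from-block l e t b (inj₁ _) h = ⊥-elim (⊨ff (w l) h)
    from-block l e t b (inj₂ (e′ , t′ , true)) h with proj₁ (reset-step l e t b e′ t′) h
    ... | (refl , eq) , refl = inj₁ (eq , refl)
    from-block l e t b (inj₂ (e′ , t′ , false)) h with proj₁ (go-step l e t b e′ t′) h
    ... | refl , refl = inj₂ refl

    accept-factor : ∀ {s e} → Factor s e → good s e ≡ true → Acc M combined w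
    accept-factor {s} {e} fac gd = (λ l → proj₁ (run l)) , start (run 0) , (λ l → proj₂ (step l (run l))) ,
      λ l → suc (J l) , ℕₚ.m≤n⇒m≤1+n (inc-≥ inc l) , visit l (run (suc (J l)))
      where
      open Factor fac
      Inv : ℕ → State → Set
      Inv l (inj₁ t) = t ≡ ty 0 l × l ≤ J 0
      Inv l (inj₂ (e′ , t , b)) = e′ ≡ e × Σ ℕ λ a → J a < l × l ≤ J (suc a) × t ≡ ty (J a) l ×
                                  (l ≡ suc (J a) → b ≡ true)
      step : ∀ l (x : Σ State (Inv l)) →
             Σ (Σ State (Inv (suc l))) λ y → w l ⊨ trans-test (proj₁ x) (proj₁ y)
      step l (inj₁ t , refl , le) with ℕₚ.m≤n⇒m<n∨m≡n le
      ... | inj₁ lt = (inj₁ (ty 0 (suc l)) , refl , lt) ,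
                      proj₂ (extend⟺ l _ _) (sym (ty-mul z≤n (ℕₚ.n≤1+n l)))
      ... | inj₂ refl = (inj₂ (e , ty l (suc l) , true) , refl , 0 , ℕₚ.≤-refl , inc 0 , refl , λ _ → refl) ,
                        proj₂ (pre-step l (ty 0 l) e (ty l (suc l))) (subst (λ s → good s e ≡ true) (sym head) gd , refl)
      step l (inj₂ (_ , t , b) , refl , a , lt , le , refl , _) with ℕₚ.m≤n⇒m<n∨m≡n le
      ... | inj₁ lt′ = (inj₂ (e , ty (J a) (suc l) , false) , refl , a , ℕₚ.m≤n⇒m≤1+n lt , lt′ , refl ,
                         λ eq → ⊥-elim (ℕₚ.<-irrefl (sym (ℕₚ.suc-injective eq)) lt)) ,
                       proj₂ (go-step l e (ty (J a) l) b e (ty (J a) (suc l))) (refl , sym (ty-mul (ℕₚ.<⇒≤ lt) (ℕₚ.n≤1+n l)))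
      ... | inj₂ refl = (inj₂ (e , ty l (suc l) , true) , refl , suc a , ℕₚ.≤-refl , inc (suc a) , refl , λ _ → refl) ,
                        proj₂ (reset-step l e (ty (J a) l) b e (ty l (suc l))) ((refl , block a) , refl)
      run : ∀ l → Σ State (Inv l)
      run = iterate (inj₁ one , ty-one 0 , z≤n) (λ l x → proj₁ (step l x))
      start : (x : Σ State (Inv 0)) → initial (proj₁ x) ≡ true
      start (inj₁ t , refl , _) = proj₂ (does⟺ (ty 0 0 ≟ᵛ one)) (sym (ty-one 0))
      start (inj₂ _ , _ , _ , () , _)
      visit : ∀ l (x : Σ State (Inv (suc (J l)))) → final (proj₁ x) ≡ true
      visit l (inj₁ t , _ , lt) = ⊥-elim (ℕₚ.<⇒≱ lt (inc-mono inc z≤n))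
      visit l (inj₂ (_ , t , b) , _ , a , s≤s ge , lt , _ , h)
        with block-unique inc ge lt ℕₚ.≤-refl (inc l)
      ... | refl = h refl

    factor-accept : Acc M combined w → Σ Prof λ s → Σ Prof λ e → Factor s e × good s e ≡ true
    factor-accept (ρ , ini , ρe , ρF) =
      let (l , _ , Fl) = ρF 0 in [ (λ eq → ⊥-elim (true≢false (trans (sym Fl) (cong final eq)))) , main ]′ (phase l)
      where
      Reset : Prof → ℕ → Set
      Reset e l = ρ (suc l) ≡ inj₂ (e , ty l (suc l) , true)
      Switch : Set
      Switch = Σ ℕ λ l → Σ Prof λ e → good (ty 0 l) e ≡ true × Reset e l
      phase : ∀ l → ρ l ≡ inj₁ (ty 0 l) ⊎ Switch
      phase zero = inj₁ (first (ρ 0) ini)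
        where
        first : ∀ q → initial q ≡ true → q ≡ inj₁ (ty 0 0)
        first (inj₁ t) h = cong inj₁ (trans (proj₁ (does⟺ (t ≟ᵛ one)) h) (ty-one 0))
      phase (suc l) with phase l
      ... | inj₂ sw = inj₂ sw
      ... | inj₁ eq with from-pre l (ty 0 l) (ρ (suc l)) (subst (λ q → w l ⊨ trans-test q (ρ (suc l))) eq (ρe l))
      ...   | inj₁ eq′ = inj₁ (trans eq′ (cong inj₁ (ty-mul z≤n (ℕₚ.n≤1+n l))))
      ...   | inj₂ (e , gd , eq′) = inj₂ (l , e , gd , eq′)
      main : Switch → Σ Prof λ s → Σ Prof λ e → Factor s e × good s e ≡ true
      main (l₀ , e , gd , r₀) = ty 0 l₀ , e , fac , gd
        where
        -- The number `d` is the distance to a position known to be marked; the search for the next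
        -- reset descends on it.
        walk : ∀ d {l m} b → l < m → ρ m ≡ inj₂ (e , ty l m , b) → final (ρ (d + suc m)) ≡ true →
               Σ ℕ λ l′ → l < l′ × ty l l′ ≡ e × Reset e l′
        walk d {l} {m} b lt eq Fd
          with from-block m e (ty l m) b (ρ (suc m)) (subst (λ q → w m ⊨ trans-test q (ρ (suc m))) eq (ρe m))
        ... | inj₁ (t≡e , eq′) = m , lt , t≡e , eq′
        walk zero {l} {m} b lt eq Fd | inj₂ eq′ = ⊥-elim (true≢false (trans (sym Fd) (cong final eq′)))
        walk (suc d) {l} {m} b lt eq Fd | inj₂ eq′ = walk d false (ℕₚ.m≤n⇒m≤1+n lt)
          (trans eq′ (cong (λ t → inj₂ (e , t , false)) (ty-mul (ℕₚ.<⇒≤ lt) (ℕₚ.n≤1+n m))))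
          (subst (λ z → final (ρ z) ≡ true) (sym (ℕₚ.+-suc d (suc m))) Fd)
        abstract
          next-reset : ∀ l → Reset e l → Σ ℕ λ l′ → l < l′ × ty l l′ ≡ e × Reset e l′
          -- The state at `suc l` is the reset itself, hence the next marked state is sought from
          -- `suc (suc l)` on.
          next-reset l r = let (j , le , Fj) = ρF (suc (suc l)) in
            walk (j ∸ suc (suc l)) true ℕₚ.≤-refl r
              (subst (λ z → final (ρ z) ≡ true) (sym (ℕₚ.m∸n+n≡m le)) Fj)
        resets : ℕ → Σ ℕ (Reset e)
        resets = iterate (l₀ , r₀) λ _ (l , r) → let (l′ , _ , _ , r′) = next-reset l r in l′ , r′
        fac : Factor (ty 0 l₀) e
        fac = record
          { J     = λ a → proj₁ (resets a)
          ; inc   = λ a → proj₁ (proj₂ (next-reset _ (proj₂ (resets a))))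
          ; head  = refl
          ; block = λ a → proj₁ (proj₂ (proj₂ (next-reset _ (proj₂ (resets a)))))
          ; idemp = proj₁ (does⟺ (mul e e ≟ᵛ e)) (proj₁ (proj₁ ∧-⟺ gd)) }

    combined⟺ : Acc M combined w ⟺ (β (truth em (Accepts I₁)) (truth em (Accepts I₂)) ≡ true)
    combined⟺ =
      (λ acc → let (s , e , fac , gd) = factor-accept acc in
        trans (sym (β-eq fac)) (proj₂ (proj₁ (∧-⟺ {idem e}) gd))) ,
      λ h → let (s , e , fac) = factorisation in accept-factor fac
        (proj₂ ∧-⟺ (proj₂ (does⟺ (mul e e ≟ᵛ e)) (Factor.idemp fac) , trans (β-eq fac) h))
      where
      β-eq : ∀ {s e} → Factor s e → β (lasso s e I₁) (lasso s e I₂) ≡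
             β (truth em (Accepts I₁)) (truth em (Accepts I₂))
      β-eq fac = cong₂ β (bool-ext (lasso⟺ fac I₁ ⟫ ⟺-sym (truth⟺ em _)))
                         (bool-ext (lasso⟺ fac I₂ ⟫ ⟺-sym (truth⟺ em _)))

-- The two components of the union are told apart by the initial states.
module _ {𝓖 : Tests} where
  open Tests 𝓖

  union-δ : ∀ {P Q : Set} → Aut 𝓖 P → Aut 𝓖 Q → P ⊎ Q → P ⊎ Q → G
  union-δ A B (inj₁ p) (inj₁ p′) = Aut.δ A p p′
  union-δ A B (inj₂ q) (inj₂ q′) = Aut.δ B q q′
  union-δ A B _ _ = ffᵍ

  union-F : ∀ {P Q : Set} → Aut 𝓖 P → Aut 𝓖 Q → P ⊎ Q → Bool
  union-F A B = [ Aut.F A , Aut.F B ]′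

  left-I right-I : ∀ {P Q : Set} → Aut 𝓖 P → Aut 𝓖 Q → P ⊎ Q → Bool
  left-I  A B = [ Aut.I A , (λ _ → false) ]′
  right-I A B = [ (λ _ → false) , Aut.I B ]′

  module _ (em : EM) (M : Model 𝓖) {P Q : Set} (A : Aut 𝓖 P) (B : Aut 𝓖 Q) (w : ℕ → Model.L M) where
    open Model M
    open ModelProps em M

    union-left : Acc M (aut (left-I A B) (union-δ A B) (union-F A B)) w ⟺ Acc M A w
    union-left = to , λ (ρ , r) → inj₁ ∘ ρ , r
      where
      to : Acc M (aut (left-I A B) (union-δ A B) (union-F A B)) w → Acc M A w
      to (ρ , ini , ρe , ρF) = σ , trans (cong (left-I A B) (sym (eq 0))) ini ,
        (λ l → subst₂ (λ p q → w l ⊨ union-δ A B p q) (eq l) (eq (suc l)) (ρe l)) ,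
        λ l → let (j , le , Fj) = ρF l in j , le , trans (cong (union-F A B) (sym (eq j))) Fj
        where
        Is : ℕ → Set
        Is l = Σ P λ p → ρ l ≡ inj₁ p
        first : ∀ x → ρ 0 ≡ x → left-I A B x ≡ true → Is 0
        first (inj₁ p) eq _ = p , eq
        step : ∀ l → Is l → Is (suc l)
        step l (p , eq) with ρ (suc l) | subst (λ x → w l ⊨ union-δ A B x (ρ (suc l))) eq (ρe l)
        ... | inj₁ p′ | _ = p′ , refl
        ... | inj₂ _  | h = ⊥-elim (⊨ff (w l) h)
        is : ∀ l → Is l
        is = iterate (first (ρ 0) refl ini) step
        σ : ℕ → P
        σ l = proj₁ (is l)
        eq : ∀ l → ρ l ≡ inj₁ (σ l)
        eq l = proj₂ (is l)

    union-right : Acc M (aut (right-I A B) (union-δ A B) (union-F A B)) w ⟺ Acc M B w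
    union-right = to , λ (ρ , r) → inj₂ ∘ ρ , r
      where
      to : Acc M (aut (right-I A B) (union-δ A B) (union-F A B)) w → Acc M B w
      to (ρ , ini , ρe , ρF) = σ , trans (cong (right-I A B) (sym (eq 0))) ini ,
        (λ l → subst₂ (λ p q → w l ⊨ union-δ A B p q) (eq l) (eq (suc l)) (ρe l)) ,
        λ l → let (j , le , Fj) = ρF l in j , le , trans (cong (union-F A B) (sym (eq j))) Fj
        where
        Is : ℕ → Set
        Is l = Σ Q λ q → ρ l ≡ inj₂ q
        first : ∀ x → ρ 0 ≡ x → right-I A B x ≡ true → Is 0
        first (inj₂ q) eq _ = q , eq
        step : ∀ l → Is l → Is (suc l)
        step l (q , eq) with ρ (suc l) | subst (λ x → w l ⊨ union-δ A B x (ρ (suc l))) eq (ρe l)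
        ... | inj₂ q′ | _ = q′ , refl
        ... | inj₁ _  | h = ⊥-elim (⊨ff (w l) h)
        is : ∀ l → Is l
        is = iterate (first (ρ 0) refl ini) step
        σ : ℕ → Q
        σ l = proj₁ (is l)
        eq : ∀ l → ρ l ≡ inj₂ (σ l)
        eq l = proj₂ (is l)

  abstract
    -- In the disjoint union one transition relation and one accepting set serve both automata, so a
    -- single factorisation of the word settles both and `Combine` applies.
    boolean : (Bool → Bool → Bool) → NBA 𝓖 → NBA 𝓖 → NBA 𝓖
    boolean β (k , A) (k′ , B) = toNBA C.finState C.combined
      where
      fU : Finite (Fin k ⊎ Fin k′)
      fU = fin⊎ (finFin k) (finFin k′)
      U : (Fin k ⊎ Fin k′ → Bool) → Aut 𝓖 (Fin (size fU))
      U I = proj₂ (toNBA fU (aut I (union-δ A B) (union-F A B)))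
      module C = Combine 𝓖 (size fU) (Aut.δ (U (left-I A B))) (Aut.F (U (left-I A B))) β
                   (Aut.I (U (left-I A B))) (Aut.I (U (right-I A B)))

    boolean⟺ : (em : EM) (M : Model 𝓖) (β : Bool → Bool → Bool) (A B : NBA 𝓖) (w : ℕ → Model.L M) →
               Acc M (proj₂ (boolean β A B)) w ⟺
               (β (truth em (Acc M (proj₂ A) w)) (truth em (Acc M (proj₂ B) w)) ≡ true)
    boolean⟺ em M β (k , A) (k′ , B) w =
      toNBA⟺ M C.finState C.combined w ⟫ C.Correct.combined⟺ em M w ⟫
      ≡→⟺ (cong (_≡ true) (cong₂ β
        (bool-ext (truth⟺ em _ ⟫ toNBA⟺ M fU (aut (left-I A B) (union-δ A B) (union-F A B)) w ⟫ union-left em M A B w ⟫ ⟺-sym (truth⟺ em _)))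
        (bool-ext (truth⟺ em _ ⟫ toNBA⟺ M fU (aut (right-I A B) (union-δ A B) (union-F A B)) w ⟫ union-right em M A B w ⟫ ⟺-sym (truth⟺ em _)))))
      where
      fU : Finite (Fin k ⊎ Fin k′)
      fU = fin⊎ (finFin k) (finFin k′)
      U : (Fin k ⊎ Fin k′ → Bool) → Aut 𝓖 (Fin (size fU))
      U I = proj₂ (toNBA fU (aut I (union-δ A B) (union-F A B)))
      module C = Combine 𝓖 (size fU) (Aut.δ (U (left-I A B))) (Aut.F (U (left-I A B))) β
                   (Aut.I (U (left-I A B))) (Aut.I (U (right-I A B)))

  complement : NBA 𝓖 → NBA 𝓖
  complement A = boolean (λ b _ → not b) A A

  complement⟺ : (em : EM) (M : Model 𝓖) (A : NBA 𝓖) (w : ℕ → Model.L M) →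
                Acc M (proj₂ (complement A)) w ⟺ (¬ Acc M (proj₂ A) w)
  complement⟺ em M A w = boolean⟺ em M _ A A w ⟫ not-⟺ ⟫ ¬-⟺ (truth⟺ em _)

  conjunction⟺ : (em : EM) (M : Model 𝓖) (A B : NBA 𝓖) (w : ℕ → Model.L M) →
                 Acc M (proj₂ (boolean _∧_ A B)) w ⟺ (Acc M (proj₂ A) w × Acc M (proj₂ B) w)
  conjunction⟺ em M A B w = boolean⟺ em M _ A B w ⟫ ∧-⟺ ⟫ ×-⟺ (truth⟺ em _) (truth⟺ em _)

Acc-cong : {𝓖 : Tests} (M : Model 𝓖) {Q : Set} (A : Aut 𝓖 Q) {w w′ : ℕ → Model.L M} →
           (∀ l → w l ≡ w′ l) → Acc M A w ⟺ Acc M A w′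
Acc-cong M A eq = Σ-⟺ λ ρ → ×-⟺ ⟺-refl (×-⟺ (Π-⟺ λ l → ≡→⟺ (cong
  (λ a → Model._⊨_ M a (Aut.δ A (ρ l) (ρ (suc l)))) (eq l))) ⟺-refl)

-- Words with an additional track, and its projection.

EnvTests : Set → Tests → Tests
EnvTests Ev 𝓖 = record
  { G = Ev → G ; ttᵍ = λ _ → ttᵍ ; ¬ᵍ_ = λ g e → ¬ᵍ g e ; _∧ᵍ_ = λ g h e → g e ∧ᵍ h e }
  where open Tests 𝓖

EnvModel : (Ev : Set) {𝓖 : Tests} → Model 𝓖 → Model (EnvTests Ev 𝓖)
EnvModel Ev M = record
  { L = Ev × L ; _⊨_ = λ (e , l) g → l ⊨ g e ; ⊨tt = λ (e , l) → ⊨tt l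
  ; ⊨¬ = λ (e , l) g → ⊨¬ l (g e) ; ⊨∧ = λ (e , l) g h → ⊨∧ l (g e) (h e) }
  where open Model M

module _ {𝓖 : Tests} {Ev Z : Set} (fZ : Finite Z) where
  open Tests 𝓖

  project : {Q : Set} → Aut (EnvTests (Z × Ev) 𝓖) Q → Aut (EnvTests Ev 𝓖) Q
  project (aut I δ F) = aut I (λ p q e → orL (elems fZ) λ z → δ p q (z , e)) F

  -- Each letter of the track is seen by exactly one transition. The choices at different positions
  -- are thus independent, and a disjunction inside every test expresses the choice of a whole
  -- track.
  project⟺ : (em : EM) (M : Model 𝓖) {Q : Set} (A : Aut (EnvTests (Z × Ev) 𝓖) Q) (w : ℕ → Ev × Model.L M) →
             Acc (EnvModel Ev M) (project A) w ⟺
             Σ (ℕ → Z) λ z → Acc (EnvModel (Z × Ev) M) A (λ l → (z l , proj₁ (w l)) , proj₂ (w l))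
  project⟺ em M (aut I δ F) w =
    (λ (ρ , ini , ρe , ρF) → let h = λ l → proj₁ (⊨orF (proj₂ (w l)) fZ _) (ρe l) in
       (λ l → proj₁ (h l)) , ρ , ini , (λ l → proj₂ (h l)) , ρF) ,
    λ (z , ρ , ini , ρe , ρF) → ρ , ini , (λ l → proj₂ (⊨orF (proj₂ (w l)) fZ _) (z l , ρe l)) , ρF
    where open ModelProps em M

-- Automata whose states carry automata: a run r is accepting if moreover, for every l,
-- the automaton of r l accepts the suffix from l on.

module Nested {𝓖 : Tests} {Ev Z : Set} (fZ : Finite Z) (I : Z → Bool) (A : Z → NBA (EnvTests Ev 𝓖))
              (edge : Z → Z → Ev → Tests.G 𝓖) (F : Z → Bool) where
  open Tests 𝓖

  Inner : Set
  Inner = Σ Z λ z → Fin (proj₁ (complement (A z)))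

  inner : (z : Z) → Aut (EnvTests Ev 𝓖) (Fin (proj₁ (complement (A z))))
  inner z = proj₂ (complement (A z))

  finInner : Finite Inner
  finInner = finΣ fZ λ z → finFin _

  skeleton : Aut (EnvTests (Z × Ev) 𝓖) Z
  skeleton = aut I (λ p q (z , e) → if does (eqF fZ z p) then edge p q e else ffᵍ) F

  -- The transition out of the waiting state already reads the first letter of the suffix, so it
  -- combines the choice of an inner initial state with the first inner step.
  enter : Inner → Ev → G
  enter (z , x) e = orL (elems (finFin _)) λ i → if Aut.I (inner z) i then Aut.δ (inner z) i x e else ffᵍ

  inside : (s s′ : Inner) → Dec (proj₁ s ≡ proj₁ s′) → Ev → G
  inside (z , x) (_ , x′) (yes refl) e = Aut.δ (inner z) x x′ e
  inside _ _ (no _) e = ffᵍ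

  bad-δ : Maybe Inner → Maybe Inner → Z × Ev → G
  bad-δ nothing nothing _ = ttᵍ
  bad-δ nothing (just (z , x)) (y , e) = if does (eqF fZ y z) then enter (z , x) e else ffᵍ
  bad-δ (just _) nothing _ = ffᵍ
  bad-δ (just s) (just s′) (_ , e) = inside s s′ (eqF fZ (proj₁ s) (proj₁ s′)) e

  bad-I bad-F : Maybe Inner → Bool
  bad-I nothing  = true
  bad-I (just _) = false
  bad-F nothing        = false
  bad-F (just (z , x)) = Aut.F (inner z) x

  bad : Aut (EnvTests (Z × Ev) 𝓖) (Maybe Inner)
  bad = aut bad-I bad-δ bad-F

  -- A Büchi automaton cannot simply follow infinitely many inner runs at once. With the outer run
  -- written on the track `Z`, however, failure is existential: one position and one run of the
  -- complemented inner automaton, both guessed by `bad`. Complementing `bad` restores the universal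
  -- condition, `skeleton` checks that the track is an outer run, and `nested` projects it away.
  core : NBA (EnvTests (Z × Ev) 𝓖)
  core = boolean (λ a b → a ∧ not b) (toNBA fZ skeleton) (toNBA (finMaybe finInner) bad)

  nested : NBA (EnvTests Ev 𝓖)
  nested = proj₁ core , project {𝓖 = 𝓖} fZ (proj₂ core)

  module Correct (em : EM) (M : Model 𝓖) (w : ℕ → Ev × Model.L M) where
    open Model M
    open ModelProps em M

    module _ (z : ℕ → Z) where

      zw : ℕ → (Z × Ev) × L
      zw l = (z l , proj₁ (w l)) , proj₂ (w l)

      skeleton⟺ : Acc (EnvModel (Z × Ev) M) skeleton zw ⟺
                  (I (z 0) ≡ true × (∀ l → proj₂ (w l) ⊨ edge (z l) (z (suc l)) (proj₁ (w l))) ×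
                   Unbounded (λ l → F (z l) ≡ true))
      skeleton⟺ = to , λ (ini , ze , zF) → z , ini , (λ l → proj₂ (⊨if _ _ _)
          (proj₂ (does⟺ (eqF fZ (z l) (z l))) refl , ze l)) , zF
        where
        to : Acc (EnvModel (Z × Ev) M) skeleton zw → _
        to (ρ , ini , ρe , ρF) = trans (cong I (eq 0)) ini ,
          (λ l → subst₂ (λ p q → proj₂ (w l) ⊨ edge p q (proj₁ (w l))) (sym (eq l)) (sym (eq (suc l)))
                   (proj₂ (proj₁ (⊨if _ _ _) (ρe l)))) ,
          λ l → let (j , le , Fj) = ρF l in j , le , trans (cong F (eq j)) Fj
          where
          eq : ∀ l → z l ≡ ρ l
          eq l = proj₁ (does⟺ (eqF fZ (z l) (ρ l))) (proj₁ (proj₁ (⊨if _ _ _) (ρe l)))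

      suffix : ℕ → ℕ → Ev × L
      suffix l m = w (m + l)

      bad⟺ : Acc (EnvModel (Z × Ev) M) bad zw ⟺
             Σ ℕ λ l → Acc (EnvModel Ev M) (inner (z l)) (suffix l)
      bad⟺ = to , from
        where
        from : (Σ ℕ λ l → Acc (EnvModel Ev M) (inner (z l)) (suffix l)) →
               Acc (EnvModel (Z × Ev) M) bad zw
        from (l , ρ , ini , ρe , ρF) = σ , σ-ini , σe ,
          λ m → let (j , le , Fj) = ρF (suc m) in
            j + l , ℕₚ.≤-trans (ℕₚ.≤-trans (ℕₚ.n≤1+n m) le) (ℕₚ.m≤m+n j l) ,
            trans (cong bad-F (σ> j (ℕₚ.≤-trans (s≤s z≤n) le))) Fj
          where
          σ : ℕ → Maybe Inner
          σ m with m ℕₚ.≤? l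
          ... | yes _ = nothing
          ... | no _  = just (z l , ρ (m ∸ l))
          σ≤ : ∀ m → m ≤ l → σ m ≡ nothing
          σ≤ m le with m ℕₚ.≤? l
          ... | yes _ = refl
          ... | no n  = ⊥-elim (n le)
          σ> : ∀ j → 0 < j → σ (j + l) ≡ just (z l , ρ j)
          σ> (suc j) _ with (suc j + l) ℕₚ.≤? l
          ... | yes le = ⊥-elim (ℕₚ.<⇒≱ (s≤s (ℕₚ.m≤n+m l j)) le)
          ... | no _   = cong (λ x → just (z l , ρ x)) (ℕₚ.m+n∸n≡m (suc j) l)
          σ-ini : bad-I (σ 0) ≡ true
          σ-ini = cong bad-I (σ≤ 0 z≤n)
          σe : ∀ m → proj₂ (w m) ⊨ bad-δ (σ m) (σ (suc m)) (z m , proj₁ (w m))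
          σe m with ℕₚ.<-cmp m l
          ... | tri< lt _ _ = subst₂ (λ p q → proj₂ (w m) ⊨ bad-δ p q (z m , proj₁ (w m)))
                  (sym (σ≤ m (ℕₚ.<⇒≤ lt))) (sym (σ≤ (suc m) lt)) (⊨tt _)
          ... | tri≈ _ refl _ = subst₂ (λ p q → proj₂ (w m) ⊨ bad-δ p q (z m , proj₁ (w m)))
                  (sym (σ≤ m ℕₚ.≤-refl)) (sym (σ> 1 (s≤s z≤n)))
                  (proj₂ (⊨if _ _ _) (proj₂ (does⟺ (eqF fZ (z m) (z m))) refl ,
                    proj₂ (⊨orF _ (finFin _) _) (ρ 0 , proj₂ (⊨if _ _ _) (ini , ρe 0))))
          ... | tri> _ _ gt = let (o , eq) = ℕₚ.m≤n⇒∃[o]m+o≡n gt in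
                  subst (λ m → proj₂ (w m) ⊨ bad-δ (σ m) (σ (suc m)) (z m , proj₁ (w m)))
                    (trans (cong suc (ℕₚ.+-comm o l)) eq) (σe> o)
            where
            stay : ∀ j (d : Dec (z l ≡ z l)) → proj₂ (w (suc j + l)) ⊨
                   inside (z l , ρ (suc j)) (z l , ρ (suc (suc j))) d (proj₁ (w (suc j + l)))
            stay j (yes refl) = ρe (suc j)
            stay j (no n)     = ⊥-elim (n refl)
            σe> : ∀ j → proj₂ (w (suc j + l)) ⊨ bad-δ (σ (suc j + l)) (σ (suc (suc j + l)))
                                                  (z (suc j + l) , proj₁ (w (suc j + l)))
            σe> j = subst₂ (λ p q → proj₂ (w (suc j + l)) ⊨ bad-δ p q (z (suc j + l) , proj₁ (w (suc j + l))))
                      (sym (σ> (suc j) (s≤s z≤n))) (sym (σ> (suc (suc j)) (s≤s z≤n)))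
                      (stay j (eqF fZ (z l) (z l)))

        to : Acc (EnvModel (Z × Ev) M) bad zw → Σ ℕ λ l → Acc (EnvModel Ev M) (inner (z l)) (suffix l)
        to (ρ , ini , ρe , ρF) =
          let (l , _ , Fl) = ρF 0 in [ (λ eq → ⊥-elim (true≢false (trans (sym Fl) (cong bad-F eq)))) , main ]′ (phase l)
          where
          Entered : Set
          Entered = Σ ℕ λ l → Σ (Fin (proj₁ (complement (A (z l))))) λ x → ρ (suc l) ≡ just (z l , x) ×
                    Σ (Fin _) λ i → Aut.I (inner (z l)) i ≡ true × (proj₂ (w l) ⊨ Aut.δ (inner (z l)) i x (proj₁ (w l)))
          phase : ∀ l → ρ l ≡ nothing ⊎ Entered
          phase zero = inj₁ (first (ρ 0) ini)
            where
            first : ∀ q → bad-I q ≡ true → q ≡ nothing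
            first nothing _ = refl
          phase (suc l) with phase l
          ... | inj₂ h = inj₂ h
          ... | inj₁ eq with ρ (suc l) in eq′ | subst (λ q → proj₂ (w l) ⊨ bad-δ q (ρ (suc l)) (z l , proj₁ (w l))) eq (ρe l)
          ...   | nothing | _ = inj₁ refl
          ...   | just (z′ , x) | h with proj₁ (⊨if _ _ _) h
          ...     | h₁ , h₂ with proj₁ (does⟺ (eqF fZ (z l) z′)) h₁
          ...       | refl = let (i , h₃) = proj₁ (⊨orF _ (finFin _) _) h₂ ; (h₄ , h₅) = proj₁ (⊨if _ _ _) h₃
                             in inj₂ (l , x , eq′ , i , h₄ , h₅)
          main : Entered → Σ ℕ λ l → Acc (EnvModel Ev M) (inner (z l)) (suffix l)
          main (l , x , ent , i , Ii , δi) = l , σ , Ii , σe , σF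
            where
            In : ℕ → Set
            In m = Σ (Fin (proj₁ (complement (A (z l))))) λ x → ρ (suc m + l) ≡ just (z l , x)
            step : ∀ m (a : In m) → Σ (In (suc m)) λ b →
                   proj₂ (w (suc m + l)) ⊨ Aut.δ (inner (z l)) (proj₁ a) (proj₁ b) (proj₁ (w (suc m + l)))
            step m (x , eq) = view (ρ (suc (suc m) + l)) refl
                (subst (λ q → proj₂ (w (suc m + l)) ⊨ bad-δ q (ρ (suc (suc m) + l)) (z (suc m + l) , proj₁ (w (suc m + l)))) eq (ρe (suc m + l)))
              where
              view : ∀ q → ρ (suc (suc m) + l) ≡ q →
                     proj₂ (w (suc m + l)) ⊨ bad-δ (just (z l , x)) q (z (suc m + l) , proj₁ (w (suc m + l))) →
                     Σ (In (suc m)) λ b → proj₂ (w (suc m + l)) ⊨ Aut.δ (inner (z l)) x (proj₁ b) (proj₁ (w (suc m + l)))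
              view nothing eq h = ⊥-elim (⊨ff _ h)
              view (just (z′ , x′)) eq h with eqF fZ (z l) z′
              ... | yes refl = (x′ , eq) , h
              ... | no _     = ⊥-elim (⊨ff _ h)
            ins : ∀ m → In m
            ins = iterate (x , ent) (λ m a → proj₁ (step m a))
            σ : ℕ → Fin (proj₁ (complement (A (z l))))
            σ zero    = i
            σ (suc m) = proj₁ (ins m)
            σe : ∀ m → proj₂ (suffix l m) ⊨ Aut.δ (inner (z l)) (σ m) (σ (suc m)) (proj₁ (suffix l m))
            σe zero    = δi
            σe (suc m) = proj₂ (step m (ins m))
            σF : Unbounded (λ m → Aut.F (inner (z l)) (σ m) ≡ true)
            σF m with ρF (suc m + l)
            ... | j , le , Fj with ℕₚ.m≤n⇒∃[o]m+o≡n le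
            ...   | o , refl = suc m + o , ℕₚ.m≤n⇒m≤1+n (ℕₚ.m≤m+n m o) ,
                      trans (sym (cong bad-F (trans (cong ρ (cong suc arith)) (proj₂ (ins (m + o)))))) Fj
              where
              arith : m + l + o ≡ m + o + l
              arith = trans (ℕₚ.+-assoc m l o) (trans (cong (m +_) (ℕₚ.+-comm l o)) (sym (ℕₚ.+-assoc m o l)))

    nested⟺ : Acc (EnvModel Ev M) (proj₂ nested) w ⟺
      Σ (ℕ → Z) λ z → I (z 0) ≡ true × (∀ l → proj₂ (w l) ⊨ edge (z l) (z (suc l)) (proj₁ (w l))) ×
        (∀ l → Acc (EnvModel Ev M) (proj₂ (A (z l))) (λ m → w (m + l))) × Unbounded (λ l → F (z l) ≡ true)
    nested⟺ = project⟺ {𝓖 = 𝓖} {Ev = Ev} {Z = Z} fZ em M (proj₂ core) w ⟫ Σ-⟺ λ z →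
      boolean⟺ em (EnvModel (Z × Ev) M) (λ a b → a ∧ not b) (toNBA fZ skeleton) (toNBA (finMaybe finInner) bad) (zw z) ⟫
      ∧-⟺ ⟫ ×-⟺ (truth⟺ em _ ⟫ toNBA⟺ (EnvModel (Z × Ev) M) fZ skeleton (zw z) ⟫ skeleton⟺ z)
                (not-⟺ ⟫ ¬-⟺ (truth⟺ em _ ⟫ toNBA⟺ (EnvModel (Z × Ev) M) (finMaybe finInner) bad (zw z) ⟫ bad⟺ z)) ⟫
      ((λ ((h₁ , h₂ , h₃) , n) → h₁ , h₂ , (λ l → ¬¬-elim em λ na → n (l ,
           proj₂ (complement⟺ em (EnvModel Ev M) (A (z l)) (suffix z l)) na)) , h₃) ,
       λ (h₁ , h₂ , a , h₃) → (h₁ , h₂ , h₃) , λ (l , c) →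
         proj₁ (complement⟺ em (EnvModel Ev M) (A (z l)) (suffix z l)) c (a l))

-- The hub logic

-- The propositions are a parameter because MCL variables become propositions as well. `EY` has a
-- single initial state and tests that are formulas again; negation is applied only to the whole of
-- it.
data Y (P : Set) : Set where
  topY  : Y P
  propY : P → Y P
  negY  : Y P → Y P
  andY  : Y P → Y P → Y P
  EY    : (k : ℕ) → Fin k → (Fin k → Fin k → Y P) → (Fin k → Bool) → Y P

YTests : Set → Tests
YTests P = record { G = Y P ; ttᵍ = topY ; ¬ᵍ_ = negY ; _∧ᵍ_ = andY }

satY : ∀ {n} (K : KTree n) {P : Set} → (P → List (KTree.D K) → Set) → List (KTree.D K) → Y P → Set
satY K V w topY         = ⊤
satY K V w (propY p)    = V p w
satY K V w (negY φ)     = ¬ satY K V w φ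
satY K V w (andY φ ψ)   = satY K V w φ × satY K V w ψ
satY K V w (EY k i δ F) = Σ (Path K w) λ π → Σ (ℕ → Fin k) λ q → q 0 ≡ i ×
  (∀ l → satY K V (Path.π π l) (δ (q l) (q (suc l)))) × Unbounded (λ l → F (q l) ≡ true)

YModel : ∀ {n} (K : KTree n) {P : Set} → (P → List (KTree.D K) → Set) → Model (YTests P)
YModel K V = record
  { L = List (KTree.D K) ; _⊨_ = satY K V ; ⊨tt = λ _ → tt
  ; ⊨¬ = λ _ _ → ⟺-refl ; ⊨∧ = λ _ _ _ → ⟺-refl }

Val : ∀ {n} (K : KTree n) → Fin n → List (KTree.D K) → Set
Val K p w = p ∈ˢ KTree.Lab K w

-- Formulated for arbitrary valuations rather than labels, so that it covers three uses: genuine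
-- bisimulations of Kripke trees, a change of valuation outside a subtree (`local`), and exchanging
-- copies of a child in the ω-expansion.
record Bisimulation {n n′ : ℕ} (K : KTree n) (K′ : KTree n′) {P : Set}
                    (V : P → List (KTree.D K) → Set) (V′ : P → List (KTree.D K′) → Set)
                    (R : List (KTree.D K) → List (KTree.D K′) → Set) : Set where
  private
    module A = KTree K
    module B = KTree K′
  field
    inT   : ∀ {w w′} → R w w′ → A.T w × B.T w′
    props : ∀ {w w′} → R w w′ → ∀ p → V p w ⟺ V′ p w′
    forth : ∀ {w w′} → R w w′ → ∀ d → A.T (w ∷ʳ d) → Σ B.D λ d′ → R (w ∷ʳ d) (w′ ∷ʳ d′)
    back  : ∀ {w w′} → R w w′ → ∀ d′ → B.T (w′ ∷ʳ d′) → Σ A.D λ d → R (w ∷ʳ d) (w′ ∷ʳ d′)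

module _ {n n′ : ℕ} {K : KTree n} {K′ : KTree n′} {P : Set} {V : P → List (KTree.D K) → Set}
         {V′ : P → List (KTree.D K′) → Set} {R : List (KTree.D K) → List (KTree.D K′) → Set} where

  flip-bisim : Bisimulation K K′ V V′ R → Bisimulation K′ K V′ V (λ w′ w → R w w′)
  flip-bisim B = record
    { inT = λ r → proj₂ (inT r) , proj₁ (inT r) ; props = λ r p → ⟺-sym (props r p)
    ; forth = back ; back = forth }
    where open Bisimulation B

  lift-path : Bisimulation K K′ V V′ R → ∀ {w w′} → R w w′ → (π : Path K w) →
              Σ (Path K′ w′) λ π′ → ∀ l → R (Path.π π l) (Path.π π′ l)
  lift-path B {w} {w′} r π =
    record { π = λ l → proj₁ (at l) ; start = refl ; inT = λ l → proj₂ (inT (proj₂ (at l)))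
           ; step = λ l → proj₂ (nx l (at l)) } , λ l → proj₂ (at l)
    where
    open Bisimulation B
    module π = Path π
    At : ℕ → Set
    At l = Σ (List (KTree.D K′)) (R (π.π l))
    nx : ∀ l (x : At l) → Σ (At (suc l)) λ y → Σ (KTree.D K′) λ d → proj₁ y ≡ proj₁ x ∷ʳ d
    nx l (v , r) with π.step l
    ... | d , eq with forth r d (subst (KTree.T K) eq (π.inT (suc l)))
    ...   | d′ , r′ = (v ∷ʳ d′ , subst (λ u → R u (v ∷ʳ d′)) (sym eq) r′) , d′ , refl
    at : ∀ l → At l
    at = iterate (w′ , subst (λ u → R u w′) (sym π.start) r) (λ l x → proj₁ (nx l x))

bisim-invariant : ∀ {n n′} {K : KTree n} {K′ : KTree n′} {P : Set} {V : P → List (KTree.D K) → Set}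
  {V′ : P → List (KTree.D K′) → Set} {R : List (KTree.D K) → List (KTree.D K′) → Set} →
  Bisimulation K K′ V V′ R → ∀ φ {w w′} → R w w′ → satY K V w φ ⟺ satY K′ V′ w′ φ
bisim-invariant B topY         r = ⟺-refl
bisim-invariant B (propY p)    r = Bisimulation.props B r p
bisim-invariant B (negY φ)     r = ¬-⟺ (bisim-invariant B φ r)
bisim-invariant B (andY φ ψ)   r = ×-⟺ (bisim-invariant B φ r) (bisim-invariant B ψ r)
bisim-invariant B (EY k i δ F) r =
  (λ (π , q , q0 , qe , qF) → let (π′ , r′) = lift-path B r π in
     π′ , q , q0 , (λ l → proj₁ (bisim-invariant B (δ (q l) (q (suc l))) (r′ l)) (qe l)) , qF) ,
  λ (π , q , q0 , qe , qF) → let (π′ , r′) = lift-path (flip-bisim B) r π in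
     π′ , q , q0 , (λ l → proj₂ (bisim-invariant B (δ (q l) (q (suc l))) (r′ l)) (qe l)) , qF

sub : {P P′ : Set} → (P → Y P′) → Y P → Y P′
sub s topY         = topY
sub s (propY p)    = s p
sub s (negY φ)     = negY (sub s φ)
sub s (andY φ ψ)   = andY (sub s φ) (sub s ψ)
sub s (EY k i δ F) = EY k i (λ p q → sub s (δ p q)) F

module _ {n : ℕ} (K : KTree n) where
  open KTree K

  sub⟺ : {P P′ : Set} (V : P′ → List D → Set) (s : P → Y P′) (φ : Y P) (w : List D) →
         satY K V w (sub s φ) ⟺ satY K (λ p w → satY K V w (s p)) w φ
  sub⟺ V s topY         w = ⟺-refl
  sub⟺ V s (propY p)    w = ⟺-refl
  sub⟺ V s (negY φ)     w = ¬-⟺ (sub⟺ V s φ w)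
  sub⟺ V s (andY φ ψ)   w = ×-⟺ (sub⟺ V s φ w) (sub⟺ V s ψ w)
  sub⟺ V s (EY k i δ F) w = Σ-⟺ λ π → Σ-⟺ λ q → ×-⟺ ⟺-refl
    (×-⟺ (Π-⟺ λ l → sub⟺ V s (δ (q l) (q (suc l))) (Path.π π l)) ⟺-refl)

  -- The identity on the descendants of `v` is a bisimulation between the two valuations.
  local : {P : Set} {V V′ : P → List D → Set} (v : List D) → T v →
          (∀ u → v ≼ u → ∀ p → V p u ⟺ V′ p u) → ∀ φ → satY K V v φ ⟺ satY K V′ v φ
  local {V = V} {V′} v Tv agree φ = bisim-invariant B φ (refl , Tv , [] , sym (Listₚ.++-identityʳ v))
    where
    R : List D → List D → Set
    R u u′ = u ≡ u′ × T u × v ≼ u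
    extend-≼ : ∀ {u} d → v ≼ u → v ≼ (u ∷ʳ d)
    extend-≼ d (s , refl) = s ∷ʳ d , Listₚ.++-assoc v s (d ∷ [])
    B : Bisimulation K K V V′ R
    B = record
      { inT = λ { (refl , Tu , _) → Tu , Tu } ; props = λ { (refl , _ , le) → agree _ le }
      ; forth = λ { (refl , _ , le) d Td → d , refl , Td , extend-≼ d le }
      ; back = λ { (refl , _ , le) d Td → d , refl , Td , extend-≼ d le } }

  -- Descendants, paths and chains in a tree.

  ≼-refl : ∀ (u : List D) → u ≼ u
  ≼-refl u = [] , sym (Listₚ.++-identityʳ u)

  ≼-trans : ∀ {u v w : List D} → u ≼ v → v ≼ w → u ≼ w
  ≼-trans {u} (s , refl) (t , refl) = s ++ t , Listₚ.++-assoc u s t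

  ≼-child : ∀ (u : List D) d → u ≼ (u ∷ʳ d)
  ≼-child u d = d ∷ [] , refl

  T-prefix : ∀ {u v} → u ≼ v → T v → T u
  T-prefix {u} (s , refl) = prefix u s

  ≼-length : ∀ {u v : List D} → u ≼ v → length u ≤ length v
  ≼-length {u} (s , refl) = subst (length u ≤_) (sym (Listₚ.length-++ u)) (ℕₚ.m≤m+n _ _)

  ≼-antisym-length : ∀ {u v : List D} → u ≼ v → length u ≡ length v → u ≡ v
  ≼-antisym-length {u} ([] , refl)    _ = sym (Listₚ.++-identityʳ u)
  ≼-antisym-length {u} (d ∷ s , refl) e = ⊥-elim (ℕₚ.m+1+n≢m (length u)
    (trans (sym (Listₚ.length-++ u {d ∷ s})) (sym e)))

  ≼-linear : ∀ {u v x : List D} → u ≼ x → v ≼ x → (u ≼ v) ⊎ (v ≼ u)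
  ≼-linear {[]}    {v}     p q = inj₁ (v , refl)
  ≼-linear {a ∷ u} {[]}    p q = inj₂ (a ∷ u , refl)
  ≼-linear {a ∷ u} {b ∷ v} (s , refl) (t , eq) with Listₚ.∷-injective eq
  ... | refl , eq′ with ≼-linear {u} {v} (s , refl) (t , eq′)
  ...   | inj₁ (r , refl) = inj₁ (r , refl)
  ...   | inj₂ (r , refl) = inj₂ (r , refl)

  ∷ʳ-++ : ∀ (v : List D) d s → (v ∷ʳ d) ++ s ≡ v ++ d ∷ s
  ∷ʳ-++ v d s = Listₚ.++-assoc v (d ∷ []) s

  -- This is how chains distinguish children: as nodes below different children are incomparable, a
  -- chain meets the subtree of at most one child of `v`.
  branch : ∀ (v : List D) {d d′ u u′} → (v ∷ʳ d) ≼ u → (v ∷ʳ d′) ≼ u′ → (u ≼ u′) ⊎ (u′ ≼ u) → d ≡ d′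
  branch v {d} {d′} (s , refl) (s′ , refl) = [ (λ le → go s s′ le) , (λ le → sym (go s′ s le)) ]′
    where
    go : ∀ {d d′} s s′ → ((v ∷ʳ d) ++ s) ≼ ((v ∷ʳ d′) ++ s′) → d ≡ d′
    go {d} {d′} s s′ (t , eq) = sym (proj₁ (Listₚ.∷-injective (Listₚ.++-cancelˡ v (d′ ∷ s′) (d ∷ s ++ t)
      (trans (sym (∷ʳ-++ v d′ s′)) (trans eq (trans (cong (_++ t) (∷ʳ-++ v d s))
        (Listₚ.++-assoc v (d ∷ s) t)))))))

  path-≼ : ∀ {w} (π : Path K w) l m → Path.π π l ≼ Path.π π (m + l)
  path-≼ π l zero    = ≼-refl _
  path-≼ π l (suc m) with Path.step π (m + l)
  ... | d , eq = subst (Path.π π l ≼_) (sym eq) (≼-trans (path-≼ π l m) (≼-child _ d))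

  path-from : ∀ {w} (π : Path K w) l → w ≼ Path.π π l
  path-from π l = subst₂ _≼_ (Path.start π) (cong (Path.π π) (ℕₚ.+-identityʳ l)) (path-≼ π 0 l)

  path-length : ∀ {w} (π : Path K w) l → length (Path.π π l) ≡ l + length w
  path-length π zero    = cong length (Path.start π)
  path-length π (suc l) with Path.step π l
  ... | d , eq = trans (cong length eq) (trans (Listₚ.length-++ (Path.π π l))
                   (trans (ℕₚ.+-comm _ 1) (cong suc (path-length π l))))

  path-linear : ∀ {w} (π : Path K w) l m → (Path.π π l ≼ Path.π π m) ⊎ (Path.π π m ≼ Path.π π l)
  path-linear π l m with ℕₚ.≤-total l m
  ... | inj₁ le = inj₁ (subst (λ z → Path.π π l ≼ Path.π π z) (ℕₚ.m∸n+n≡m le) (path-≼ π l (m ∸ l)))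
  ... | inj₂ le = inj₂ (subst (λ z → Path.π π m ≼ Path.π π z) (ℕₚ.m∸n+n≡m le) (path-≼ π m (l ∸ m)))

  path-injective : ∀ {w} (π : Path K w) {l m} → Path.π π l ≡ Path.π π m → l ≡ m
  path-injective {w} π {l} {m} eq = ℕₚ.+-cancelʳ-≡ (length w) l m
    (trans (sym (path-length π l)) (trans (cong length eq) (path-length π m)))

  drop-path : ∀ {w} (π : Path K w) l → Path K (Path.π π l)
  drop-path π l = record
    { π = λ m → Path.π π (m + l) ; start = refl ; inT = λ m → Path.inT π (m + l)
    ; step = λ m → Path.step π (m + l) }

  cons-path : ∀ {w} → T w → ∀ d → Path K (w ∷ʳ d) → Path K w
  cons-path {w} Tw d π = record { π = ρ ; start = refl ; inT = inT ; step = step }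
    where
    ρ : ℕ → List D
    ρ zero    = w
    ρ (suc l) = Path.π π l
    inT : ∀ l → T (ρ l)
    inT zero    = Tw
    inT (suc l) = Path.inT π l
    step : ∀ l → Σ D λ d → ρ (suc l) ≡ ρ l ∷ʳ d
    step zero    = d , Path.start π
    step (suc l) = Path.step π l

  IsChain : (List D → Set) → Set
  IsChain = MCLSem.IsChain K

  -- Follow the chain as long as it continues below the current node.
  chain-path : EM → (X : List D → Set) → IsChain X → ∀ {w} → T w →
               Σ (Path K w) λ π → ∀ u → X u → w ≼ u → Σ ℕ λ l → Path.π π l ≡ u
  chain-path em X (X⊆T , cmp) {w} Tw =
    record { π = λ l → proj₁ (node l) ; start = refl ; inT = λ l → proj₂ (node l)
           ; step = λ l → proj₁ (nx (proj₁ (node l)) (proj₂ (node l))) , refl } ,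
    λ u Xu (s , eq) → reach s 0 u Xu eq
    where
    Ahead : List D → Set
    Ahead v = Σ D λ d → Σ (List D) λ u → X u × (v ∷ʳ d) ≼ u
    abstract
      nx : ∀ v → T v → Σ D λ d → T (v ∷ʳ d) × (Ahead v → Σ (List D) λ u → X u × (v ∷ʳ d) ≼ u)
      nx v Tv with em {Ahead v}
      ... | yes (d , u , Xu , le) = d , T-prefix le (X⊆T u Xu) , λ _ → u , Xu , le
      -- No element of the chain lies strictly below; since the tree is non-blocking, the path is
      -- prolonged by an arbitrary child.
      ... | no n = let (d , Td) = nonblock v Tv in d , Td , λ a → ⊥-elim (n a)
    node : ℕ → Σ (List D) T
    node = iterate (w , Tw) λ _ (v , Tv) → let (d , Td , _) = nx v Tv in v ∷ʳ d , Td
    reach : ∀ s l u → X u → u ≡ proj₁ (node l) ++ s → Σ ℕ λ m → proj₁ (node m) ≡ u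
    reach []      l u Xu eq = l , sym (trans eq (Listₚ.++-identityʳ _))
    reach (d ∷ s) l u Xu eq = follow (nx (proj₁ (node l)) (proj₂ (node l))) refl
      where
      v = proj₁ (node l)
      le : (v ∷ʳ d) ≼ u
      le = s , trans eq (sym (∷ʳ-++ v d s))
      follow : (x : Σ D λ d → T (v ∷ʳ d) × (Ahead v → Σ (List D) λ u → X u × (v ∷ʳ d) ≼ u)) →
               nx v (proj₂ (node l)) ≡ x → Σ ℕ λ m → proj₁ (node m) ≡ u
      follow (d′ , _ , h) eq′ with h (d , u , Xu , le)
      ... | u′ , Xu′ , le′ = reach s (suc l) u Xu (trans eq (trans
            (cong (λ d → v ++ d ∷ s) (trans (branch v le le′ (cmp u u′ Xu Xu′)) (sym (cong proj₁ eq′))))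
            (sym (∷ʳ-++ v (proj₁ (nx v (proj₂ (node l)))) s))))

  some-path : EM → ∀ {w} → T w → Path K w
  some-path em Tw = proj₁ (chain-path em (λ _ → ⊥) ((λ _ ()) , λ _ _ ()) Tw)

module _ {P : Set} where
  open Tests (YTests P)

  -- Reachability and the next-step modality are themselves acceptance by small automata along a
  -- path, so they are definable in `Y` and all inductions on formulas have only the case `EY` to
  -- treat.
  efδ : Y P → Fin 2 → Fin 2 → Y P
  efδ φ zero zero       = topY
  efδ φ zero (suc _)    = φ
  efδ φ (suc _) zero    = ffᵍ
  efδ φ (suc _) (suc _) = topY

  efF : Fin 2 → Bool
  efF zero    = false
  efF (suc _) = true

  EF : Y P → Y P
  EF φ = EY 2 zero (efδ φ) efF

  nextδ : Y P → Fin 3 → Fin 3 → Y P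
  nextδ φ zero             (suc zero)       = topY
  nextδ φ (suc zero)       (suc (suc zero)) = φ
  nextδ φ (suc (suc zero)) (suc (suc zero)) = topY
  nextδ φ _                _                = ffᵍ

  nextF : Fin 3 → Bool
  nextF (suc (suc zero)) = true
  nextF _                = false

  EX : Y P → Y P
  EX φ = EY 3 zero (nextδ φ) nextF

module _ (em : EM) {n : ℕ} (K : KTree n) {P : Set} (V : P → List (KTree.D K) → Set) where
  open KTree K
  open ModelProps em (YModel K V)

  EF⟺ : ∀ φ {w} → T w → satY K V w (EF φ) ⟺ Σ (List D) λ u → w ≼ u × T u × satY K V u φ
  EF⟺ φ {w} Tw = to , from
    where
    Goal = Σ (List D) λ u → w ≼ u × T u × satY K V u φ
    to : satY K V w (EF φ) → Goal
    to (π , q , q0 , qe , qF) = let (j , _ , Fj) = qF 0 in search j (q j) refl Fj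
      where
      search : ∀ j x → q j ≡ x → efF {P} x ≡ true → Goal
      search (suc j) (suc x) eq _ with q j in eq′ | qe j
      ... | zero | h = Path.π π j , path-from K π j , Path.inT π j ,
                       subst (λ y → satY K V (Path.π π j) (efδ φ zero y)) eq h
      ... | suc y | h = search j (suc y) eq′ refl
      search zero (suc x) eq _ with trans (sym q0) eq
      ... | ()
    from : Goal → satY K V w (EF φ)
    -- A path from `w` through `u` is one that follows the singleton chain of `u`; the automaton
    -- takes its one tested transition there.
    from (u , le , Tu , h) with chain-path K em (_≡ u) ((λ { _ refl → Tu }) ,
                                  λ { _ _ refl refl → inj₁ (≼-refl K u) }) Tw
    ... | π , hit with hit u refl le
    ...   | l , eq = π , q , refl , qe , λ m → suc (m + l) , ℕₚ.m≤n⇒m≤1+n (ℕₚ.m≤m+n m l) , qF m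
      where
      q : ℕ → Fin 2
      q m with m ℕₚ.≤? l
      ... | yes _ = zero
      ... | no _  = suc zero
      qe : ∀ m → satY K V (Path.π π m) (efδ φ (q m) (q (suc m)))
      qe m with m ℕₚ.≤? l | suc m ℕₚ.≤? l
      ... | yes _  | yes _ = tt
      ... | yes m≤l | no n = subst (λ u → satY K V u φ)
              (sym (trans (cong (Path.π π) (ℕₚ.≤-antisym m≤l (ℕₚ.≮⇒≥ n))) eq)) h
      ... | no n  | yes m<l = ⊥-elim (n (ℕₚ.<⇒≤ m<l))
      ... | no _  | no _ = tt
      qF : ∀ m → efF {P} (q (suc (m + l))) ≡ true
      qF m with suc (m + l) ℕₚ.≤? l
      ... | yes le = ⊥-elim (ℕₚ.<⇒≱ (s≤s (ℕₚ.m≤n+m l m)) le)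
      ... | no _   = refl

  EX⟺ : ∀ φ {w} → T w → satY K V w (EX φ) ⟺ Σ D λ d → T (w ∷ʳ d) × satY K V (w ∷ʳ d) φ
  EX⟺ φ {w} Tw = to , from
    where
    to : satY K V w (EX φ) → Σ D λ d → T (w ∷ʳ d) × satY K V (w ∷ʳ d) φ
    to (π , q , q0 , qe , qF) with Path.step π 0 | q 0 | q 1 | q 2 | q0 | qe 0 | qe 1
    ... | d , eq | zero | suc zero | suc (suc zero) | _ | _ | h =
      d , subst T eq′ (Path.inT π 1) , subst (λ u → satY K V u φ) eq′ h
      where eq′ = trans eq (cong (_∷ʳ d) (Path.start π))
    ... | _ | zero | zero | _ | _ | h | _ = ⊥-elim (⊨ff (Path.π π 0) h)
    ... | _ | zero | suc (suc zero) | _ | _ | h | _ = ⊥-elim (⊨ff (Path.π π 0) h)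
    ... | _ | zero | suc zero | zero | _ | _ | h = ⊥-elim (⊨ff (Path.π π 1) h)
    ... | _ | zero | suc zero | suc zero | _ | _ | h = ⊥-elim (⊨ff (Path.π π 1) h)
    from : (Σ D λ d → T (w ∷ʳ d) × satY K V (w ∷ʳ d) φ) → satY K V w (EX φ)
    from (d , Td , h) = cons-path K Tw d (some-path K em Td) , q , refl , qe ,
      λ l → suc (suc l) , ℕₚ.m≤n⇒m≤1+n (ℕₚ.n≤1+n l) , refl
      where
      q : ℕ → Fin 3
      q 0 = zero
      q 1 = suc zero
      q (suc (suc _)) = suc (suc zero)
      qe : ∀ m → satY K V (Path.π (cons-path K Tw d (some-path K em Td)) m) (nextδ φ (q m) (q (suc m)))
      qe 0 = tt
      qe 1 = h
      qe (suc (suc _)) = tt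

∈ˢ⟺ : ∀ {n} (p : Fin n) (a : Subset n) → p ∈ˢ a ⟺ vlookup a p ≡ true
∈ˢ⟺ p a = Vecₚ.[]=⇒lookup , Vecₚ.lookup⇒[]= p a

module _ {n : ℕ} where
  open Tests (YTests (Fin n))

  isLab : Subset n → Y (Fin n)
  isLab a = andL (elems (finFin n)) λ p → if vlookup a p then propY p else negY (propY p)

  -- There are finitely many labels, so a case distinction on them is a single formula. In this way
  -- the label-dependent transitions of NFAs and of hesitant automata become tests.
  caseLab : (Subset n → Y (Fin n)) → Y (Fin n)
  caseLab f = orL (elems (finVec finBool n)) λ a → andY (isLab a) (f a)

  module _ (em : EM) (K : KTree n) where
    open KTree K
    open ModelProps em (YModel K (Val K))

    isLab⟺ : ∀ w a → satY K (Val K) w (isLab a) ⟺ a ≡ Lab w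
    isLab⟺ w a = ⊨andF w (finFin n) _ ⟫
      ((λ h → vec-ext a (Lab w) λ p → to p (h p)) , λ { refl → from })
      where
      to : ∀ p → satY K (Val K) w (if vlookup a p then propY p else negY (propY p)) →
           vlookup a p ≡ vlookup (Lab w) p
      to p h with vlookup a p
      ... | true = sym (proj₁ (∈ˢ⟺ p (Lab w)) h)
      ... | false = bool-ext ((λ ()) , λ e → ⊥-elim (h (proj₂ (∈ˢ⟺ p (Lab w)) e)))
      from : ∀ p → satY K (Val K) w (if vlookup (Lab w) p then propY p else negY (propY p))
      from p with vlookup (Lab w) p in eq
      ... | true = proj₂ (∈ˢ⟺ p (Lab w)) eq
      ... | false = λ m → true≢false (trans (sym (proj₁ (∈ˢ⟺ p (Lab w)) m)) eq)

    caseLab⟺ : ∀ f w → satY K (Val K) w (caseLab f) ⟺ satY K (Val K) w (f (Lab w))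
    caseLab⟺ f w = ⊨orF w (finVec finBool n) _ ⟫
      ((λ (a , h , h′) → subst (λ a → satY K (Val K) w (f a)) (proj₁ (isLab⟺ w a) h) h′) ,
       λ h → Lab w , proj₂ (isLab⟺ w (Lab w)) refl , h)

-- CDL into the hub logic

module _ {n : ℕ} (K : KTree n) where
  open CDLSem K

  -- The clause for ⟨N⟩ψ with positions relative to the current one.
  DiamAt : ∀ {w} → Path K w → ℕ → (k : ℕ) → (Fin k → Subset n → Subset k) → Fin k → Subset k →
           (Fin k → CDLPath n) → CDLPath n → Set
  DiamAt π i k δ q₀ F τ ψ = Σ ℕ λ j → satP π (j + i) ψ × Σ (ℕ → Fin k) λ q → q 0 ≡ q₀ × q j ∈ˢ F ×
    (∀ l → l < j → q (suc l) ∈ˢ δ (q l) (KTree.Lab K (Path.π π (l + i)))) ×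
    (∀ l → l ≤ j → satP π (l + i) (τ (q l)))

  diam⟺ : ∀ {w} (π : Path K w) i k δ q₀ F τ ψ →
          satP π i (diam (nfa k δ q₀ F τ) ψ) ⟺ DiamAt π i k δ q₀ F τ ψ
  diam⟺ π i k δ q₀ F τ ψ = to , from
    where
    to : satP π i (diam (nfa k δ q₀ F τ) ψ) → DiamAt π i k δ q₀ F τ ψ
    to (j , i≤j , sψ , q , qi , qF , qδ , qτ) = j ∸ i , subst (λ z → satP π z ψ) (sym eq) sψ ,
      (λ l → q (l + i)) , qi , subst (λ z → q z ∈ˢ F) (sym eq) qF ,
      (λ l lt → qδ (l + i) (ℕₚ.m≤n+m i l) (subst (l + i <_) eq (ℕₚ.+-monoˡ-< i lt))) ,
      (λ l le → qτ (l + i) (ℕₚ.m≤n+m i l) (subst (l + i ≤_) eq (ℕₚ.+-monoˡ-≤ i le)))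
      where eq = ℕₚ.m∸n+n≡m i≤j
    from : DiamAt π i k δ q₀ F τ ψ → satP π i (diam (nfa k δ q₀ F τ) ψ)
    from (j , sψ , q , q0 , qF , qδ , qτ) = j + i , ℕₚ.m≤n+m i j , sψ , (λ l → q (l ∸ i)) ,
      trans (cong q (ℕₚ.n∸n≡0 i)) q0 , subst (λ z → q z ∈ˢ F) (sym (ℕₚ.m+n∸n≡m j i)) qF ,
      (λ l i≤l lt → subst₂ (λ a b → q a ∈ˢ δ (q (l ∸ i)) (KTree.Lab K (Path.π π b)))
         (sym (ℕₚ.+-∸-assoc 1 i≤l)) (ℕₚ.m∸n+n≡m i≤l)
         (qδ (l ∸ i) (ℕₚ.+-cancelʳ-< i _ _ (subst (_< j + i) (sym (ℕₚ.m∸n+n≡m i≤l)) lt)))) ,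
      (λ l i≤l le → subst (λ b → satP π b (τ (q (l ∸ i)))) (ℕₚ.m∸n+n≡m i≤l)
         (qτ (l ∸ i) (ℕₚ.+-cancelʳ-≤ i _ _ (subst (_≤ j + i) (sym (ℕₚ.m∸n+n≡m i≤l)) le))))

module _ {𝓖 : Tests} where
  open Tests 𝓖

  test : G → NBA 𝓖
  test g = 2 , aut (λ { zero → true ; (suc _) → false })
                   (λ { zero (suc _) → g ; (suc _) (suc _) → ttᵍ ; _ zero → ffᵍ })
                   (λ { zero → false ; (suc _) → true })

  test⟺ : (em : EM) (M : Model 𝓖) (g : G) (w : ℕ → Model.L M) →
          Acc M (proj₂ (test g)) w ⟺ Model._⊨_ M (w 0) g
  test⟺ em M g w = to , λ h → (λ { zero → zero ; (suc _) → suc zero }) , refl ,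
      (λ { zero → h ; (suc l) → ⊨tt _ }) , λ l → suc l , ℕₚ.n≤1+n l , refl
    where
    open Model M
    open ModelProps em M
    to : Acc M (proj₂ (test g)) w → w 0 ⊨ g
    to (ρ , ini , ρe , _) with ρ 0 | ρ 1 | ini | ρe 0
    ... | zero | suc _ | _ | h = h
    ... | zero | zero  | _ | h = ⊥-elim (⊨ff _ h)

module _ {P : Set} where
  open Tests (YTests P)

  existsPath : NBA (EnvTests ⊤ (YTests P)) → Y P
  existsPath (k , aut I δ F) =
    orL (elems (finFin k)) λ i → if I i then EY k i (λ p q → δ p q tt) F else ffᵍ

  existsPath⟺ : (em : EM) {n : ℕ} (K : KTree n) (V : P → List (KTree.D K) → Set)
    (A : NBA (EnvTests ⊤ (YTests P))) (w : List (KTree.D K)) → satY K V w (existsPath A) ⟺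
    Σ (Path K w) λ π → Acc (EnvModel ⊤ (YModel K V)) (proj₂ A) (λ l → tt , Path.π π l)
  existsPath⟺ em K V (k , aut I δ F) w = ⊨orF w (finFin k) _ ⟫
    ((λ (i , h) → let (Ii , π , q , q0 , r) = proj₁ (⊨if w (I i) (EY k i (λ p q → δ p q tt) F)) h in π , q , trans (cong I q0) Ii , r)
    , λ (π , q , ini , r) → q 0 , proj₂ (⊨if w (I (q 0)) (EY k (q 0) (λ p q → δ p q tt) F)) (ini , π , q , refl , r))
    where open ModelProps em (YModel K V)

module _ {n : ℕ} where
  private
    𝓨 : Tests
    𝓨 = EnvTests ⊤ (YTests (Fin n))
  open Tests (YTests (Fin n)) using (⌜_⌝)
  open Tests 𝓨 using (ttᵍ; ffᵍ)

  -- The states q of the NFA, marked true when the run ends there, and a sink.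
  DiamState : ℕ → Set
  DiamState k = (Fin k × Bool) ⊎ ⊤

  finDiam : ∀ k → Finite (DiamState k)
  finDiam k = fin⊎ (fin× (finFin k) finBool) (finite (tt ∷ []) λ _ → here refl)

  diam-I : ∀ {k} → Fin k → DiamState k → Bool
  diam-I q₀ (inj₁ (q , _)) = does (q Finₚ.≟ q₀)
  diam-I q₀ (inj₂ _)       = false

  -- The obligation `τ q` is attached to each state of the finite run, and `ψ` to its last one. The
  -- sink accepts every suffix.
  diam-A : ∀ {k} → (Fin k → NBA 𝓨) → NBA 𝓨 → DiamState k → NBA 𝓨
  diam-A τ ψ (inj₁ (q , false)) = τ q
  diam-A τ ψ (inj₁ (q , true))  = boolean _∧_ (τ q) ψ
  diam-A τ ψ (inj₂ _)           = test ttᵍ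

  diam-edge : ∀ {k} → (Fin k → Subset n → Subset k) → Subset k → DiamState k → DiamState k → ⊤ → Y (Fin n)
  diam-edge δ F (inj₁ (q , false)) (inj₁ (q′ , _)) _ = caseLab λ a → ⌜ vlookup (δ q a) q′ ⌝
  diam-edge δ F (inj₁ (q , true))  (inj₂ _)       _ = ⌜ vlookup F q ⌝
  diam-edge δ F (inj₂ _)           (inj₂ _)       _ = topY
  diam-edge δ F _                  _              _ = Tests.ffᵍ (YTests (Fin n))

  -- Acceptance in the sink alone forces the finite run to end; a Büchi run that keeps simulating
  -- the NFA forever is rejecting.
  diam-F : ∀ {k} → DiamState k → Bool
  diam-F (inj₁ _) = false
  diam-F (inj₂ _) = true

  diamNBA : ∀ k → (Fin k → Subset n → Subset k) → Fin k → Subset k → (Fin k → NBA 𝓨) → NBA 𝓨 → NBA 𝓨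
  diamNBA k δ q₀ F τ ψ = Nested.nested {𝓖 = YTests (Fin n)} {Ev = ⊤} (finDiam k)
    (diam-I q₀) (diam-A τ ψ) (diam-edge δ F) diam-F

  mutual
    toY : CDL n → Y (Fin n)
    toY tt        = topY
    toY (prop p)  = propY p
    toY (neg φ)   = negY (toY φ)
    toY (and φ ψ) = andY (toY φ) (toY ψ)
    toY (E ψ)     = existsPath (toNBA′ ψ)
    toY (D1 φ)    = EX (toY φ)

    toNBA′ : CDLPath n → NBA 𝓨
    toNBA′ (st φ)    = test (λ _ → toY φ)
    toNBA′ (neg ψ)   = complement (toNBA′ ψ)
    toNBA′ (and ψ χ) = boolean _∧_ (toNBA′ ψ) (toNBA′ χ)
    toNBA′ (diam (nfa k δ q₀ F τ) ψ) = diamNBA k δ q₀ F (λ q → toNBA′ (τ q)) (toNBA′ ψ)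

  module ToY (em : EM) (K : KTree n) where
    open KTree K
    open CDLSem K
    open ModelProps em (YModel K (Val K))
    M : Model 𝓨
    M = EnvModel ⊤ (YModel K (Val K))

    from-pos : ∀ {w} → Path K w → ℕ → ℕ → ⊤ × List D
    from-pos π i m = tt , Path.π π (m + i)

    mutual
      toY⟺ : ∀ φ {w} → T w → satS w φ ⟺ satY K (Val K) w (toY φ)
      toY⟺ tt        Tw = ⟺-refl
      toY⟺ (prop p)  Tw = ⟺-refl
      toY⟺ (neg φ)   Tw = ¬-⟺ (toY⟺ φ Tw)
      toY⟺ (and φ ψ) Tw = ×-⟺ (toY⟺ φ Tw) (toY⟺ ψ Tw)
      toY⟺ (E ψ)     {w} Tw = (Σ-⟺ λ π → toNBA′⟺ ψ π 0 ⟫ shift0 π) ⟫ ⟺-sym (existsPath⟺ em K (Val K) (toNBA′ ψ) w)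
        where
        shift0 : ∀ π → Acc M (proj₂ (toNBA′ ψ)) (from-pos π 0) ⟺
                 Acc M (proj₂ (toNBA′ ψ)) (λ l → tt , Path.π π l)
        shift0 π = Acc-cong M (proj₂ (toNBA′ ψ)) λ l → cong (λ x → tt , Path.π π x) (ℕₚ.+-identityʳ l)
      toY⟺ (D1 φ)    {w} Tw = Σ-⟺ (λ d → (λ (Td , h) → Td , proj₁ (toY⟺ φ Td) h) ,
                                       (λ (Td , h) → Td , proj₂ (toY⟺ φ Td) h)) ⟫
                              ⟺-sym (EX⟺ em K (Val K) (toY φ) Tw)

      toNBA′⟺ : ∀ ψ {w} (π : Path K w) i → satP π i ψ ⟺ Acc M (proj₂ (toNBA′ ψ)) (from-pos π i)
      toNBA′⟺ (st φ) π i = toY⟺ φ (Path.inT π i) ⟫ ⟺-sym (test⟺ em M _ (from-pos π i))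
      toNBA′⟺ (neg ψ) π i = ¬-⟺ (toNBA′⟺ ψ π i) ⟫ ⟺-sym (complement⟺ em M (toNBA′ ψ) (from-pos π i))
      toNBA′⟺ (and ψ χ) π i = ×-⟺ (toNBA′⟺ ψ π i) (toNBA′⟺ χ π i) ⟫
        ⟺-sym (conjunction⟺ em M (toNBA′ ψ) (toNBA′ χ) (from-pos π i))
      toNBA′⟺ (diam (nfa k δ q₀ F τ) ψ) π i = diam⟺ K π i k δ q₀ F τ ψ ⟫
        diamNBA⟺ π i k δ q₀ F τ ψ (λ q j → toNBA′⟺ (τ q) π j) (λ j → toNBA′⟺ ψ π j)

      diamNBA⟺ : ∀ {w} (π : Path K w) i k δ q₀ F τ ψ →
        (∀ q j → satP π j (τ q) ⟺ Acc M (proj₂ (toNBA′ (τ q))) (from-pos π j)) →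
        (∀ j → satP π j ψ ⟺ Acc M (proj₂ (toNBA′ ψ)) (from-pos π j)) →
        DiamAt K π i k δ q₀ F τ ψ ⟺
        Acc M (proj₂ (diamNBA k δ q₀ F (λ q → toNBA′ (τ q)) (toNBA′ ψ))) (from-pos π i)
      diamNBA⟺ {w} π i k δ q₀ F τ ψ ihτ ihψ =
        (to , from) ⟫ ⟺-sym (Nested.Correct.nested⟺ {𝓖 = YTests (Fin n)} {Ev = ⊤} (finDiam k) (diam-I q₀) A
          (diam-edge δ F) diam-F em (YModel K (Val K)) (from-pos π i))
        where
        A : DiamState k → NBA 𝓨
        A = diam-A (λ q → toNBA′ (τ q)) (toNBA′ ψ)
        Trace : Set
        Trace = Σ (ℕ → DiamState k) λ z → diam-I q₀ (z 0) ≡ true ×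
          (∀ l → satY K (Val K) (Path.π π (l + i)) (diam-edge δ F (z l) (z (suc l)) tt)) ×
          (∀ l → Acc M (proj₂ (A (z l))) (λ m → from-pos π i (m + l))) ×
          Unbounded (λ l → diam-F (z l) ≡ true)
        shift : ∀ (B : NBA 𝓨) l → Acc M (proj₂ B) (λ m → from-pos π i (m + l)) ⟺
                Acc M (proj₂ B) (from-pos π (l + i))
        shift B l = Acc-cong M (proj₂ B) λ m → cong (λ x → tt , Path.π π x) (ℕₚ.+-assoc m l i)
        edge⟺ : ∀ q q′ b l → satY K (Val K) (Path.π π (l + i)) (diam-edge δ F (inj₁ (q , false)) (inj₁ (q′ , b)) tt) ⟺
                q′ ∈ˢ δ q (Lab (Path.π π (l + i)))
        edge⟺ q q′ b l = caseLab⟺ em K _ _ ⟫ ⊨⌜⌝ (Path.π π (l + i)) _ ⟫ ⟺-sym (∈ˢ⟺ q′ _)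
        to : DiamAt K π i k δ q₀ F τ ψ → Trace
        to (j , sψ , q , q0 , qF , qδ , qτ) = z , z0 (ℕₚ.<-cmp 0 j) , (λ l → ze l (ℕₚ.<-cmp l j) (ℕₚ.<-cmp (suc l) j)) ,
          (λ l → zA l (ℕₚ.<-cmp l j)) , λ l → suc (l + j) , ℕₚ.m≤n⇒m≤1+n (ℕₚ.m≤m+n l j) , zF l (ℕₚ.<-cmp (suc (l + j)) j)
          where
          zz : ∀ l → Tri (l < j) (l ≡ j) (j < l) → DiamState k
          zz l (tri< _ _ _) = inj₁ (q l , false)
          zz l (tri≈ _ _ _) = inj₁ (q l , true)
          zz l (tri> _ _ _) = inj₂ tt
          z : ℕ → DiamState k
          z l = zz l (ℕₚ.<-cmp l j)
          z0 : ∀ c → diam-I q₀ (zz 0 c) ≡ true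
          z0 (tri< _ _ _) = proj₂ (does⟺ (q 0 Finₚ.≟ q₀)) q0
          z0 (tri≈ _ _ _) = proj₂ (does⟺ (q 0 Finₚ.≟ q₀)) q0
          ze : ∀ l c c′ → satY K (Val K) (Path.π π (l + i)) (diam-edge δ F (zz l c) (zz (suc l) c′) tt)
          ze l (tri< lt _ _) (tri< _ _ _) = proj₂ (edge⟺ (q l) (q (suc l)) false l) (qδ l lt)
          ze l (tri< lt _ _) (tri≈ _ _ _) = proj₂ (edge⟺ (q l) (q (suc l)) true l) (qδ l lt)
          ze l (tri< lt _ _) (tri> n _ gt) = ⊥-elim (ℕₚ.<⇒≱ gt lt)
          ze l (tri≈ _ refl _) (tri> _ _ _) = proj₂ (⊨⌜⌝ (Path.π π (l + i)) _) (proj₁ (∈ˢ⟺ (q l) F) qF)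
          ze l (tri≈ _ refl _) (tri< lt _ _) = ⊥-elim (ℕₚ.<⇒≱ lt (ℕₚ.n≤1+n l))
          ze l (tri≈ _ refl _) (tri≈ _ e _) = ⊥-elim (ℕₚ.1+n≢n e)
          ze l (tri> _ _ gt) (tri> _ _ _) = tt
          ze l (tri> _ _ gt) (tri< lt _ _) = ⊥-elim (ℕₚ.<⇒≱ gt (ℕₚ.≤-trans (ℕₚ.n≤1+n l) (ℕₚ.<⇒≤ lt)))
          ze l (tri> _ _ gt) (tri≈ _ refl _) = ⊥-elim (ℕₚ.<⇒≱ gt (ℕₚ.n≤1+n l))
          zA : ∀ l c → Acc M (proj₂ (A (zz l c))) (λ m → from-pos π i (m + l))
          zA l (tri< lt _ _) = proj₂ (shift (toNBA′ (τ (q l))) l) (proj₁ (ihτ (q l) (l + i)) (qτ l (ℕₚ.<⇒≤ lt)))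
          zA l (tri≈ _ refl _) = proj₂ (conjunction⟺ em M (toNBA′ (τ (q l))) (toNBA′ ψ) _)
            ( proj₂ (shift (toNBA′ (τ (q l))) l) (proj₁ (ihτ (q l) (l + i)) (qτ l ℕₚ.≤-refl))
            , proj₂ (shift (toNBA′ ψ) l) (proj₁ (ihψ (l + i)) sψ) )
          zA l (tri> _ _ _) = proj₂ (test⟺ em M _ (λ m → from-pos π i (m + l))) tt
          zF : ∀ l c → diam-F (zz (suc (l + j)) c) ≡ true
          zF l (tri< lt _ _) = ⊥-elim (ℕₚ.<⇒≱ lt (ℕₚ.m≤n⇒m≤1+n (ℕₚ.m≤n+m j l)))
          zF l (tri≈ _ e _) = ⊥-elim (ℕₚ.<⇒≢ (s≤s (ℕₚ.m≤n+m j l)) (sym e))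
          zF l (tri> _ _ _) = refl
        from : Trace → DiamAt K π i k δ q₀ F τ ψ
        from (z , ini , ze , zA , zF) = let (m , _ , Fm) = zF 0 in
            [ (λ h → ⊥-elim (true≢false (trans (sym Fm) (cong diam-F (h m ℕₚ.≤-refl))))) , finish ]′ (phase m)
          where
          state : DiamState k → Fin k
          state = [ proj₁ , (λ _ → q₀) ]′
          q : ℕ → Fin k
          q l = state (z l)
          Live : ℕ → Set
          Live l = z l ≡ inj₁ (q l , false)
          Ends : Set
          Ends = Σ ℕ λ j → z j ≡ inj₁ (q j , true) × (∀ l → l < j → Live l)
          mark : ∀ l → (Σ Bool λ b → z l ≡ inj₁ (q l , b)) → (∀ m → m < l → Live m) →
                 (∀ m → m ≤ l → Live m) ⊎ Ends
          mark l (false , eq) h = inj₁ λ m le → [ h m , (λ { refl → eq }) ]′ (ℕₚ.m≤n⇒m<n∨m≡n le)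
          mark l (true , eq)  h = inj₂ (l , eq , h)
          succ-live : ∀ l y → satY K (Val K) (Path.π π (l + i)) (diam-edge δ F (inj₁ (q l , false)) y tt) →
                      Σ Bool λ b → y ≡ inj₁ (state y , b)
          succ-live l (inj₁ (_ , b)) _ = b , refl
          succ-live l (inj₂ _) h = ⊥-elim (⊨ff (Path.π π (l + i)) h)
          first : ∀ y → diam-I q₀ y ≡ true → Σ Bool λ b → y ≡ inj₁ (state y , b)
          first (inj₁ (_ , b)) _ = b , refl
          phase : ∀ l → (∀ m → m ≤ l → Live m) ⊎ Ends
          phase zero = mark 0 (first (z 0) ini) λ _ ()
          phase (suc l) with phase l
          ... | inj₂ e = inj₂ e
          ... | inj₁ h = mark (suc l) (succ-live l (z (suc l)) (subst (λ x →
                    satY K (Val K) (Path.π π (l + i)) (diam-edge δ F x (z (suc l)) tt)) (h l ℕₚ.≤-refl) (ze l)))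
                  λ { m (s≤s le) → h m le }
          finish : Ends → DiamAt K π i k δ q₀ F τ ψ
          finish (j , eqj , live) = j , proj₂ (ihψ (j + i)) (proj₁ (shift (toNBA′ ψ) j) (proj₂ both)) , q ,
              init-state (z 0) ini , ends (z (suc j)) (subst (λ x →
                 satY K (Val K) (Path.π π (j + i)) (diam-edge δ F x (z (suc j)) tt)) eqj (ze j)) ,
              (λ l lt → proj₁ (edge⟺ (q l) (q (suc l)) (proj₁ (marked (suc l) lt)) l)
                (subst₂ (λ x y → satY K (Val K) (Path.π π (l + i)) (diam-edge δ F x y tt))
                   (live l lt) (proj₂ (marked (suc l) lt)) (ze l))) ,
              λ l le → [ (λ lt → proj₂ (ihτ (q l) (l + i)) (proj₁ (shift (toNBA′ (τ (q l))) l)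
                            (subst (λ x → Acc M (proj₂ (A x)) (λ m → from-pos π i (m + l))) (live l lt) (zA l))))
                       , (λ { refl → proj₂ (ihτ (q l) (l + i)) (proj₁ (shift (toNBA′ (τ (q l))) l) (proj₁ both)) }) ]′
                       (ℕₚ.m≤n⇒m<n∨m≡n le)
            where
            both = proj₁ (conjunction⟺ em M (toNBA′ (τ (q j))) (toNBA′ ψ) (λ m → from-pos π i (m + j)))
                     (subst (λ x → Acc M (proj₂ (A x)) (λ m → from-pos π i (m + j))) eqj (zA j))
            marked : ∀ l → l ≤ j → Σ Bool λ b → z l ≡ inj₁ (q l , b)
            marked l le = [ (λ lt → false , live l lt) , (λ { refl → true , eqj }) ]′ (ℕₚ.m≤n⇒m<n∨m≡n le)
            init-state : ∀ x → diam-I q₀ x ≡ true → state x ≡ q₀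
            init-state (inj₁ (x , _)) h = proj₁ (does⟺ (x Finₚ.≟ q₀)) h
            ends : ∀ y → satY K (Val K) (Path.π π (j + i)) (diam-edge δ F (inj₁ (q j , true)) y tt) → q j ∈ˢ F
            ends (inj₁ _) h = ⊥-elim (⊨ff (Path.π π (j + i)) h)
            ends (inj₂ _) h = proj₂ (∈ˢ⟺ (q j) F) (proj₁ (⊨⌜⌝ (Path.π π (j + i)) _) h)

-- The hub logic into CDL

CDLTests PathTests : ℕ → Tests
CDLTests n  = record { G = CDL n ; ttᵍ = tt ; ¬ᵍ_ = neg ; _∧ᵍ_ = and }
PathTests n = record { G = CDLPath n ; ttᵍ = st tt ; ¬ᵍ_ = neg ; _∧ᵍ_ = and }

CDLModel : ∀ {n} → KTree n → Model (CDLTests n)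
CDLModel K = record
  { L = List (KTree.D K) ; _⊨_ = CDLSem.satS K ; ⊨tt = λ _ → tt
  ; ⊨¬ = λ _ _ → ⟺-refl ; ⊨∧ = λ _ _ _ → ⟺-refl }

PathModel : ∀ {n} (K : KTree n) {w : List (KTree.D K)} → Path K w → Model (PathTests n)
PathModel K π = record
  { L = ℕ ; _⊨_ = CDLSem.satP K π ; ⊨tt = λ _ → tt
  ; ⊨¬ = λ _ _ → ⟺-refl ; ⊨∧ = λ _ _ _ → ⟺-refl }

-- Büchi acceptance without determinisation.  A suffix starting at i lies in e·e·e·… iff arbitrarily
-- late there are positions j ≤ m such that the profiles satisfy [i,j) = e and [i,m) = [j,m):
-- jumping from one such j to another one beyond m yields a block of profile e.
module AccFormula (n k : ℕ) (δ : Fin k → Fin k → CDL n) (F : Fin k → Bool) where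
  open Tests (PathTests n)
  open Profile (CDLTests n) k δ F

  -- An NFA of CDL reads labels only, whereas the profile of a letter depends on CDL formulas. A
  -- state therefore pairs the profile of the factor read so far with a guess of the profile of the
  -- next letter, and its path formula `tracker-τ` verifies the guess.
  finTracker : Finite (Prof × Prof)
  finTracker = fin× finProf finProf

  abstract
    N : ℕ
    N = size finTracker

    code : Prof → Prof → Fin N
    code t m = enc finTracker (t , m)

    tracked letterOf : Fin N → Prof
    tracked x  = proj₁ (dec finTracker x)
    letterOf x = proj₂ (dec finTracker x)

    tracked-code : ∀ t m → tracked (code t m) ≡ t
    tracked-code t m = cong proj₁ (dec-enc finTracker (t , m))

    letter-code : ∀ t m → letterOf (code t m) ≡ m
    letter-code t m = cong proj₂ (dec-enc finTracker (t , m))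

  after : Fin N → Prof
  after x = mul (tracked x) (letterOf x)

  tracker-δ : Fin N → Subset n → Subset N
  tracker-δ x _ = tabulate λ y → does (tracked y ≟ᵛ after x)

  tracker-F : Prof → Subset N
  tracker-F t = tabulate λ y → does (tracked y ≟ᵛ t)

  tracker-τ : Fin N → CDLPath n
  tracker-τ x = st (isL (letterOf x))

  -- An NFA has one initial state, but the first letter also has to be guessed; this guess `m`
  -- becomes the disjunction in `dia`.
  guess : Prof → CDLPath n → Prof → CDLPath n
  guess t ψ m = diam (nfa N tracker-δ (code one m) (tracker-F t) tracker-τ) ψ

  abstract
    dia : Prof → CDLPath n → CDLPath n
    dia t ψ = orL (elems finProf) (guess t ψ)

  mergeAt : Prof → Prof → CDLPath n
  mergeAt e c = and ⌜ does (mul e c ≟ᵛ c) ⌝ (dia c (st tt))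

  merges : Prof → CDLPath n
  merges e = orL (elems finProf) (mergeAt e)

  hitAt : Prof → Prof → Prof → CDLPath n
  hitAt e a b = and ⌜ does (mul a b ≟ᵛ e) ⌝ (dia b (merges e))

  hit : Prof → Prof → CDLPath n
  hit e a = orL (elems finProf) (hitAt e a)

  -- A formula evaluated at a later position `p` cannot refer back to the starting position `i`. The
  -- profile of the factor between them is therefore passed on as the constant `a`, and `recurs`
  -- ranges over all its values, which together cover every `p`.
  unmissed : Prof → Prof → CDLPath n
  unmissed e a = neg (dia a (neg (hit e a)))

  recurs : Prof → CDLPath n
  recurs e = andL (elems finProf) (unmissed e)

  acceptsAt : (Fin k → Bool) → Prof → Prof → CDLPath n
  acceptsAt I s e = and ⌜ idem e ∧ lasso s e I ⌝ (dia s (recurs e))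

  accepts : (Fin k → Bool) → CDLPath n
  accepts I = orL (elems finProf) λ s → orL (elems finProf) (acceptsAt I s)

  module Correct (em : EM) (K : KTree n) {v : List (KTree.D K)} (π : Path K v) where
    open CDLSem K
    open Word em (CDLModel K) (Path.π π)
    open ModelProps em (PathModel K π)

    ∈tab : ∀ {N} (f : Fin N → Bool) x → x ∈ˢ tabulate f ⟺ f x ≡ true
    ∈tab f x = ∈ˢ⟺ x (tabulate f) ⟫ ≡→⟺ (cong (_≡ true) (Vecₚ.lookup∘tabulate f x))

    Lab : ℕ → Subset n
    Lab l = KTree.Lab K (Path.π π l)

    F→ : ∀ t x → x ∈ˢ tracker-F t → tracked x ≡ t
    F→ t x h = proj₁ (does⟺ (tracked x ≟ᵛ t)) (proj₁ (∈tab (λ y → does (tracked y ≟ᵛ t)) x) h)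

    F← : ∀ t x → tracked x ≡ t → x ∈ˢ tracker-F t
    F← t x h = proj₂ (∈tab (λ y → does (tracked y ≟ᵛ t)) x) (proj₂ (does⟺ (tracked x ≟ᵛ t)) h)

    δ→ : ∀ x y a → y ∈ˢ tracker-δ x a → tracked y ≡ after x
    δ→ x y a = F→ (after x) y

    δ← : ∀ x y a → tracked y ≡ after x → y ∈ˢ tracker-δ x a
    δ← x y a = F← (after x) y

    guess⟺ : ∀ t ψ i → (Σ Prof λ m → satP π i (guess t ψ m)) ⟺
             (Σ ℕ λ j → i ≤ j × ty i j ≡ t × satP π j ψ)
    guess⟺ t ψ i = to , from
      where
      to : (Σ Prof λ m → satP π i (guess t ψ m)) →
           Σ ℕ λ j → i ≤ j × ty i j ≡ t × satP π j ψ
      to (m , h) with proj₁ (diam⟺ K π i N tracker-δ (code one m) (tracker-F t) tracker-τ ψ) h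
      ... | j , sψ , q , q0 , qF , qδ , qτ = j + i , ℕₚ.m≤n+m i j ,
            trans (sym (track j ℕₚ.≤-refl))
              (F→ t (q j) qF) , sψ
        where
        track : ∀ l → l ≤ j → tracked (q l) ≡ ty i (l + i)
        track zero    _  = trans (cong tracked q0) (trans (tracked-code one m) (ty-one i))
        track (suc l) lt = trans (δ→ (q l) (q (suc l)) (Lab (l + i)) (qδ l lt))
          (trans (cong₂ mul (track l (ℕₚ.<⇒≤ lt)) (proj₁ (isL⟺ (l + i) (letterOf (q l))) (qτ l (ℕₚ.<⇒≤ lt))))
            (ty-mul (ℕₚ.m≤n+m i l) (ℕₚ.n≤1+n (l + i))))
      from : (Σ ℕ λ j → i ≤ j × ty i j ≡ t × satP π j ψ) →
             Σ Prof λ m → satP π i (guess t ψ m)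
      from (j , i≤j , eq , sψ) = ty i (suc i) ,
        proj₂ (diam⟺ K π i N tracker-δ (code one (ty i (suc i))) (tracker-F t) tracker-τ ψ)
          ( j ∸ i , subst (λ z → satP π z ψ) (sym j≡) sψ , q
          , cong (λ t → code t (ty i (suc i))) (sym (ty-one i))
          , F← t (q (j ∸ i)) (trans (q₁ (j ∸ i)) (trans (cong (ty i) j≡) eq))
          , (λ l _ → δ← (q l) (q (suc l)) (Lab (l + i)) (trans (q₁ (suc l))
              (trans (sym (ty-mul (ℕₚ.m≤n+m i l) (ℕₚ.n≤1+n (l + i)))) (sym (cong₂ mul (q₁ l) (q₂ l))))))
          , λ l _ → proj₂ (isL⟺ (l + i) (letterOf (q l))) (q₂ l) )
        where
        j≡ : j ∸ i + i ≡ j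
        j≡ = ℕₚ.m∸n+n≡m i≤j
        q : ℕ → Fin N
        q l = code (ty i (l + i)) (ty (l + i) (suc (l + i)))
        q₁ : ∀ l → tracked (q l) ≡ ty i (l + i)
        q₁ l = tracked-code _ _
        q₂ : ∀ l → letterOf (q l) ≡ ty (l + i) (suc (l + i))
        q₂ l = letter-code _ _

    abstract
      dia⟺ : ∀ t ψ i → satP π i (dia t ψ) ⟺ Σ ℕ λ j → i ≤ j × ty i j ≡ t × satP π j ψ
      dia⟺ t ψ i = ⊨orF i finProf (guess t ψ) ⟫ guess⟺ t ψ i

    merges⟺ : ∀ e j → satP π j (merges e) ⟺ Σ ℕ λ m → j ≤ m × mul e (ty j m) ≡ ty j m
    merges⟺ e j = ⊨orF j finProf (mergeAt e) ⟫ (to , from)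
      where
      to : (Σ Prof λ c → satP π j (mergeAt e c)) → Σ ℕ λ m → j ≤ m × mul e (ty j m) ≡ ty j m
      to (c , h , h′) with proj₁ (dia⟺ c (st tt) j) h′
      ... | m , le , eq , _ = m , le , subst (λ c → mul e c ≡ c) (sym eq)
              (proj₁ (does⟺ (mul e c ≟ᵛ c)) (proj₁ (⊨⌜⌝ j (does (mul e c ≟ᵛ c))) h))
      from : (Σ ℕ λ m → j ≤ m × mul e (ty j m) ≡ ty j m) → Σ Prof λ c → satP π j (mergeAt e c)
      from (m , le , eq) = ty j m ,
        proj₂ (⊨⌜⌝ j (does (mul e (ty j m) ≟ᵛ ty j m))) (proj₂ (does⟺ (mul e (ty j m) ≟ᵛ ty j m)) eq) ,
        proj₂ (dia⟺ (ty j m) (st tt) j) (m , le , refl , tt)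

    Hit : Prof → Prof → ℕ → Set
    Hit e a p = Σ ℕ λ j → p ≤ j × mul a (ty p j) ≡ e × Σ ℕ λ m → j ≤ m × mul e (ty j m) ≡ ty j m

    hit⟺ : ∀ e a p → satP π p (hit e a) ⟺ Hit e a p
    hit⟺ e a p = ⊨orF p finProf (hitAt e a) ⟫ (to , from)
      where
      to : (Σ Prof λ b → satP π p (hitAt e a b)) → Hit e a p
      to (b , h , h′) with proj₁ (dia⟺ b (merges e) p) h′
      ... | j , le , eq , h″ = j , le , trans (cong (mul a) eq)
              (proj₁ (does⟺ (mul a b ≟ᵛ e)) (proj₁ (⊨⌜⌝ p (does (mul a b ≟ᵛ e))) h)) ,
              proj₁ (merges⟺ e j) h″
      from : Hit e a p → Σ Prof λ b → satP π p (hitAt e a b)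
      from (j , le , eq , h) = ty p j ,
        proj₂ (⊨⌜⌝ p (does (mul a (ty p j) ≟ᵛ e))) (proj₂ (does⟺ (mul a (ty p j) ≟ᵛ e)) eq) ,
        proj₂ (dia⟺ (ty p j) (merges e) p) (j , le , refl , proj₂ (merges⟺ e j) h)

    Recurs : Prof → ℕ → Set
    Recurs e i = ∀ p → i ≤ p → Σ ℕ λ j → p ≤ j × ty i j ≡ e × Σ ℕ λ m → j ≤ m × mul e (ty j m) ≡ ty j m

    recurs⟺ : ∀ e i → satP π i (recurs e) ⟺ Recurs e i
    recurs⟺ e i = ⊨andF i finProf (unmissed e) ⟫ (to , from)
      where
      to : (∀ a → satP π i (unmissed e a)) → Recurs e i
      to h p le = let (j , p≤j , eq , r) = proj₁ (hit⟺ e (ty i p) p) reached in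
          j , p≤j , trans (sym (ty-mul le p≤j)) eq , r
        where
        reached : satP π p (hit e (ty i p))
        reached = ¬¬-elim em λ n →
          h (ty i p) (proj₂ (dia⟺ (ty i p) (neg (hit e (ty i p))) i) (p , le , refl , n))
      from : Recurs e i → ∀ a → satP π i (unmissed e a)
      from h a d = refute (proj₁ (dia⟺ a (neg (hit e a)) i) d)
        where
        refute : ¬ (Σ ℕ λ p → i ≤ p × ty i p ≡ a × ¬ satP π p (hit e a))
        refute (p , le , eq , n) = let (j , p≤j , eq′ , r) = h p le in
          n (proj₂ (hit⟺ e a p) (j , p≤j ,
            trans (cong (λ a → mul a (ty p j)) (sym eq)) (trans (ty-mul le p≤j) eq′) , r))

    accepts⟺ : ∀ I → satP π 0 (accepts I) ⟺ Accepts I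
    accepts⟺ I = ⊨orF 0 finProf (λ s → orL (elems finProf) (acceptsAt I s)) ⟫
                 Σ-⟺ (λ s → ⊨orF 0 finProf (acceptsAt I s)) ⟫ (to , from)
      where
      to : (Σ Prof λ s → Σ Prof λ e → satP π 0 (acceptsAt I s e)) → Accepts I
      to (s , e , h , h′) = lasso-sound fac I (proj₂ parts)
        where
        parts : idem e ≡ true × lasso s e I ≡ true
        parts = proj₁ ∧-⟺ (proj₁ (⊨⌜⌝ 0 (idem e ∧ lasso s e I)) h)
        D : Σ ℕ λ j → 0 ≤ j × ty 0 j ≡ s × satP π j (recurs e)
        D = proj₁ (dia⟺ s (recurs e) 0) h′
        i : ℕ
        i = proj₁ D
        rec : Recurs e i
        rec = proj₁ (recurs⟺ e i) (proj₂ (proj₂ (proj₂ D)))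
        Mark : Set
        Mark = Σ ℕ λ j → Σ ℕ λ m → i ≤ j × j ≤ m × ty i m ≡ ty j m
        -- From `ty i m ≡ ty j m` and `ty i j′ ≡ e` with `m < j′` one gets `ty j j′ ≡ mul (ty j m)
        -- (ty m j′) ≡ mul (ty i m) (ty m j′) ≡ e`. The next mark merges too: `ty i m′ ≡ mul e (ty
        -- j′ m′) ≡ ty j′ m′`.
        jump : (x : Mark) → Σ Mark λ y → proj₁ x < proj₁ y × ty (proj₁ x) (proj₁ y) ≡ e
        jump (j , m , i≤j , j≤m , mg) =
          let i≤m = ℕₚ.≤-trans i≤j j≤m
              (j′ , m<j′ , eq , m′ , j′≤m′ , mg′) = rec (suc m) (ℕₚ.m≤n⇒m≤1+n i≤m)
              i≤j′ = ℕₚ.≤-trans i≤m (ℕₚ.<⇒≤ m<j′)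
          in (j′ , m′ , i≤j′ , j′≤m′ ,
               trans (sym (ty-mul i≤j′ j′≤m′)) (trans (cong (λ t → mul t (ty j′ m′)) eq) mg′)) ,
             ℕₚ.≤-<-trans j≤m m<j′ ,
             trans (sym (ty-mul j≤m (ℕₚ.<⇒≤ m<j′))) (trans (cong (λ t → mul t (ty m j′)) (sym mg))
               (trans (ty-mul i≤m (ℕₚ.<⇒≤ m<j′)) eq))
        marks : ℕ → Mark
        marks = iterate (i , i , ℕₚ.≤-refl , ℕₚ.≤-refl , refl) λ _ x → proj₁ (jump x)
        fac : Factor s e
        fac = record
          { J = λ a → proj₁ (marks a) ; inc = λ a → proj₁ (proj₂ (jump (marks a)))
          ; head = proj₁ (proj₂ (proj₂ D)) ; block = λ a → proj₂ (proj₂ (jump (marks a)))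
          ; idemp = proj₁ (does⟺ (mul e e ≟ᵛ e)) (proj₁ parts) }
      from : Accepts I → Σ Prof λ s → Σ Prof λ e → satP π 0 (acceptsAt I s e)
      from acc = choose (proj₁ factorisation) (proj₁ (proj₂ factorisation)) (proj₂ (proj₂ factorisation))
        where
        choose : ∀ s e → Factor s e → Σ Prof λ s → Σ Prof λ e → satP π 0 (acceptsAt I s e)
        choose s e fac = s , e ,
          proj₂ (⊨⌜⌝ 0 (idem e ∧ lasso s e I))
            (proj₂ ∧-⟺ (proj₂ (does⟺ (mul e e ≟ᵛ e)) idemp , lasso-complete fac I acc)) ,
          proj₂ (dia⟺ s (recurs e) 0) (J 0 , z≤n , head , proj₂ (recurs⟺ e (J 0)) λ p le →
            J (suc p) , ℕₚ.≤-trans (ℕₚ.n≤1+n p) (inc-≥ inc (suc p)) , blocks (s≤s z≤n) ,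
            J (suc (suc p)) , ℕₚ.<⇒≤ (inc (suc p)) ,
            trans (cong (mul e) (block (suc p))) (trans idemp (sym (block (suc p)))))
          where open Factor fac

toC : ∀ {n} → Y (Fin n) → CDL n
toC topY         = tt
toC (propY p)    = prop p
toC (negY φ)     = neg (toC φ)
toC (andY φ ψ)   = and (toC φ) (toC ψ)
toC {n} (EY k i δ F) = E (AccFormula.accepts n k (λ p q → toC (δ p q)) F λ j → does (j Finₚ.≟ i))

toC⟺ : (em : EM) {n : ℕ} (K : KTree n) (φ : Y (Fin n)) (w : List (KTree.D K)) →
       satY K (Val K) w φ ⟺ CDLSem.satS K w (toC φ)
toC⟺ em K topY         w = ⟺-refl
toC⟺ em K (propY p)    w = ⟺-refl
toC⟺ em K (negY φ)     w = ¬-⟺ (toC⟺ em K φ w)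
toC⟺ em K (andY φ ψ)   w = ×-⟺ (toC⟺ em K φ w) (toC⟺ em K ψ w)
toC⟺ em {n} K (EY k i δ F) w = Σ-⟺ λ π →
  (Σ-⟺ λ q → ×-⟺ (⟺-sym (does⟺ (q 0 Finₚ.≟ i)))
    (×-⟺ (Π-⟺ λ l → toC⟺ em K (δ (q l) (q (suc l))) (Path.π π l)) ⟺-refl)) ⟫
  ⟺-sym (AccFormula.Correct.accepts⟺ n k (λ p q → toC (δ p q)) F em K π λ j → does (j Finₚ.≟ i))

-- Projection of a chain variable in the hub logic

E-unfold : ∀ {n} (K : KTree n) {P : Set} (V : P → List (KTree.D K) → Set) {k} p δ (F : Fin k → Bool) {w} → KTree.T K w →
  satY K V w (EY k p δ F) ⟺ Σ (Fin k) λ q → satY K V w (δ p q) ×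
    Σ (KTree.D K) λ d → KTree.T K (w ∷ʳ d) × satY K V (w ∷ʳ d) (EY k q δ F)
E-unfold K V {k} p δ F {w} Tw = to , from
  where
  to : satY K V w (EY k p δ F) → _
  to (π , q , refl , qe , qF) with Path.step π 0
  ... | d , eq = q 1 , subst (λ u → satY K V u (δ (q 0) (q 1))) (Path.start π) (qe 0) , d ,
        subst (KTree.T K) eq′ (Path.inT π 1) , subst (λ u → satY K V u (EY k (q 1) δ F)) eq′
          ( record { π = λ l → Path.π π (suc l) ; start = refl ; inT = λ l → Path.inT π (suc l)
                   ; step = λ l → Path.step π (suc l) }
          , (λ l → q (suc l)) , refl , (λ l → qe (suc l)) , shift )
        where
        eq′ = trans eq (cong (_∷ʳ d) (Path.start π))
        shift : Unbounded (λ l → F (q (suc l)) ≡ true)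
        shift l with qF (suc l)
        ... | suc j , s≤s le , Fj = j , le , Fj
  from : _ → satY K V w (EY k p δ F)
  from (q , h , d , Td , π , r , r0 , re , rF) = cons-path K Tw d π , s , refl , se ,
      λ l → let (j , le , Fj) = rF l in suc j , ℕₚ.m≤n⇒m≤1+n le , Fj
    where
    s : ℕ → Fin k
    s zero    = p
    s (suc l) = r l
    se : ∀ l → satY K V (Path.π (cons-path K Tw d π) l) (δ (s l) (s (suc l)))
    se zero    = subst (λ q → satY K V w (δ p q)) (sym r0) h
    se (suc l) = re l

module Projection (P X : Set) (fX : Finite X) (var : X → P) where
  open Tests (YTests P) using (⌜_⌝; ffᵍ; andL)

  -- The Boolean is the membership of the path node in the chain to be quantified; the factor `⊤`
  -- gives the shape of a track over a trivial environment that `project` and `existsPath` expect.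
  Bits : Set
  Bits = Bool × ⊤

  𝓑 : Tests
  𝓑 = EnvTests Bits (YTests P)

  erase : Y (Maybe P) → Y P
  erase = sub λ { nothing → ffᵍ ; (just p) → propY p }

  inactive : Y P
  inactive = andL (elems fX) λ x → negY (EF (propY (var x)))

  -- A run either stays on the distinguished path or leaves it below the current node.  A child off
  -- the path that contains no chain variable can be replaced by a copy of it; a child that contains
  -- x is off the path iff the next node of the path does not contain x.
  Mode Stage : Set
  Mode  = Maybe (Maybe X)
  Stage = X ⊎ ⊤

  -- A state `(p , q , m)` announces the next automaton state `q` beforehand: the test from `p` to
  -- `q` speaks of the distinguished path, so it is checked by an inner automaton, and inner
  -- automata are attached to states.
  PState : ℕ → Set
  PState k = (Fin k × Fin k × Mode) ⊎ Stage

  finPState : ∀ k → Finite (PState k)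
  finPState k = fin⊎ (fin× (finFin k) (fin× (finFin k) (finMaybe (finMaybe fX))))
                     (fin⊎ fX (finite (tt ∷ []) λ _ → here refl))

  module _ {k : ℕ} (δ : Fin k → Fin k → Y (Maybe P)) (F : Fin k → Bool) (A : Fin k → Fin k → NBA 𝓑) where

    P-init : Fin k → PState k → Bool
    P-init i (inj₁ (p , _)) = does (p Finₚ.≟ i)
    P-init i (inj₂ _)       = false

    P-inner : PState k → NBA 𝓑
    P-inner (inj₁ (p , q , _)) = A p q
    P-inner (inj₂ _)           = test λ _ → topY

    leaving : Fin k → Y P
    leaving q = erase (EY k q δ F)

    P-edge : PState k → PState k → Y P
    P-edge (inj₁ (p , q , nothing))       (inj₁ (p′ , _))  = ⌜ does (q Finₚ.≟ p′) ⌝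
    P-edge (inj₁ (p , q , just nothing))  (inj₂ (inj₂ _))  = EX (andY (leaving q) inactive)
    P-edge (inj₁ (p , q , just (just x))) (inj₂ (inj₁ x′)) =
      andY ⌜ does (eqF fX x x′) ⌝ (EX (andY (leaving q) (EF (propY (var x)))))
    P-edge (inj₂ (inj₁ x))                (inj₂ (inj₂ _))  = negY (EF (propY (var x)))
    P-edge (inj₂ (inj₂ _))                (inj₂ (inj₂ _))  = topY
    P-edge _                              _                = ffᵍ

    P-final : PState k → Bool
    P-final (inj₁ (p , _ , nothing)) = F p
    P-final (inj₁ (_ , _ , just _))  = false
    P-final (inj₂ (inj₁ _))          = false
    P-final (inj₂ (inj₂ _))          = true

  alongNBA : ∀ k → Fin k → (Fin k → Fin k → Y (Maybe P)) → (Fin k → Bool) → (Fin k → Fin k → NBA 𝓑) → NBA 𝓑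
  alongNBA k i δ F A = Nested.nested {𝓖 = YTests P} {Ev = Bits} (finPState k)
    (P-init δ F A i) (P-inner δ F A) (λ z z′ _ → P-edge δ F A z z′) (P-final δ F A)

  along : Y (Maybe P) → NBA 𝓑
  along topY             = test λ _ → topY
  along (propY nothing)  = test λ (b , _) → ⌜ b ⌝
  along (propY (just p)) = test λ _ → propY p
  along (negY φ)         = complement (along φ)
  along (andY φ ψ)       = boolean _∧_ (along φ) (along ψ)
  along (EY k i δ F)     = alongNBA k i δ F λ p q → along (δ p q)

  existsChain : Y (Maybe P) → Y P
  existsChain ψ = existsPath (proj₁ (along ψ) , project {𝓖 = YTests P} {Ev = ⊤} finBool (proj₂ (along ψ)))

  _⁺_ : ∀ {n} {K : KTree n} → (P → List (KTree.D K) → Set) → (List (KTree.D K) → Set) →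
        Maybe P → List (KTree.D K) → Set
  (V ⁺ U) nothing  = U
  (V ⁺ U) (just p) = V p

  module Correct (em : EM) {n : ℕ} (K : KTree n) (V : P → List (KTree.D K) → Set)
    (chains : ∀ x → IsChain K (V (var x)))
    (copies : ∀ w d → KTree.T K (w ∷ʳ d) → (∀ x u → (w ∷ʳ d) ≼ u → ¬ V (var x) u) →
              Σ (KTree.D K) λ d′ → d ≢ d′ × KTree.T K (w ∷ʳ d′) ×
              (∀ χ → satY K V (w ∷ʳ d) χ → satY K V (w ∷ʳ d′) χ)) where
    open KTree K
    open ModelProps em (YModel K V)

    Active : List D → X → Set
    Active v x = satY K V v (EF (propY (var x)))

    inactive⟺ : ∀ v → satY K V v inactive ⟺ (∀ x → ¬ Active v x)
    inactive⟺ v = ⊨andF v fX _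

    active : ∀ {v} x {u} → T v → v ≼ u → V (var x) u → Active v x
    active x Tv le Vu = proj₂ (EF⟺ em K V _ Tv) (_ , le , proj₁ (chains x) _ Vu , Vu)

    active→ : ∀ {v} x → T v → Active v x → Σ (List D) λ u → v ≼ u × V (var x) u
    active→ x Tv a = let (u , le , _ , Vu) = proj₁ (EF⟺ em K V _ Tv) a in u , le , Vu

    module _ (π : Path K []) (b : ℕ → Bool) where
      private module π = Path π

      U : List D → Set
      U u = Σ ℕ λ l → b l ≡ true × u ≡ π.π l

      V⁺ : Maybe P → List D → Set
      V⁺ = _⁺_ {K = K} V U

      pos : ℕ → ℕ → Bits × List D
      pos i m = (b (m + i) , tt) , π.π (m + i)

      M : Model 𝓑
      M = EnvModel Bits (YModel K V)

      -- All elements of `U` lie on the path. One below the child `d` would be comparable with the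
      -- next node of the path, and `branch` would put `d` on the path; so `U` is empty there, as
      -- `erase` assumes.
      off-path : ∀ j d χ → T (π.π j ∷ʳ d) → π.π j ∷ʳ d ≢ π.π (suc j) →
                 satY K V⁺ (π.π j ∷ʳ d) χ ⟺ satY K V (π.π j ∷ʳ d) (erase χ)
      off-path j d χ Td off = local K (π.π j ∷ʳ d) Td agree χ ⟫ ⟺-sym (sub⟺ K V _ χ (π.π j ∷ʳ d))
        where
        agree : ∀ u → (π.π j ∷ʳ d) ≼ u → ∀ p → V⁺ p u ⟺ _
        agree u le (just p) = ⟺-refl
        agree u le nothing = (λ (l , _ , eq) → ⊥-elim (off (sym (trans (proj₂ (π.step j)) (cong (π.π j ∷ʳ_)
            (branch K (π.π j) (≼-refl K _) le (subst₂ (λ x y → (x ≼ y) ⊎ (y ≼ x)) (proj₂ (π.step j)) (sym eq)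
              (path-linear K π (suc j) l))))))))
          , λ f → ⊥-elim (f tt)

      Sibling : ℕ → Y (Maybe P) → Set
      Sibling j χ = Σ D λ d → T (π.π j ∷ʳ d) × π.π j ∷ʳ d ≢ π.π (suc j) × satY K V⁺ (π.π j ∷ʳ d) χ

      sibling⟺ : ∀ j χ → Sibling j χ ⟺
        (satY K V (π.π j) (EX (andY (erase χ) inactive)) ⊎
         Σ X λ x → satY K V (π.π j) (EX (andY (erase χ) (EF (propY (var x))))) × ¬ Active (π.π (suc j)) x)
      sibling⟺ j χ = to , from
        where
        to : Sibling j χ → _
        to (d , Td , off , h) = pick (em {Σ X (Active (π.π j ∷ʳ d))})
          where
          h′ = proj₁ (off-path j d χ Td off) h
          pick : Dec (Σ X (Active (π.π j ∷ʳ d))) →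
            (satY K V (π.π j) (EX (andY (erase χ) inactive)) ⊎
             Σ X λ x → satY K V (π.π j) (EX (andY (erase χ) (EF (propY (var x))))) × ¬ Active (π.π (suc j)) x)
          pick (no none) = inj₁ (proj₂ (EX⟺ em K V _ (π.inT j)) (d , Td , h′ ,
                             proj₂ (inactive⟺ _) λ x a → none (x , a)))
          pick (yes (x , a)) = inj₂ (x , proj₂ (EX⟺ em K V _ (π.inT j)) (d , Td , h′ , a) , λ a′ →
            let (u , le , Vu) = active→ x Td a
                (u′ , le′ , Vu′) = active→ x (π.inT (suc j)) a′
            in off (sym (trans (proj₂ (π.step j)) (cong (π.π j ∷ʳ_) (branch K (π.π j)
                 (subst (_≼ u′) (proj₂ (π.step j)) le′) le (proj₂ (chains x) u′ u Vu′ Vu))))))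
        from : _ → Sibling j χ
        from (inj₁ h) = pick (em {π.π j ∷ʳ d ≡ π.π (suc j)})
          where
          W = proj₁ (EX⟺ em K V (andY (erase χ) inactive) (π.inT j)) h
          d = proj₁ W
          Td = proj₁ (proj₂ W)
          pick : Dec (π.π j ∷ʳ d ≡ π.π (suc j)) → Sibling j χ
          pick (no off) = d , Td , off , proj₂ (off-path j d χ Td off) (proj₁ (proj₂ (proj₂ W)))
          -- The witness of `EX` is the next node of the path itself; being free of chain variables,
          -- it has a copy, which is off the path.
          pick (yes on) =
            let (d′ , d≢d′ , Td′ , copy) = copies (π.π j) d Td λ x u le Vu →
                  proj₁ (inactive⟺ _) (proj₂ (proj₂ (proj₂ W))) x (active x Td le Vu)
                off = λ eq → d≢d′ (Listₚ.∷ʳ-injectiveʳ (π.π j) (π.π j) (trans on (sym eq)))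
            in d′ , Td′ , off , proj₂ (off-path j d′ χ Td′ off) (copy (erase χ) (proj₁ (proj₂ (proj₂ W))))
        from (inj₂ (x , h , na)) =
          let (d , Td , h′ , a) = proj₁ (EX⟺ em K V (andY (erase χ) (EF (propY (var x)))) (π.inT j)) h
              off = λ eq → na (subst (λ v → Active v x) eq a)
          in d , Td , off , proj₂ (off-path j d χ Td off) h′

      module Step {k : ℕ} (δ : Fin k → Fin k → Y (Maybe P)) (F : Fin k → Bool) (A : Fin k → Fin k → NBA 𝓑)
        (ih : ∀ p q j → satY K V⁺ (π.π j) (δ p q) ⟺ Acc M (proj₂ (A p q)) (pos j)) where

        St : Set
        St = PState k

        edge : St → St → Y P
        edge = P-edge δ F A

        Goes : ℕ → Fin k → Set
        Goes s p = satY K V⁺ (π.π s) (EY k p δ F)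

        record Trace (s : ℕ) (z : ℕ → St) : Set where
          field
            edges  : ∀ l → satY K V (π.π (l + s)) (edge (z l) (z (suc l)))
            inners : ∀ l → Acc M (proj₂ (P-inner δ F A (z l))) (pos (l + s))
            finals : Unbounded (λ l → P-final δ F A (z l) ≡ true)

        TraceFrom : ℕ → St → Set
        TraceFrom s x = Σ (ℕ → St) λ z → z 0 ≡ x × Trace s z

        uncons : ∀ {s z} → Trace s z → Trace (suc s) (z ∘ suc)
        uncons {s} {z} t = record
          { edges  = λ l → subst (λ x → satY K V (π.π x) (edge (z (suc l)) (z (suc (suc l)))))
                             (sym (ℕₚ.+-suc l s)) (edges (suc l))
          ; inners = λ l → subst (λ x → Acc M (proj₂ (P-inner δ F A (z (suc l)))) (pos x))
                             (sym (ℕₚ.+-suc l s)) (inners (suc l))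
          ; finals = fin′ }
          where
          open Trace t
          fin′ : Unbounded (λ l → P-final δ F A (z (suc l)) ≡ true)
          fin′ l with finals (suc l)
          ... | suc j , s≤s le , Fj = j , le , Fj

        cons : ∀ {s} x {y} → satY K V (π.π s) (edge x y) → Acc M (proj₂ (P-inner δ F A x)) (pos s) →
               TraceFrom (suc s) y → TraceFrom s x
        cons {s} x e a (z , refl , t) = z′ , refl , record
          { edges = edges′ ; inners = inners′
          ; finals = λ l → let (j , le , Fj) = Trace.finals t l in suc j , ℕₚ.m≤n⇒m≤1+n le , Fj }
          where
          z′ : ℕ → St
          z′ zero    = x
          z′ (suc l) = z l
          edges′ : ∀ l → satY K V (π.π (l + s)) (edge (z′ l) (z′ (suc l)))
          edges′ zero    = e
          edges′ (suc l) = subst (λ x → satY K V (π.π x) (edge (z l) (z (suc l)))) (ℕₚ.+-suc l s) (Trace.edges t l)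
          inners′ : ∀ l → Acc M (proj₂ (P-inner δ F A (z′ l))) (pos (l + s))
          inners′ zero    = a
          inners′ (suc l) = subst (λ x → Acc M (proj₂ (P-inner δ F A (z l))) (pos x)) (ℕₚ.+-suc l s) (Trace.inners t l)

        idle : ∀ s → Acc M (proj₂ (test {𝓖 = 𝓑} λ _ → topY)) (pos s)
        idle s = proj₂ (test⟺ em M (λ _ → topY) (pos s)) tt

        sink : ∀ s → TraceFrom s (inj₂ (inj₂ tt))
        sink s = (λ _ → inj₂ (inj₂ tt)) , refl , record
          { edges = λ _ → tt ; inners = λ l → idle (l + s) ; finals = λ l → l , ℕₚ.≤-refl , refl }

        stay⟺ : ∀ s p q p′ q′ m → satY K V (π.π s) (edge (inj₁ (p , q , nothing)) (inj₁ (p′ , q′ , m))) ⟺ (q ≡ p′)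
        stay⟺ s p q p′ q′ m = ⊨⌜⌝ (π.π s) (does (q Finₚ.≟ p′)) ⟫ does⟺ (q Finₚ.≟ p′)

        exit : ∀ s p q → satY K V⁺ (π.π s) (δ p q) → Sibling s (EY k q δ F) →
               Σ Mode λ m → TraceFrom s (inj₁ (p , q , m))
        exit s p q g sib = [ (λ h → just nothing , cons _ h (proj₁ (ih p q s) g) (sink (suc s)))
          , (λ (x , h , na) → just (just x) ,
               cons _ (proj₂ (⊨⌜⌝ (π.π s) _) (proj₂ (does⟺ (eqF fX x x)) refl) , h) (proj₁ (ih p q s) g)
                 (cons {suc s} (inj₂ (inj₁ x)) na (idle (suc s)) (sink (suc (suc s))))) ]′
          (proj₁ (sibling⟺ s (EY k q δ F)) sib)

        -- Induction on a position `m` at which `π′` has left the path. As long as the next nodes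
        -- agree, the trace stays in mode `nothing`; at the first disagreement the rest of `π′`
        -- starts in a sibling, and `exit` condenses it into one test.
        leave : ∀ m s (π′ : Path K (π.π s)) (q : ℕ → Fin k) →
                (∀ l → satY K V⁺ (Path.π π′ l) (δ (q l) (q (suc l)))) → Unbounded (λ l → F (q l) ≡ true) →
                Path.π π′ m ≢ π.π (m + s) → Σ (Fin k × Mode) λ (q′ , m) → TraceFrom s (inj₁ (q 0 , q′ , m))
        leave zero    s π′ q qe qF ne = ⊥-elim (ne (Path.start π′))
        leave (suc m) s π′ q qe qF ne = decide (em {Path.π π′ 1 ≡ π.π (suc s)})
          where
          g : satY K V⁺ (π.π s) (δ (q 0) (q 1))
          g = subst (λ u → satY K V⁺ u (δ (q 0) (q 1))) (Path.start π′) (qe 0)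
          eq₁ : Path.π π′ 1 ≡ π.π s ∷ʳ proj₁ (Path.step π′ 0)
          eq₁ = trans (proj₂ (Path.step π′ 0)) (cong (_∷ʳ proj₁ (Path.step π′ 0)) (Path.start π′))
          qF′ : Unbounded (λ l → F (q (suc l)) ≡ true)
          qF′ l with qF (suc l)
          ... | suc j , s≤s le , Fj = j , le , Fj
          tail : ∀ {w} → Path.π π′ 1 ≡ w → Path K w
          tail eq = record { π = λ l → Path.π π′ (suc l) ; start = eq ; inT = λ l → Path.inT π′ (suc l)
                           ; step = λ l → Path.step π′ (suc l) }
          decide : Dec (Path.π π′ 1 ≡ π.π (suc s)) → Σ (Fin k × Mode) λ (q′ , m) → TraceFrom s (inj₁ (q 0 , q′ , m))
          decide (yes eq) =
            let ((q″ , m″) , t) = leave m (suc s) (tail eq) (q ∘ suc) (λ l → qe (suc l)) qF′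
                  (λ e → ne (trans e (cong π.π (ℕₚ.+-suc m s))))
            in (q 1 , nothing) , cons _ (proj₂ (stay⟺ s (q 0) (q 1) (q 1) q″ m″) refl) (proj₁ (ih _ _ s) g) t
          decide (no off) =
            let (m , t) = exit s (q 0) (q 1) g (proj₁ (Path.step π′ 0) , subst T eq₁ (Path.inT π′ 1) ,
                  (λ e → off (trans eq₁ e)) , tail eq₁ , q ∘ suc , refl , (λ l → qe (suc l)) , qF′)
            in (q 1 , m) , t

        goes→ : ∀ s p → Goes s p → Σ (Fin k × Mode) λ (q′ , m) → TraceFrom s (inj₁ (p , q′ , m))
        goes→ s p (π′ , q , refl , qe , qF) = decide (em {∀ l → Path.π π′ l ≡ π.π (l + s)})
          where
          decide : Dec (∀ l → Path.π π′ l ≡ π.π (l + s)) → Σ (Fin k × Mode) λ (q′ , m) → TraceFrom s (inj₁ (q 0 , q′ , m))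
          decide (yes same) = (q 1 , nothing) , (λ l → inj₁ (q l , q (suc l) , nothing)) , refl , record
            { edges = λ l → proj₂ (stay⟺ (l + s) (q l) (q (suc l)) _ (q (suc (suc l))) nothing) refl
            ; inners = λ l → proj₁ (ih (q l) (q (suc l)) (l + s))
                (subst (λ u → satY K V⁺ u (δ (q l) (q (suc l)))) (same l) (qe l))
            ; finals = qF }
          decide (no n) = let (m , ne) = ¬∀→∃¬ em n in leave m s π′ q qe qF ne

        Live : St → Set
        Live x = Σ (Fin k) λ p → Σ (Fin k) λ q → x ≡ inj₁ (p , q , nothing)

        -- The converse of `leave`, by induction on a position where the mode is no longer
        -- `nothing`: the path is assembled from its exit backwards, one use of `E-unfold` for each
        -- step.
        back : ∀ m s z → Trace s z → ¬ Live (z m) → ∀ p q m′ → z 0 ≡ inj₁ (p , q , m′) → Goes s p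
        back m s z t nl p q m′ eq = go m′ eq e
          where
          g : satY K V⁺ (π.π s) (δ p q)
          g = proj₂ (ih p q s) (subst (λ x → Acc M (proj₂ (P-inner δ F A x)) (pos s)) eq (Trace.inners t 0))
          e : satY K V (π.π s) (edge (inj₁ (p , q , m′)) (z 1))
          e = subst (λ x → satY K V (π.π s) (edge x (z 1))) eq (Trace.edges t 0)
          unfold : (Σ D λ d → T (π.π s ∷ʳ d) × satY K V⁺ (π.π s ∷ʳ d) (EY k q δ F)) → Goes s p
          unfold c = proj₂ (E-unfold K V⁺ p δ F (π.inT s)) (q , g , c)
          sib : Sibling s (EY k q δ F) → Goes s p
          sib (d , Td , _ , h) = unfold (d , Td , h)
          exit-in : ∀ y → satY K V (π.π s) (edge (inj₁ (p , q , just nothing)) y) → Goes s p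
          exit-in (inj₁ _)        h = ⊥-elim (⊨ff (π.π s) h)
          exit-in (inj₂ (inj₁ _)) h = ⊥-elim (⊨ff (π.π s) h)
          exit-in (inj₂ (inj₂ _)) h = sib (proj₂ (sibling⟺ s (EY k q δ F)) (inj₁ h))
          chk : ∀ x y → satY K V (π.π (suc s)) (edge (inj₂ (inj₁ x)) y) → ¬ Active (π.π (suc s)) x
          chk x (inj₁ _)        h = ⊥-elim (⊨ff (π.π (suc s)) h)
          chk x (inj₂ (inj₁ _)) h = ⊥-elim (⊨ff (π.π (suc s)) h)
          chk x (inj₂ (inj₂ _)) h = h
          exit-x : ∀ x y → z 1 ≡ y → satY K V (π.π s) (edge (inj₁ (p , q , just (just x))) y) → Goes s p
          exit-x x (inj₁ _)         _  h = ⊥-elim (⊨ff (π.π s) h)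
          exit-x x (inj₂ (inj₂ _))  _  h = ⊥-elim (⊨ff (π.π s) h)
          exit-x x (inj₂ (inj₁ x′)) e₁ (h , h′) = sib (proj₂ (sibling⟺ s (EY k q δ F)) (inj₂ (x , h′ ,
            subst (λ x → ¬ Active (π.π (suc s)) x) (sym (proj₁ (does⟺ (eqF fX x x′)) (proj₁ (⊨⌜⌝ (π.π s) _) h)))
              (chk x′ (z 2) (subst (λ y → satY K V (π.π (suc s)) (edge y (z 2))) e₁ (Trace.edges t 1))))))
          stay : ∀ m → ¬ Live (z m) → z 0 ≡ inj₁ (p , q , nothing) → ∀ y → z 1 ≡ y →
                 satY K V (π.π s) (edge (inj₁ (p , q , nothing)) y) → Goes s p
          stay m nl eq (inj₂ _) _ h = ⊥-elim (⊨ff (π.π s) h)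
          stay zero nl eq (inj₁ _) _ h = ⊥-elim (nl (p , q , eq))
          stay (suc m) nl eq (inj₁ (p′ , q′ , m″)) e₁ h =
            let q≡p′ = proj₁ (stay⟺ s p q p′ q′ m″) h in
            unfold (proj₁ (π.step s) , subst T (proj₂ (π.step s)) (π.inT (suc s)) ,
              subst₂ (λ u x → satY K V⁺ u (EY k x δ F)) (proj₂ (π.step s)) (sym q≡p′)
                (back m (suc s) (z ∘ suc) (uncons t) nl p′ q′ m″ e₁))
          go : ∀ m′ → z 0 ≡ inj₁ (p , q , m′) → satY K V (π.π s) (edge (inj₁ (p , q , m′)) (z 1)) → Goes s p
          go nothing         eq h = stay m nl eq (z 1) refl h
          go (just nothing)  eq h = exit-in (z 1) h
          go (just (just x)) eq h = exit-x x (z 1) refl h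

        goes← : ∀ s p → (Σ (ℕ → St) λ z → P-init δ F A p (z 0) ≡ true × Trace s z) → Goes s p
        goes← s p (z , ini , t) = decide (em {∀ l → Live (z l)})
          where
          start : ∀ x → P-init δ F A p x ≡ true → Σ (Fin k) λ q → Σ Mode λ m → x ≡ inj₁ (p , q , m)
          start (inj₁ (p′ , q , m)) h = q , m , cong (λ p → inj₁ (p , q , m)) (proj₁ (does⟺ (p′ Finₚ.≟ p)) h)
          z0 : Σ (Fin k) λ q → Σ Mode λ m → z 0 ≡ inj₁ (p , q , m)
          z0 = start (z 0) ini
          decide : Dec (∀ l → Live (z l)) → Goes s p
          decide (no n) = let (m , nl) = ¬∀→∃¬ em n in back m s z t nl p (proj₁ z0) (proj₁ (proj₂ z0)) (proj₂ (proj₂ z0))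
          decide (yes live) = drop-path K π s , q , inj-p (trans (sym (eq 0)) (proj₂ (proj₂ z0))) ,
            (λ l → subst (λ x → satY K V⁺ (π.π (l + s)) (δ (q l) x)) (follow l)
              (proj₂ (ih (q l) (q′ l) (l + s)) (subst (λ x → Acc M (proj₂ (P-inner δ F A x)) (pos (l + s)))
                (eq l) (Trace.inners t l)))) ,
            λ l → let (j , le , Fj) = Trace.finals t l in j , le , trans (sym (cong (P-final δ F A) (eq j))) Fj
            where
            q q′ : ℕ → Fin k
            q l  = proj₁ (live l)
            q′ l = proj₁ (proj₂ (live l))
            eq : ∀ l → z l ≡ inj₁ (q l , q′ l , nothing)
            eq l = proj₂ (proj₂ (live l))
            inj-p : ∀ {p p′ q q′ : Fin k} {m m′ : Mode} → _≡_ {A = St} (inj₁ (p , q , m)) (inj₁ (p′ , q′ , m′)) → p ≡ p′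
            inj-p refl = refl
            follow : ∀ l → q′ l ≡ q (suc l)
            follow l = proj₁ (stay⟺ (l + s) (q l) (q′ l) (q (suc l)) (q′ (suc l)) nothing)
              (subst₂ (λ x y → satY K V (π.π (l + s)) (edge x y)) (eq l) (eq (suc l)) (Trace.edges t l))

      -- The induction concerns nodes of the distinguished path only, for which the bits decide
      -- membership in the new chain; elsewhere the chain is empty and `off-path` takes over.
      along⟺ : ∀ ψ s → satY K V⁺ (π.π s) ψ ⟺ Acc M (proj₂ (along ψ)) (pos s)
      along⟺ topY s = ⟺-sym (test⟺ em M (λ _ → topY) (pos s))
      along⟺ (propY nothing) s = U⟺ ⟫ ⟺-sym (⊨⌜⌝ (π.π s) (b s)) ⟫ ⟺-sym (test⟺ em M (λ (b , _) → ⌜ b ⌝) (pos s))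
        where
        U⟺ : U (π.π s) ⟺ b s ≡ true
        U⟺ = (λ (l , bl , eq) → trans (cong b (path-injective K π eq)) bl) , λ bs → s , bs , refl
      along⟺ (propY (just p)) s = ⟺-sym (test⟺ em M (λ _ → propY p) (pos s))
      along⟺ (negY φ) s = ¬-⟺ (along⟺ φ s) ⟫ ⟺-sym (complement⟺ em M (along φ) (pos s))
      along⟺ (andY φ ψ) s = ×-⟺ (along⟺ φ s) (along⟺ ψ s) ⟫ ⟺-sym (conjunction⟺ em M (along φ) (along ψ) (pos s))
      along⟺ (EY k i δ F) s = (to , from) ⟫ ⟺-sym nest
        where
        A : Fin k → Fin k → NBA 𝓑
        A p q = along (δ p q)
        open Step δ F A (λ p q j → along⟺ (δ p q) j)
        Cond : Set
        Cond = Σ (ℕ → St) λ z → P-init δ F A i (z 0) ≡ true × (∀ l → satY K V (π.π (l + s)) (edge (z l) (z (suc l)))) ×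
          (∀ l → Acc M (proj₂ (P-inner δ F A (z l))) (λ m → pos s (m + l))) × Unbounded (λ l → P-final δ F A (z l) ≡ true)
        nest : Acc M (proj₂ (alongNBA k i δ F A)) (pos s) ⟺ Cond
        nest = Nested.Correct.nested⟺ {𝓖 = YTests P} {Ev = Bits} (finPState k) (P-init δ F A i) (P-inner δ F A)
          (λ z z′ _ → edge z z′) (P-final δ F A) em (YModel K V) (pos s)
        shift : ∀ (B : NBA 𝓑) l → Acc M (proj₂ B) (λ m → pos s (m + l)) ⟺ Acc M (proj₂ B) (pos (l + s))
        shift B l = Acc-cong M (proj₂ B) λ m → cong (λ x → (b x , tt) , π.π x) (ℕₚ.+-assoc m l s)
        to : Goes s i → Cond
        to g = let ((q , m) , z , eq , t) = goes→ s i g in z ,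
          trans (cong (P-init δ F A i) eq) (proj₂ (does⟺ (i Finₚ.≟ i)) refl) , Trace.edges t ,
          (λ l → proj₂ (shift (P-inner δ F A (z l)) l) (Trace.inners t l)) , Trace.finals t
        from : Cond → Goes s i
        from (z , ini , e , a , f) = goes← s i (z , ini , record
          { edges = e ; inners = λ l → proj₁ (shift (P-inner δ F A (z l)) l) (a l) ; finals = f })

    -- A chain is exactly a subset of the nodes of some path from the root, so quantifying a chain
    -- amounts to quantifying a path together with a bit for each of its positions.
    existsChain⟺ : T [] → ∀ ψ → satY K V [] (existsChain ψ) ⟺
      Σ (List D → Set) λ U → IsChain K U × satY K (_⁺_ {K = K} V U) [] ψ
    existsChain⟺ T[] ψ = existsPath⟺ em K V _ [] ⟫
      (Σ-⟺ λ π → project⟺ {𝓖 = YTests P} {Ev = ⊤} finBool em (YModel K V) (proj₂ (along ψ)) (λ l → tt , Path.π π l) ⟫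
        Σ-⟺ λ b → Acc-cong (EnvModel Bits (YModel K V)) (proj₂ (along ψ))
                    (λ l → cong (λ x → (b x , tt) , Path.π π x) (sym (ℕₚ.+-identityʳ l))) ⟫
                  ⟺-sym (along⟺ π b ψ 0)) ⟫ (to , from)
      where
      to : (Σ (Path K []) λ π → Σ (ℕ → Bool) λ b → satY K (V⁺ π b) (Path.π π 0) ψ) →
           Σ (List D → Set) λ U → IsChain K U × satY K (_⁺_ {K = K} V U) [] ψ
      to (π , b , h) = U π b , ((λ { _ (l , _ , refl) → Path.inT π l }) ,
          λ { _ _ (l , _ , refl) (m , _ , refl) → path-linear K π l m }) ,
        subst (λ u → satY K (V⁺ π b) u ψ) (Path.start π) h
      from : (Σ (List D → Set) λ U → IsChain K U × satY K (_⁺_ {K = K} V U) [] ψ) →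
             Σ (Path K []) λ π → Σ (ℕ → Bool) λ b → satY K (V⁺ π b) (Path.π π 0) ψ
      from (U′ , ch , h) = π , b , subst (λ u → satY K (V⁺ π b) u ψ) (sym (Path.start π))
          (proj₁ (local K [] T[] agree ψ) h)
        where
        π : Path K []
        π = proj₁ (chain-path K em U′ ch T[])
        b : ℕ → Bool
        b l = truth em (U′ (Path.π π l))
        agree : ∀ u → [] ≼ u → ∀ p → (_⁺_ {K = K} V U′) p u ⟺ V⁺ π b p u
        agree u le (just p) = ⟺-refl
        agree u le nothing =
          (λ Uu → let (l , eq) = proj₂ (chain-path K em U′ ch T[]) u Uu le in
             l , proj₂ (truth⟺ em _) (subst U′ (sym eq) Uu) , sym eq) ,
          λ { (l , bl , refl) → proj₁ (truth⟺ em _) bl }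

-- The ω-expansion of a tree, and MCL over it

expand : ∀ {n} → KTree n → KTree n
expand K = record
  { D = D × ℕ ; T = λ u → T (map proj₁ u) ; root = root
  ; prefix = λ u v t → prefix (map proj₁ u) (map proj₁ v) (subst T (Listₚ.map-++ proj₁ u v) t)
  ; nonblock = λ w t → let (d , Td) = nonblock (map proj₁ w) t in
      (d , 0) , subst T (sym (Listₚ.map-++ proj₁ w _)) Td
  ; Lab = λ u → Lab (map proj₁ u) }
  where open KTree K

module Expand {n : ℕ} (K : KTree n) where
  open KTree K
  Kω : KTree n
  Kω = expand K

  flat : List (D × ℕ) → List D
  flat = map proj₁

  flat-∷ʳ : ∀ u d → flat (u ∷ʳ d) ≡ flat u ∷ʳ proj₁ d
  flat-∷ʳ u d = Listₚ.map-++ proj₁ u (d ∷ [])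

  expand-bisim : Bisim K Kω
  expand-bisim = record
    { R = λ w u → w ≡ flat u × T w ; inT = λ { _ _ (refl , t) → t , t } ; root = refl , root
    ; lab = λ { _ _ (refl , _) → refl }
    ; forth = λ { _ u (refl , _) d Td → (d , 0) , subst T (sym (flat-∷ʳ u (d , 0))) Td , sym (flat-∷ʳ u (d , 0)) , Td }
    ; back = λ { _ u (refl , _) d Td → proj₁ d , subst T (flat-∷ʳ u d) Td , sym (flat-∷ʳ u d) , subst T (flat-∷ʳ u d) Td } }

fromBisim : ∀ {n} {K K′ : KTree n} (B : Bisim K K′) → Bisimulation K K′ (Val K) (Val K′) (Bisim.R B)
fromBisim B = record
  { inT = inT _ _
  ; props = λ r p → (λ h → subst (p ∈ˢ_) (lab _ _ r) h) , (λ h → subst (p ∈ˢ_) (sym (lab _ _ r)) h)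
  ; forth = λ r d Td → let (d′ , _ , r′) = forth _ _ r d Td in d′ , r′
  ; back = λ r d Td → let (d′ , _ , r′) = back _ _ r d Td in d′ , r′ }
  where open Bisim B

flip-Bisim : ∀ {n} {K K′ : KTree n} → Bisim K K′ → Bisim K′ K
flip-Bisim B = record
  { R = λ w′ w → R w w′ ; inT = λ w′ w r → proj₂ (inT w w′ r) , proj₁ (inT w w′ r) ; root = root
  ; lab = λ w′ w r → sym (lab w w′ r) ; forth = λ w′ w r → back w w′ r ; back = λ w′ w r → forth w w′ r }
  where open Bisim B

Vars : ℕ → ℕ → Set
Vars m k = Fin m ⊎ Fin k

finVars : ∀ m k → Finite (Vars m k)
finVars m k = fin⊎ (finFin m) (finFin k)

module _ {n : ℕ} where

  Props : ℕ → ℕ → Set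
  Props m k = Fin n ⊎ Vars m k

  fo : ∀ {m k} → Fin m → Y (Props m k)
  fo x = propY (inj₂ (inj₁ x))

  new₁ : ∀ {m k} → Props (suc m) k → Y (Maybe (Props m k))
  new₁ (inj₁ p)              = propY (just (inj₁ p))
  new₁ (inj₂ (inj₁ zero))    = propY nothing
  new₁ (inj₂ (inj₁ (suc x))) = propY (just (inj₂ (inj₁ x)))
  new₁ (inj₂ (inj₂ X))       = propY (just (inj₂ (inj₂ X)))

  newC : ∀ {m k} → Props m (suc k) → Y (Maybe (Props m k))
  newC (inj₁ p)              = propY (just (inj₁ p))
  newC (inj₂ (inj₁ x))       = propY (just (inj₂ (inj₁ x)))
  newC (inj₂ (inj₂ zero))    = propY nothing
  newC (inj₂ (inj₂ (suc X))) = propY (just (inj₂ (inj₂ X)))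

  -- No element may have another one strictly below it; as the elements of a chain are comparable,
  -- this leaves exactly one. First-order quantifiers thus become chain quantifiers.
  singleton : ∀ {P : Set} → Y (Maybe P)
  singleton = andY (EF (propY nothing)) (negY (EF (andY (propY nothing) (EX (EF (propY nothing))))))

  -- Meant to be evaluated at the root. Variables are propositions, those of first order true at a
  -- single node, to which `EF` leads.
  fromMCL : ∀ {m k} → MCL n m k → Y (Props m k)
  fromMCL (prop p x)  = EF (andY (fo x) (propY (inj₁ p)))
  fromMCL (leq x y)   = EF (andY (fo x) (EF (fo y)))
  fromMCL (mem x X)   = EF (andY (fo x) (propY (inj₂ (inj₂ X))))
  fromMCL (neg φ)     = negY (fromMCL φ)
  fromMCL (and φ ψ)   = andY (fromMCL φ) (fromMCL ψ)
  fromMCL {m} {k} (ex1 φ) = Projection.existsChain (Props m k) (Vars m k) (finVars m k) inj₂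
                              (andY singleton (sub new₁ (fromMCL φ)))
  fromMCL {m} {k} (exC φ) = Projection.existsChain (Props m k) (Vars m k) (finVars m k) inj₂
                              (sub newC (fromMCL φ))

  module FromMCL (em : EM) (K₀ : KTree n) where
    open Expand K₀ using (flat; flat-∷ʳ)
    K : KTree n
    K = expand K₀
    open KTree K

    val : ∀ {m k} → (Fin m → List D) → (Fin k → List D → Set) → Props m k → List D → Set
    val ρ σ (inj₁ p)        w = p ∈ˢ Lab w
    val ρ σ (inj₂ (inj₁ x)) w = w ≡ ρ x
    val ρ σ (inj₂ (inj₂ X)) w = σ X w

    module _ {m k : ℕ} (ρ : Fin m → List D) (σ : Fin k → List D → Set)
             (Tρ : ∀ x → T (ρ x)) (chσ : ∀ X → IsChain K (σ X)) where

      V : Props m k → List D → Set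
      V = val ρ σ

      chains : ∀ x → IsChain K (V (inj₂ x))
      chains (inj₁ x) = (λ { _ refl → Tρ x }) , λ { _ _ refl refl → inj₁ (≼-refl K _) }
      chains (inj₂ X) = chσ X

      -- By `branch`, each variable occurs below at most one of the copies `(d , j)` of a child. An
      -- index above `i` and above these finitely many exceptions gives a second copy without
      -- variables, and nodes below the two copies with the same projection to the original tree are
      -- bisimilar.
      copies : ∀ w d → T (w ∷ʳ d) → (∀ x u → (w ∷ʳ d) ≼ u → ¬ V (inj₂ x) u) →
               Σ D λ d′ → d ≢ d′ × T (w ∷ʳ d′) × (∀ χ → satY K V (w ∷ʳ d) χ → satY K V (w ∷ʳ d′) χ)
      copies w (d , i) Td none = (d , i′) , (λ eq → ℕₚ.<⇒≢ i<i′ (cong proj₂ eq)) , Td′ ,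
          λ χ h → proj₁ (bisim-invariant B χ (trans (flat-∷ʳ w (d , i)) (sym (flat-∷ʳ w (d , i′))) ,
            Td , ≼-refl K _ , ≼-refl K _)) h
        where
        Hit : Vars m k → ℕ → Set
        Hit x j = Σ (List D) λ u → (w ∷ʳ (d , j)) ≼ u × V (inj₂ x) u
        bound : ∀ x → Σ ℕ λ N → ∀ j → N ≤ j → ¬ Hit x j
        bound x with em {Σ ℕ (Hit x)}
        ... | no n = 0 , λ j _ h → n (j , h)
        ... | yes (j₀ , u₀ , le₀ , V₀) = suc j₀ , λ j lt (u , le , Vu) → ℕₚ.<⇒≢ lt
                (cong proj₂ (branch K w le₀ le (proj₂ (chains x) u₀ u V₀ Vu)))
        fV : Finite (Vars m k)
        fV = finVars m k
        N : ℕ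
        N = sup λ c → proj₁ (bound (dec fV c))
        i′ : ℕ
        i′ = suc i ⊔ⁿ N
        i<i′ : i < i′
        i<i′ = ℕₚ.m≤m⊔n (suc i) N
        none′ : ∀ x u → (w ∷ʳ (d , i′)) ≼ u → ¬ V (inj₂ x) u
        none′ x u le Vu = proj₂ (bound x) i′ (ℕₚ.≤-trans
          (subst (λ y → proj₁ (bound y) ≤ N) (dec-enc fV x) (≤sup (λ c → proj₁ (bound (dec fV c))) (enc fV x)))
          (ℕₚ.m≤n⊔m (suc i) N)) (u , le , Vu)
        Td′ : T (w ∷ʳ (d , i′))
        Td′ = subst (KTree.T K₀) (trans (flat-∷ʳ w (d , i)) (sym (flat-∷ʳ w (d , i′)))) Td
        R : List D → List D → Set
        R u u′ = flat u ≡ flat u′ × T u × (w ∷ʳ (d , i)) ≼ u × (w ∷ʳ (d , i′)) ≼ u′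
        B : Bisimulation K K V V R
        B = record
          { inT = λ (eq , Tu , _) → Tu , subst (KTree.T K₀) eq Tu
          ; props = λ { (eq , _) (inj₁ p) → ≡→⟺ (cong (λ v → p ∈ˢ KTree.Lab K₀ v) eq)
                      ; {u} {u′} (_ , _ , le , le′) (inj₂ x) →
                          (λ h → ⊥-elim (none x u le h)) , λ h → ⊥-elim (none′ x u′ le′ h) }
          ; forth = λ {u} {u′} (eq , _ , le , le′) e Te → e , flat-eq u u′ e eq , Te ,
              ≼-trans K le (≼-child K u e) , ≼-trans K le′ (≼-child K u′ e)
          ; back = λ {u} {u′} (eq , _ , le , le′) e Te → e , flat-eq u u′ e eq ,
              subst (KTree.T K₀) (sym (flat-eq u u′ e eq)) Te ,
              ≼-trans K le (≼-child K u e) , ≼-trans K le′ (≼-child K u′ e) }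
          where
          flat-eq : ∀ u u′ e → flat u ≡ flat u′ → flat (u ∷ʳ e) ≡ flat (u′ ∷ʳ e)
          flat-eq u u′ e eq = trans (flat-∷ʳ u e) (trans (cong (_∷ʳ proj₁ e) eq) (sym (flat-∷ʳ u′ e)))

      open Projection (Props m k) (Vars m k) (finVars m k) inj₂ using (_⁺_; module Correct)
      open Correct em K V chains copies public using (existsChain⟺)

      V+ : (List D → Set) → Maybe (Props m k) → List D → Set
      V+ = _⁺_ {K = K} V

      exists-fo : ∀ x φ → satY K V [] (EF (andY (fo x) φ)) ⟺ satY K V (ρ x) φ
      exists-fo x φ = EF⟺ em K V _ root ⟫
        ((λ { (_ , _ , _ , refl , h) → h }) , λ h → ρ x , (ρ x , refl) , Tρ x , refl , h)

      singleton⟺ : ∀ U → IsChain K U → satY K (V+ U) [] singleton ⟺ Σ (List D) λ w → T w × (∀ u → U u ⟺ u ≡ w)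
      singleton⟺ U (U⊆T , cmp) = to , from
        where
        to : satY K (V+ U) [] singleton → Σ (List D) λ w → T w × (∀ u → U u ⟺ u ≡ w)
        to (h , nh) = let (w , _ , Tw , Uw) = proj₁ (EF⟺ em K (V+ U) _ root) h in
            w , Tw , λ u → (λ Uu → [ (λ le → sym (same w u Uw Uu le)) , same u w Uu Uw ]′ (cmp w u Uw Uu)) ,
                           λ { refl → Uw }
          where
          same : ∀ u v → U u → U v → u ≼ v → u ≡ v
          same u v Uu Uv ([] , eq) = sym (trans eq (Listₚ.++-identityʳ u))
          same u v Uu Uv (d ∷ s , eq) = ⊥-elim (nh (proj₂ (EF⟺ em K (V+ U) _ root)
              (u , (u , refl) , U⊆T u Uu , Uu , proj₂ (EX⟺ em K (V+ U) _ (U⊆T u Uu))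
                (d , Td , proj₂ (EF⟺ em K (V+ U) _ Td) (v , le , U⊆T v Uv , Uv)))))
            where
            le : (u ∷ʳ d) ≼ v
            le = s , trans eq (sym (∷ʳ-++ K u d s))
            Td : T (u ∷ʳ d)
            Td = T-prefix K le (U⊆T v Uv)
        from : (Σ (List D) λ w → T w × (∀ u → U u ⟺ u ≡ w)) → satY K (V+ U) [] singleton
        from (w , Tw , eq) = proj₂ (EF⟺ em K (V+ U) _ root) (w , (w , refl) , Tw , proj₂ (eq w) refl) , λ h →
          let (u , _ , Tu , Uu , h′) = proj₁ (EF⟺ em K (V+ U) _ root) h
              (d , Td , h″) = proj₁ (EX⟺ em K (V+ U) _ Tu) h′
              (v , le , _ , Uv) = proj₁ (EF⟺ em K (V+ U) _ Td) h″
              le′ = subst₂ (λ x y → (x ∷ʳ d) ≼ y) (proj₁ (eq u) Uu) (proj₁ (eq v) Uv) le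
          in ℕₚ.<⇒≱ (ℕₚ.≤-reflexive (trans (ℕₚ.+-comm 1 (length w)) (sym (Listₚ.length-++ w)))) (≼-length K le′)

    fromMCL⟺ : ∀ {m k} (φ : MCL n m k) ρ σ → (∀ x → T (ρ x)) → (∀ X → IsChain K (σ X)) →
               MCLSem.sat K ρ σ φ ⟺ satY K (val ρ σ) [] (fromMCL φ)
    fromMCL⟺ (prop p x) ρ σ Tρ ch = (lower , lift) ⟫ ⟺-sym (exists-fo ρ σ Tρ ch x _)
    fromMCL⟺ (leq x y)  ρ σ Tρ ch = (lower , lift) ⟫
      ((λ le → proj₂ (EF⟺ em K (val ρ σ) _ (Tρ x)) (ρ y , le , Tρ y , refl)) ,
       λ h → reach (proj₁ (EF⟺ em K (val ρ σ) _ (Tρ x)) h)) ⟫ ⟺-sym (exists-fo ρ σ Tρ ch x _)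
      where
      reach : (Σ (List D) λ u → ρ x ≼ u × T u × u ≡ ρ y) → ρ x ≼ ρ y
      reach (_ , le , _ , refl) = le
    fromMCL⟺ (mem x X)  ρ σ Tρ ch = (lower , lift) ⟫ ⟺-sym (exists-fo ρ σ Tρ ch x _)
    fromMCL⟺ (neg φ)    ρ σ Tρ ch = ¬-⟺ (fromMCL⟺ φ ρ σ Tρ ch)
    fromMCL⟺ (and φ ψ)  ρ σ Tρ ch = ×-⟺ (fromMCL⟺ φ ρ σ Tρ ch) (fromMCL⟺ ψ ρ σ Tρ ch)
    fromMCL⟺ {m} {k} (ex1 φ)    ρ σ Tρ ch = (to , from) ⟫ ⟺-sym (existsChain⟺ ρ σ Tρ ch root (andY singleton (sub new₁ (fromMCL φ))))
      where
      Goal : Set₁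
      Goal = Σ (List D → Set) λ U → IsChain K U × satY K (V+ ρ σ Tρ ch U) [] (andY singleton (sub new₁ (fromMCL φ)))
      Tρ′ : ∀ {w} → T w → ∀ x → T ((w ∷ᶠ ρ) x)
      Tρ′ Tw zero    = Tw
      Tρ′ Tw (suc x) = Tρ x
      body⟺ : ∀ U w → (∀ u → U u ⟺ u ≡ w) → satY K (val (w ∷ᶠ ρ) σ) [] (fromMCL φ) ⟺
              satY K (V+ ρ σ Tρ ch U) [] (sub new₁ (fromMCL φ))
      body⟺ U w eq = local K [] root agree (fromMCL φ) ⟫ ⟺-sym (sub⟺ K _ new₁ (fromMCL φ) [])
        where
        agree : ∀ u → [] ≼ u → ∀ p → val (w ∷ᶠ ρ) σ p u ⟺ satY K (V+ ρ σ Tρ ch U) u (new₁ p)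
        agree u _ (inj₁ p)              = ⟺-refl
        agree u _ (inj₂ (inj₁ zero))    = ⟺-sym (eq u)
        agree u _ (inj₂ (inj₁ (suc x))) = ⟺-refl
        agree u _ (inj₂ (inj₂ X))       = ⟺-refl
      to : MCLSem.sat K ρ σ (ex1 φ) → Goal
      to (w , lift Tw , h) = (_≡ w) , chw , proj₂ (singleton⟺ ρ σ Tρ ch (_≡ w) chw) (w , Tw , λ _ → ⟺-refl) ,
          proj₁ (body⟺ (_≡ w) w λ _ → ⟺-refl) (proj₁ (fromMCL⟺ φ (w ∷ᶠ ρ) σ (Tρ′ Tw) ch) h)
        where
        chw : IsChain K (_≡ w)
        chw = (λ { _ refl → Tw }) , λ { _ _ refl refl → inj₁ (≼-refl K _) }
      from : Goal → MCLSem.sat K ρ σ (ex1 φ)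
      from (U , chU , hs , h) = let (w , Tw , eq) = proj₁ (singleton⟺ ρ σ Tρ ch U chU) hs in
        w , lift Tw , proj₂ (fromMCL⟺ φ (w ∷ᶠ ρ) σ (Tρ′ Tw) ch) (proj₂ (body⟺ U w eq) h)
    fromMCL⟺ {m} {k} (exC φ)    ρ σ Tρ ch = Σ-⟺ (λ U → (to U , from U)) ⟫ ⟺-sym (existsChain⟺ ρ σ Tρ ch root (sub newC (fromMCL φ)))
      where
      ch′ : ∀ {U} → IsChain K U → ∀ X → IsChain K ((U ∷ᶠ σ) X)
      ch′ chU zero    = chU
      ch′ chU (suc X) = ch X
      body⟺ : ∀ U → satY K (val ρ (U ∷ᶠ σ)) [] (fromMCL φ) ⟺ satY K (V+ ρ σ Tρ ch U) [] (sub newC (fromMCL φ))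
      body⟺ U = local K [] root agree (fromMCL φ) ⟫ ⟺-sym (sub⟺ K _ newC (fromMCL φ) [])
        where
        agree : ∀ u → [] ≼ u → ∀ p → val ρ (U ∷ᶠ σ) p u ⟺ satY K (V+ ρ σ Tρ ch U) u (newC p)
        agree u _ (inj₁ p)              = ⟺-refl
        agree u _ (inj₂ (inj₁ x))       = ⟺-refl
        agree u _ (inj₂ (inj₂ zero))    = ⟺-refl
        agree u _ (inj₂ (inj₂ (suc X))) = ⟺-refl
      to : ∀ U → Lift (lsuc 0ℓ) (IsChain K U) × MCLSem.sat K ρ (U ∷ᶠ σ) φ →
           IsChain K U × satY K (V+ ρ σ Tρ ch U) [] (sub newC (fromMCL φ))
      to U (lift chU , h) = chU , proj₁ (body⟺ U) (proj₁ (fromMCL⟺ φ ρ (U ∷ᶠ σ) Tρ (ch′ chU)) h)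
      from : ∀ U → IsChain K U × satY K (V+ ρ σ Tρ ch U) [] (sub newC (fromMCL φ)) →
             Lift (lsuc 0ℓ) (IsChain K U) × MCLSem.sat K ρ (U ∷ᶠ σ) φ
      from U (chU , h) = lift chU , proj₂ (fromMCL⟺ φ ρ (U ∷ᶠ σ) Tρ (ch′ chU)) (proj₂ (body⟺ U) h)

  closeProps : Props 0 0 → Y (Fin n)
  closeProps (inj₁ p) = propY p
  closeProps (inj₂ (inj₁ ()))
  closeProps (inj₂ (inj₂ ()))

  MCL→CDL : MCLSentence n → CDL n
  MCL→CDL φ = toC (sub closeProps (fromMCL φ))

  -- The sentence and its translation are compared on the expansion only. The hub formula passes
  -- between `K` and `Kω` by its own invariance, the sentence by the assumed closure.
  MCL→CDL⟺ : EM → (φ : MCLSentence n) → BisimClosed (LMCL φ) → LCDL (MCL→CDL φ) ≐ LMCL φ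
  MCL→CDL⟺ em φ closed K = ⟺-sym (toC⟺ em K φY []) ⟫
    bisim-invariant (fromBisim B) φY (Bisim.root B) ⟫ sub⟺ Kω (Val Kω) closeProps (fromMCL φ) [] ⟫
    local Kω [] (KTree.root Kω) agree (fromMCL φ) ⟫
    ⟺-sym (FromMCL.fromMCL⟺ em K φ (λ ()) (λ ()) (λ ()) (λ ())) ⟫
    (closed Kω K (flip-Bisim B) , closed K Kω B)
    where
    φY : Y (Fin n)
    φY = sub closeProps (fromMCL φ)
    Kω : KTree n
    Kω = expand K
    B : Bisim K Kω
    B = Expand.expand-bisim K
    agree : ∀ u → [] ≼ u → ∀ p → satY Kω (Val Kω) u (closeProps p) ⟺ FromMCL.val em K (λ ()) (λ ()) p u
    agree u _ (inj₁ p) = ⟺-refl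
    agree u _ (inj₂ (inj₁ ()))
    agree u _ (inj₂ (inj₂ ()))

-- The hub logic into MCL

MCLTests : ∀ n m k → Fin m → Tests
MCLTests n m k x = record { G = MCL n m k ; ttᵍ = leq x x ; ¬ᵍ_ = neg ; _∧ᵍ_ = and }

exCs : ∀ {n m k} j → MCL n m (j + k) → MCL n m k
exCs zero    φ = φ
exCs (suc j) φ = exCs j (exC φ)

module _ {n m k : ℕ} where

  child : Fin m → Fin m → MCL n m k
  child y z = and (and (leq y z) (neg (leq z y)))
    (neg (ex1 (and (and (leq (suc y) zero) (neg (leq zero (suc y))))
                   (and (leq zero (suc z)) (neg (leq (suc z) zero))))))

  unique : ∀ {j} → (Fin j → Fin k) → Fin m → MCL n m k
  unique {j} Z y = andL (elems (fin× (finFin j) (finFin j))) λ (p , q) →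
      if does (p Finₚ.≟ q) then ttᵍ else neg (and (mem y (Z p)) (mem y (Z q)))
    where open Tests (MCLTests n m k y)

  accepting : ∀ {j} → (Fin j → Fin k) → (Fin j → Bool) → Fin m → MCL n m k
  accepting {j} Z F z = orL (elems (finFin j)) λ q → if F q then mem z (Z q) else ffᵍ
    where open Tests (MCLTests n m k z)

  move : ∀ {j} → (Fin j → Fin k) → (Fin j → Fin j → MCL n m k) → Fin m → Fin m → MCL n m k
  move {j} Z δ y z = orL (elems (fin× (finFin j) (finFin j))) λ (p , q) →
      and (mem y (Z p)) (and (mem z (Z q)) (δ p q))
    where open Tests (MCLTests n m k y)

runAt : ∀ {n m k j} → Fin k → (Fin j → Fin k) → (Fin j → Fin j → MCL n (suc (suc m)) k) → (Fin j → Bool) →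
        Fin m → MCL n (suc m) k
runAt P Z δ F x = and (leq (suc x) zero) (and (unique Z zero) (and
  (ex1 (and (mem zero P) (and (child (suc zero) zero) (move Z δ (suc zero) zero))))
  (ex1 (and (mem zero P) (and (leq (suc zero) zero) (accepting Z F zero))))))

runOn : ∀ {n m k j} → Fin k → (Fin j → Fin k) → Fin j → (Fin j → Fin j → MCL n (suc (suc m)) k) → (Fin j → Bool) →
        Fin m → MCL n m k
runOn P Z i δ F x =
  and (and (mem x P) (mem x (Z i))) (neg (ex1 (and (mem zero P) (neg (runAt P Z δ F x)))))

toMCL : ∀ {n m k} → Y (Fin n) → Fin m → MCL n m k
toMCL topY         x = leq x x
toMCL (propY p)    x = prop p x
toMCL (negY φ)     x = neg (toMCL φ x)
toMCL (andY φ ψ)   x = and (toMCL φ x) (toMCL ψ x)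
-- The chain of the path is bound first and the chains of the states in front of it, hence the
-- indices `j ↑ʳ zero` and `q ↑ˡ suc k`. Inside a test the variable `zero` is the target of the step
-- and `suc zero` its source, where the test is evaluated.
toMCL {k = k} (EY j i δ F) x = exC (exCs j (runOn (j ↑ʳ zero) (λ q → q ↑ˡ suc k) i
  (λ p q → toMCL (δ p q) (suc zero)) F x))

module ToMCL (em₁ : ExcludedMiddle (lsuc 0ℓ)) {n : ℕ} (K : KTree n) where
  open KTree K
  open MCLSem K using (sat)
  em : EM
  em = em-lower em₁

  Chains : ℕ → Set₁
  Chains j = Fin j → List D → Set

  infixr 5 _⧺_
  _⧺_ : ∀ {j k} → Chains j → Chains k → Chains (j + k)
  _⧺_ {zero}  Z σ = σ
  _⧺_ {suc j} Z σ = Z zero ∷ᶠ ((Z ∘ suc) ⧺ σ)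

  ⧺-left : ∀ {j k} (Z : Chains j) (σ : Chains k) q → (Z ⧺ σ) (q ↑ˡ k) ≡ Z q
  ⧺-left Z σ zero    = refl
  ⧺-left Z σ (suc q) = ⧺-left (Z ∘ suc) σ q

  ⧺-right : ∀ {j k} (Z : Chains j) (σ : Chains k) X → (Z ⧺ σ) (j ↑ʳ X) ≡ σ X
  ⧺-right {zero}  Z σ X = refl
  ⧺-right {suc j} Z σ X = ⧺-right (Z ∘ suc) σ X

  exCs⟺ : ∀ {m k} (ρ : Fin m → List D) (σ : Chains k) j φ →
          sat ρ σ (exCs j φ) ⟺ Σ (Chains j) λ Z → (∀ q → IsChain K (Z q)) × sat ρ (Z ⧺ σ) φ
  exCs⟺ ρ σ zero    φ = (λ h → (λ ()) , (λ ()) , h) , λ (_ , _ , h) → h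
  exCs⟺ ρ σ (suc j) φ = exCs⟺ ρ σ j (exC φ) ⟫
    ((λ (Z , ch , U , lift chU , h) → (U ∷ᶠ Z) , (λ { zero → chU ; (suc q) → ch q }) , h) ,
     λ (Z , ch , h) → Z ∘ suc , (λ q → ch (suc q)) , Z zero , lift (ch zero) , h)

  module _ {m k : ℕ} (ρ : Fin m → List D) (σ : Chains k) where

    Sat : MCL n m k → Set
    Sat φ = does (em₁ {sat ρ σ φ}) ≡ true

    Sat⟺ : ∀ φ → Sat φ ⟺ sat ρ σ φ
    Sat⟺ φ = does⟺ (em₁ {sat ρ σ φ})

    -- Lowers satisfaction by one universe level, so that the lemmas on tests apply.
    MCLModel : ∀ x → Model (MCLTests n m k x)
    MCLModel x = record
      { L = ⊤ ; _⊨_ = λ _ → Sat ; ⊨tt = λ _ → proj₂ (Sat⟺ (leq x x)) (lift (≼-refl K _))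
      ; ⊨¬ = λ _ φ → Sat⟺ (neg φ) ⟫ ¬-⟺ (⟺-sym (Sat⟺ φ))
      ; ⊨∧ = λ _ φ ψ → Sat⟺ (and φ ψ) ⟫ ×-⟺ (⟺-sym (Sat⟺ φ)) (⟺-sym (Sat⟺ ψ)) }

    sat-∀ : ∀ φ ψ → sat ρ σ (neg (ex1 (and φ (neg ψ)))) ⟺
            (∀ w → T w → sat (w ∷ᶠ ρ) σ φ → sat (w ∷ᶠ ρ) σ ψ)
    sat-∀ φ ψ = (λ h w Tw hφ → decidable-stable (em₁ {sat (w ∷ᶠ ρ) σ ψ}) λ n → h (w , lift Tw , hφ , n)) ,
                λ { h (w , lift Tw , hφ , n) → n (h w Tw hφ) }

    Child : List D → List D → Set
    Child y z = Σ D λ d → z ≡ y ∷ʳ d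

    sat-child : ∀ y z → T (ρ z) → sat ρ σ (child y z) ⟺ Child (ρ y) (ρ z)
    sat-child y z Tz = to , from
      where
      longer : ∀ (u : List D) d s → ¬ (length (u ++ d ∷ s) ≤ length u)
      longer u d s le = ℕₚ.m+1+n≰m (length u) (subst (_≤ length u) (Listₚ.length-++ u {d ∷ s}) le)
      to : sat ρ σ (child y z) → Child (ρ y) (ρ z)
      to ((lift ([] , eq) , n) , _) = ⊥-elim (n (lift ([] , trans (sym (Listₚ.++-identityʳ (ρ y)))
        (trans (sym eq) (sym (Listₚ.++-identityʳ (ρ z)))))))
      to ((lift (d ∷ [] , eq) , _) , _) = d , eq
      to ((lift (d ∷ e ∷ s , eq) , _) , none) = ⊥-elim (none (ρ y ∷ʳ d , lift (T-prefix K le Tz) ,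
          (lift (d ∷ [] , refl) , λ (lift le′) → longer (ρ y) d [] (≼-length K le′)) ,
          (lift le , λ (lift le′) → longer (ρ y ∷ʳ d) e s (subst (λ v → length v ≤ length (ρ y ∷ʳ d)) eq′ (≼-length K le′)))))
        where
        eq′ : ρ z ≡ (ρ y ∷ʳ d) ++ e ∷ s
        eq′ = trans eq (sym (∷ʳ-++ K (ρ y) d (e ∷ s)))
        le : (ρ y ∷ʳ d) ≼ ρ z
        le = e ∷ s , eq′
      from : Child (ρ y) (ρ z) → sat ρ σ (child y z)
      from (d , eq) = (lift (d ∷ [] , eq) , λ (lift le) → longer (ρ y) d [] (subst (λ v → length v ≤ length (ρ y)) eq (≼-length K le))) ,
        λ { (u , _ , (lift ([] , e) , n) , _) → n (lift ([] , trans (sym (Listₚ.++-identityʳ (ρ y)))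
                (trans (sym e) (sym (Listₚ.++-identityʳ u)))))
          ; (u , _ , (lift (a ∷ s , e) , _) , lift le , n) → n (lift ([] , trans
                (≼-antisym-length K le (ℕₚ.≤-antisym (≼-length K le)
                  (ℕₚ.≤-trans (ℕₚ.≤-reflexive (trans (cong length eq) (Listₚ.length-++ (ρ y))))
                    (subst (length (ρ y) + 1 ≤_) (sym (trans (cong length e) (Listₚ.length-++ (ρ y))))
                      (ℕₚ.+-monoʳ-≤ (length (ρ y)) (s≤s z≤n))))))
                (sym (Listₚ.++-identityʳ (ρ z))))) }

    module _ {j : ℕ} (Z : Fin j → Fin k) where

      sat-unique : ∀ y → sat ρ σ (unique Z y) ⟺ (∀ p q → σ (Z p) (ρ y) → σ (Z q) (ρ y) → p ≡ q)
      sat-unique y = ⟺-sym (Sat⟺ _) ⟫ ⊨andF tt (fin× (finFin j) (finFin j)) _ ⟫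
        ((λ h p q → to p q (h (p , q))) , λ h (p , q) → from p q (h p q))
        where
        open ModelProps em (MCLModel y)
        open Tests (MCLTests n m k y)
        to : ∀ p q → Sat (if does (p Finₚ.≟ q) then ttᵍ else neg (and (mem y (Z p)) (mem y (Z q)))) →
             σ (Z p) (ρ y) → σ (Z q) (ρ y) → p ≡ q
        to p q h hp hq with p Finₚ.≟ q
        ... | yes eq = eq
        ... | no _   = ⊥-elim (proj₁ (Sat⟺ (neg (and (mem y (Z p)) (mem y (Z q))))) h (lift hp , lift hq))
        from : ∀ p q → (σ (Z p) (ρ y) → σ (Z q) (ρ y) → p ≡ q) →
               Sat (if does (p Finₚ.≟ q) then ttᵍ else neg (and (mem y (Z p)) (mem y (Z q))))
        from p q h with p Finₚ.≟ q
        ... | yes _ = proj₂ (Sat⟺ (leq y y)) (lift (≼-refl K _))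
        ... | no n  = proj₂ (Sat⟺ (neg (and (mem y (Z p)) (mem y (Z q))))) λ (lift hp , lift hq) → n (h hp hq)

      sat-accepting : ∀ F z → sat ρ σ (accepting Z F z) ⟺ Σ (Fin j) λ q → F q ≡ true × σ (Z q) (ρ z)
      sat-accepting F z = ⟺-sym (Sat⟺ _) ⟫ ⊨orF tt (finFin j) _ ⟫ Σ-⟺ λ q →
        ⊨if tt (F q) (mem z (Z q)) ⟫ ×-⟺ ⟺-refl (Sat⟺ (mem z (Z q)) ⟫ (lower , lift))
        where open ModelProps em (MCLModel z)

      sat-move : ∀ δ y z → sat ρ σ (move Z δ y z) ⟺
                 Σ (Fin j × Fin j) λ (p , q) → σ (Z p) (ρ y) × σ (Z q) (ρ z) × sat ρ σ (δ p q)
      sat-move δ y z = ⟺-sym (Sat⟺ _) ⟫ ⊨orF tt (fin× (finFin j) (finFin j)) _ ⟫ Σ-⟺ λ (p , q) →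
        Sat⟺ (and (mem y (Z p)) (and (mem z (Z q)) (δ p q))) ⟫ ×-⟺ (lower , lift) (×-⟺ (lower , lift) ⟺-refl)
        where open ModelProps em (MCLModel y)

  -- The chain U is a path from w on which the chains Z mark an accepting run.
  record PathRun (w : List D) {j : ℕ} (i : Fin j) (δ : Fin j → Fin j → List D → Set) (F : Fin j → Bool)
                 (U : List D → Set) (Z : Fin j → List D → Set) : Set where
    field
      start : U w × Z i w
      above : ∀ y → U y → w ≼ y
      uniq  : ∀ y → U y → ∀ p q → Z p y → Z q y → p ≡ q
      nexts : ∀ y → U y → Σ D λ d → U (y ∷ʳ d) × Σ (Fin j) λ p → Σ (Fin j) λ q → Z p y × Z q (y ∷ʳ d) × δ p q y
      visit : ∀ y → U y → Σ (List D) λ z → U z × y ≼ z × Σ (Fin j) λ q → F q ≡ true × Z q z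

  module _ {w : List D} {j : ℕ} {i : Fin j} {δ : Fin j → Fin j → List D → Set} {F : Fin j → Bool} where

    Runs : Set
    Runs = Σ (Path K w) λ π → Σ (ℕ → Fin j) λ q → q 0 ≡ i × (∀ l → δ (q l) (q (suc l)) (Path.π π l)) ×
           Unbounded (λ l → F (q l) ≡ true)

    marked : ∀ {U Z} → IsChain K U → PathRun w i δ F U Z → Runs
    marked {U} {Z} (U⊆T , cmp) R = π , (λ l → proj₁ (proj₂ (proj₂ (at l)))) , refl , edges , unb
      where
      open PathRun R
      At : Set
      At = Σ (List D) λ y → U y × Σ (Fin j) λ p → Z p y
      nx : At → At
      nx (y , Uy , _) = let (d , Ud , _ , q , _ , Zq , _) = nexts y Uy in y ∷ʳ d , Ud , q , Zq
      at : ℕ → At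
      at = iterate (w , proj₁ start , i , proj₂ start) λ _ → nx
      π : Path K w
      π = record { π = λ l → proj₁ (at l) ; start = refl ; inT = λ l → U⊆T _ (proj₁ (proj₂ (at l)))
                 ; step = λ l → proj₁ (nexts _ (proj₁ (proj₂ (at l)))) , refl }
      q : ℕ → Fin j
      q l = proj₁ (proj₂ (proj₂ (at l)))
      edges : ∀ l → δ (q l) (q (suc l)) (proj₁ (at l))
      edges l = let (y , Uy , p , Zp) = at l ; (_ , _ , p′ , _ , Zp′ , _ , h) = nexts y Uy in
        subst (λ p → δ p (q (suc l)) y) (uniq y Uy p′ p Zp′ Zp) h
      unb : Unbounded (λ l → F (q l) ≡ true)
      -- `visit` provides merely some node `z` of the chain. The path node of the same depth is in
      -- the chain as well, and comparable nodes of equal length coincide.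
      unb l = let (y , Uy , _) = at l
                  (z , Uz , le , p , Fp , Zp) = visit y Uy
                  lw = ≼-length K (above z Uz)
                  l′ = length z ∸ length w
                  len : length (proj₁ (at l′)) ≡ length z
                  len = trans (path-length K π l′) (ℕₚ.m∸n+n≡m lw)
                  same : proj₁ (at l′) ≡ z
                  same = [ (λ le → ≼-antisym-length K le len) , (λ le → sym (≼-antisym-length K le (sym len))) ]′
                           (cmp (proj₁ (at l′)) z (proj₁ (proj₂ (at l′))) Uz)
              in l′ , ℕₚ.+-cancelʳ-≤ (length w) _ _ (subst₂ _≤_ (path-length K π l) (sym (ℕₚ.m∸n+n≡m lw)) (≼-length K le)) ,
                 trans (cong F (uniq z Uz (q l′) p (subst (Z (q l′)) same (proj₂ (proj₂ (proj₂ (at l′))))) Zp)) Fp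

    marks : Runs → Σ (List D → Set) λ U → IsChain K U ×
            Σ (Chains j) λ Z → (∀ q → IsChain K (Z q)) × PathRun w i δ F U Z
    marks (π , q , q0 , qe , qF) = U , ((λ { _ (l , refl) → π.inT l }) , λ { _ _ (l , refl) (m , refl) → path-linear K π l m }) ,
        Z , (λ p → (λ { _ (l , refl , _) → π.inT l }) , λ { _ _ (l , refl , _) (m , refl , _) → path-linear K π l m }) , record
        { start = (0 , sym π.start) , 0 , sym π.start , q0
        ; above = λ { _ (l , refl) → path-from K π l }
        ; uniq = λ { _ _ p p′ (l , e , refl) (l′ , e′ , refl) → cong q (path-injective K π (trans (sym e) e′)) }
        ; nexts = λ { _ (l , refl) → proj₁ (π.step l) , (suc l , sym (proj₂ (π.step l))) , q l , q (suc l) ,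
                        (l , refl , refl) , (suc l , sym (proj₂ (π.step l)) , refl) , qe l }
        ; visit = λ { _ (l , refl) → let (m , le , Fm) = qF l in π.π m , (m , refl) ,
                        subst (λ x → π.π l ≼ π.π x) (ℕₚ.m∸n+n≡m le) (path-≼ K π l (m ∸ l)) , q m , Fm , m , refl , refl } }
      where
      module π = Path π
      U : List D → Set
      U u = Σ ℕ λ l → u ≡ π.π l
      Z : Chains j
      Z p u = Σ ℕ λ l → u ≡ π.π l × q l ≡ p

  runOn⟺ : ∀ {m k j} (ρ : Fin m → List D) (σ : Chains k) (P : Fin k) (Z : Fin j → Fin k) i
           (δ : Fin j → Fin j → MCL n (suc (suc m)) k) (δ′ : Fin j → Fin j → List D → Set) F x →
           IsChain K (σ P) → (∀ p q ρ′ → sat ρ′ σ (δ p q) ⟺ δ′ p q (ρ′ (suc zero))) →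
           sat ρ σ (runOn P Z i δ F x) ⟺ PathRun (ρ x) i δ′ F (σ P) (λ q → σ (Z q))
  runOn⟺ {m} {k} {j} ρ σ P Z i δ δ′ F x (P⊆T , cmp) δ⟺ =
    ×-⟺ (×-⟺ (lower , lift) (lower , lift)) (sat-∀ ρ σ (mem zero P) (runAt P Z δ F x) ⟫ Π-⟺ at⟺) ⟫ (to , from)
    where
    record At (y : List D) : Set where
      field
        above : ρ x ≼ y
        uniq  : ∀ p q → σ (Z p) y → σ (Z q) y → p ≡ q
        nexts : Σ D λ d → σ P (y ∷ʳ d) × Σ (Fin j) λ p → Σ (Fin j) λ q → σ (Z p) y × σ (Z q) (y ∷ʳ d) × δ′ p q y
        visit : Σ (List D) λ z → σ P z × y ≼ z × Σ (Fin j) λ q → F q ≡ true × σ (Z q) z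
    nexts⟺ : ∀ y → sat (y ∷ᶠ ρ) σ (ex1 (and (mem zero P) (and (child (suc zero) zero) (move Z δ (suc zero) zero)))) ⟺
             Σ D λ d → σ P (y ∷ʳ d) × Σ (Fin j) λ p → Σ (Fin j) λ q → σ (Z p) y × σ (Z q) (y ∷ʳ d) × δ′ p q y
    nexts⟺ y = fwd , bwd
      where
      fwd : sat (y ∷ᶠ ρ) σ (ex1 (and (mem zero P) (and (child (suc zero) zero) (move Z δ (suc zero) zero)))) → _
      fwd (z , lift Tz , lift Pz , c , mv)
        with proj₁ (sat-child (z ∷ᶠ (y ∷ᶠ ρ)) σ (suc zero) zero Tz) c
           | proj₁ (sat-move (z ∷ᶠ (y ∷ᶠ ρ)) σ Z δ (suc zero) zero) mv
      ... | d , refl | (p , q) , Zp , Zq , h = d , Pz , p , q , Zp , Zq , proj₁ (δ⟺ p q _) h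
      bwd : _ → sat (y ∷ᶠ ρ) σ (ex1 (and (mem zero P) (and (child (suc zero) zero) (move Z δ (suc zero) zero))))
      bwd (d , Pz , p , q , Zp , Zq , h) = y ∷ʳ d , lift (P⊆T _ Pz) , lift Pz ,
        proj₂ (sat-child ((y ∷ʳ d) ∷ᶠ (y ∷ᶠ ρ)) σ (suc zero) zero (P⊆T _ Pz)) (d , refl) ,
        proj₂ (sat-move ((y ∷ʳ d) ∷ᶠ (y ∷ᶠ ρ)) σ Z δ (suc zero) zero) ((p , q) , Zp , Zq , proj₂ (δ⟺ p q _) h)
    visit⟺ : ∀ y → sat (y ∷ᶠ ρ) σ (ex1 (and (mem zero P) (and (leq (suc zero) zero) (accepting Z F zero)))) ⟺
             Σ (List D) λ z → σ P z × y ≼ z × Σ (Fin j) λ q → F q ≡ true × σ (Z q) z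
    visit⟺ y = Σ-⟺ λ z → (λ (_ , lift Pz , lift le , h) → Pz , le , proj₁ (sat-accepting (z ∷ᶠ (y ∷ᶠ ρ)) σ Z F zero) h) ,
      λ (Pz , le , h) → lift (P⊆T z Pz) , lift Pz , lift le , proj₂ (sat-accepting (z ∷ᶠ (y ∷ᶠ ρ)) σ Z F zero) h
    at⟺ : ∀ y → (T y → sat (y ∷ᶠ ρ) σ (mem zero P) → sat (y ∷ᶠ ρ) σ (runAt P Z δ F x)) ⟺ (σ P y → At y)
    at⟺ y = (λ h Py → let (lift ab , un , ne , vi) = h (P⊆T y Py) (lift Py) in record
        { above = ab ; uniq = proj₁ (sat-unique (y ∷ᶠ ρ) σ Z zero) un
        ; nexts = proj₁ (nexts⟺ y) ne ; visit = proj₁ (visit⟺ y) vi }) ,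
      λ h _ (lift Py) → let open At (h Py) in lift above , proj₂ (sat-unique (y ∷ᶠ ρ) σ Z zero) uniq ,
        proj₂ (nexts⟺ y) nexts , proj₂ (visit⟺ y) visit
    to : (σ P (ρ x) × σ (Z i) (ρ x)) × (∀ y → σ P y → At y) → PathRun (ρ x) i δ′ F (σ P) (λ q → σ (Z q))
    to (s , h) = record { start = s ; above = λ y Py → At.above (h y Py) ; uniq = λ y Py → At.uniq (h y Py)
                        ; nexts = λ y Py → At.nexts (h y Py) ; visit = λ y Py → At.visit (h y Py) }
    from : PathRun (ρ x) i δ′ F (σ P) (λ q → σ (Z q)) → (σ P (ρ x) × σ (Z i) (ρ x)) × (∀ y → σ P y → At y)
    from R = start , λ y Py → record { above = above y Py ; uniq = uniq y Py ; nexts = nexts y Py ; visit = visit y Py }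
      where open PathRun R

  toMCL⟺ : ∀ φ {m k} (ρ : Fin m → List D) (σ : Chains k) x → sat ρ σ (toMCL φ x) ⟺ satY K (Val K) (ρ x) φ
  toMCL⟺ topY         ρ σ x = (λ _ → tt) , λ _ → lift (≼-refl K _)
  toMCL⟺ (propY p)    ρ σ x = lower , lift
  toMCL⟺ (negY φ)     ρ σ x = ¬-⟺ (toMCL⟺ φ ρ σ x)
  toMCL⟺ (andY φ ψ)   ρ σ x = ×-⟺ (toMCL⟺ φ ρ σ x) (toMCL⟺ ψ ρ σ x)
  toMCL⟺ (EY j i δ F) {m} {k} ρ σ x = Σ-⟺ (λ U → ×-⟺ (lower , lift) (exCs⟺ ρ (U ∷ᶠ σ) j _)) ⟫ (to , from)
    where
    δ′ : Fin j → Fin j → List D → Set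
    δ′ p q u = satY K (Val K) u (δ p q)
    body : MCL n m (j + suc k)
    body = runOn (j ↑ʳ zero) (λ q → q ↑ˡ suc k) i (λ p q → toMCL (δ p q) (suc zero)) F x
    body⟺ : ∀ U Z → IsChain K U → sat ρ (Z ⧺ (U ∷ᶠ σ)) body ⟺ PathRun (ρ x) i δ′ F U Z
    body⟺ U Z chU = runOn⟺ ρ (Z ⧺ (U ∷ᶠ σ)) (j ↑ʳ zero) (λ q → q ↑ˡ suc k) i _ δ′ F x
        (subst (IsChain K) (sym eqU) chU) (λ p q ρ′ → toMCL⟺ (δ p q) ρ′ (Z ⧺ (U ∷ᶠ σ)) (suc zero)) ⟫
      (subst₂R (λ q → ⧺-left Z (U ∷ᶠ σ) q) eqU , subst₂R (λ q → sym (⧺-left Z (U ∷ᶠ σ) q)) (sym eqU))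
      where
      eqU : (Z ⧺ (U ∷ᶠ σ)) (j ↑ʳ zero) ≡ U
      eqU = ⧺-right Z (U ∷ᶠ σ) zero
      subst₂R : ∀ {U U′ Z Z′} → (∀ q → Z q ≡ Z′ q) → U ≡ U′ → PathRun (ρ x) i δ′ F U Z → PathRun (ρ x) i δ′ F U′ Z′
      subst₂R {Z = Z} {Z′} e refl R = record
        { start = proj₁ start , c i (proj₂ start) ; above = above
        ; uniq = λ y Uy p q Zp Zq → uniq y Uy p q (c′ p Zp) (c′ q Zq)
        ; nexts = λ y Uy → let (d , Ud , p , q , Zp , Zq , h) = nexts y Uy in d , Ud , p , q , c p Zp , c q Zq , h
        ; visit = λ y Uy → let (z , Uz , le , q , Fq , Zq) = visit y Uy in z , Uz , le , q , Fq , c q Zq }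
        where
        open PathRun R
        c : ∀ q {y} → Z q y → Z′ q y
        c q {y} = subst (λ X → X y) (e q)
        c′ : ∀ q {y} → Z′ q y → Z q y
        c′ q {y} = subst (λ X → X y) (sym (e q))
    to : (Σ (List D → Set) λ U → IsChain K U × Σ (Chains j) λ Z → (∀ q → IsChain K (Z q)) × sat ρ (Z ⧺ (U ∷ᶠ σ)) body) →
         satY K (Val K) (ρ x) (EY j i δ F)
    to (U , chU , Z , chZ , h) = marked chU (proj₁ (body⟺ U Z chU) h)
    from : satY K (Val K) (ρ x) (EY j i δ F) →
           Σ (List D → Set) λ U → IsChain K U × Σ (Chains j) λ Z → (∀ q → IsChain K (Z q)) × sat ρ (Z ⧺ (U ∷ᶠ σ)) body
    from r = let (U , chU , Z , chZ , R) = marks r in U , chU , Z , chZ , proj₂ (body⟺ U Z chU) R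

-- Acceptance by hesitant automata, component by component

AllPB-map : ∀ {k} {P Q : Fin k → Set} → (∀ {q} → P q → Q q) → ∀ {α} → AllPB P α → AllPB Q α
AllPB-map f (atom p)   = atom (f p)
AllPB-map f ptt        = ptt
AllPB-map f pff        = pff
AllPB-map f (pand a b) = pand (AllPB-map f a) (AllPB-map f b)
AllPB-map f (por a b)  = por (AllPB-map f a) (AllPB-map f b)

AllCon-map : ∀ {k} {P Q : Fin k → Set} → (∀ {q} → P q → Q q) → ∀ {θ} → AllCon P θ → AllCon Q θ
AllCon-map f c⊤         = c⊤
AllCon-map f c⊥         = c⊥
AllCon-map f (cor a b)  = cor (AllCon-map f a) (AllCon-map f b)
AllCon-map f (cand a b) = cand (AllCon-map f a) (AllCon-map f b)
AllCon-map f (◇ a)      = ◇ (AllPB-map f a)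
AllCon-map f (□ a)      = □ (AllPB-map f a)

conj→all : ∀ {k} {P : Fin k → Set} {θ} → ConjLow P θ → AllCon P θ
conj→all c⊤         = c⊤
conj→all (cand a b) = cand (conj→all a) (conj→all b)
conj→all (◇ a)      = ◇ a
conj→all (□ a)      = □ a

disj→all : ∀ {k} {P : Fin k → Set} {θ} → DisjLow P θ → AllCon P θ
disj→all c⊥        = c⊥
disj→all (cor a b) = cor (disj→all a) (disj→all b)
disj→all (◇ a)     = ◇ a
disj→all (□ a)     = □ a

-- W q stands for the set of nodes accepted from q.
module Semantics {n : ℕ} (K : KTree n) where
  open KTree K

  pbW : ∀ {k} → (Fin k → List D → Set) → List D → PB k → Set
  pbW W v (atom q)   = W q v
  pbW W v ptt        = ⊤
  pbW W v pff        = ⊥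
  pbW W v (pand α β) = pbW W v α × pbW W v β
  pbW W v (por α β)  = pbW W v α ⊎ pbW W v β

  conW : ∀ {k} → (Fin k → List D → Set) → List D → Con k → Set
  conW W w c⊤         = ⊤
  conW W w c⊥         = ⊥
  conW W w (cor θ η)  = conW W w θ ⊎ conW W w η
  conW W w (cand θ η) = conW W w θ × conW W w η
  conW W w (◇ α)      = Σ D λ d → T (w ∷ʳ d) × pbW W (w ∷ʳ d) α
  conW W w (□ α)      = ∀ d → T (w ∷ʳ d) → pbW W (w ∷ʳ d) α

  -- A disjunct ◇q′ ∧ θ with θ true, resp. a conjunct □q′ ∨ θ with θ false.
  ExTerm UnTerm : ∀ {k} → (Fin k → List D → Set) → List D → Con k → Fin k → Set
  ExTerm W w (cor θ η) q′             = ExTerm W w θ q′ ⊎ ExTerm W w η q′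
  ExTerm W w (cand (◇ (atom q)) θ) q′ = q ≡ q′ × conW W w θ
  ExTerm W w _ q′                     = ⊥
  UnTerm W w (cand θ η) q′            = UnTerm W w θ q′ ⊎ UnTerm W w η q′
  UnTerm W w (cor (□ (atom q)) θ) q′  = q ≡ q′ × ¬ conW W w θ
  UnTerm W w _ q′                     = ⊥

  module _ {k : ℕ} {W W′ : Fin k → List D → Set} {P : Fin k → Set} where

    pbW-mono : (∀ {q v} → P q → W q v → W′ q v) → ∀ {v α} → AllPB P α → pbW W v α → pbW W′ v α
    pbW-mono f (atom p)   h        = f p h
    pbW-mono f ptt        h        = h
    pbW-mono f (pand a b) (h , h′) = pbW-mono f a h , pbW-mono f b h′
    pbW-mono f (por a b)  (inj₁ h) = inj₁ (pbW-mono f a h)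
    pbW-mono f (por a b)  (inj₂ h) = inj₂ (pbW-mono f b h)

    conW-mono : (∀ {q v} → P q → W q v → W′ q v) → ∀ {w θ} → AllCon P θ → conW W w θ → conW W′ w θ
    conW-mono f c⊤         h            = h
    conW-mono f (cor a b)  (inj₁ h)     = inj₁ (conW-mono f a h)
    conW-mono f (cor a b)  (inj₂ h)     = inj₂ (conW-mono f b h)
    conW-mono f (cand a b) (h , h′)     = conW-mono f a h , conW-mono f b h′
    conW-mono f (◇ a)      (d , Td , h) = d , Td , pbW-mono f a h
    conW-mono f (□ a)      h            = λ d Td → pbW-mono f a (h d Td)

module Acceptance (em : EM) {n : ℕ} (A : HGTA n) (K : KTree n) where
  open HGTA A
  open KTree K
  open Semantics K

  rank : Fin k → ℕ
  rank q = toℕ (ord q)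

  Runs : ((Fin k → List D → Set) → List D → Con k → Fin k → Set) → (Fin k → List D → Set) →
         ℕ → Fin k → (w : List D) → Path K w → (ℕ → Fin k) → Set
  Runs Term W m q w π r = r 0 ≡ q × (∀ l → Term W (Path.π π l) (δ (r l) (Lab (Path.π π l))) (r (suc l))) ×
                          Unbounded (λ l → Ω (r l) ≡ m)

  ExRun UnRun : (Fin k → List D → Set) → ℕ → Fin k → List D → Set
  ExRun W m q w = Σ (Path K w) λ π → Σ (ℕ → Fin k) (Runs ExTerm W m q w π)
  UnRun W m q w = Σ (Path K w) λ π → Σ (ℕ → Fin k) (Runs UnTerm W m q w π)

  -- A branch that remains in an existential component has the colours `m ∸ 1` and `m` with `m`
  -- even, so it is accepting iff `m` recurs; in a universal component `m` is odd and it is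
  -- accepting iff `m` does not recur. Both are Büchi conditions on a single path, which is what
  -- `EY` can express.
  CharAt : (Fin k → List D → Set) → ∀ q → List D →
           Transient δ ord hE Ω (ord q) ⊎ (hE (ord q) ≡ true × Existential δ ord hE Ω (ord q)) ⊎
             (hE (ord q) ≡ false × Universal δ ord hE Ω (ord q)) → Set
  CharAt W q w (inj₁ _)                      = W q w ⟺ conW W w (δ q (Lab w))
  CharAt W q w (inj₂ (inj₁ (_ , _ , m , _))) = W q w ⟺ ExRun W m q w
  CharAt W q w (inj₂ (inj₂ (_ , _ , m , _))) = W q w ⟺ (¬ UnRun W m q w)

  Low Same : Fin k → Fin k → Set
  Low q q′  = rank q′ < rank q
  Same q q′ = ord q′ ≡ ord q

  Cols : Fin c → ℕ → Set
  Cols i m = ∀ q → ord q ≡ i → (Ω q ≡ m ∸ 1) ⊎ (Ω q ≡ m)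

  Below : Fin c → Fin k → Set
  Below i q = toℕ (ord q) < toℕ i

  Max : (ℕ → Fin k) → Set
  Max r = Σ ℕ λ m → Even m × Unbounded (λ l → Ω (r l) ≡ m) × (Σ ℕ λ i → ∀ j → i ≤ j → Ω (r j) ≤ m)

  module _ {W : Fin k → List D → Set} {i : Fin c} {w : List D} where

    exT-comp : ∀ {θ q′} → ExForm (λ q → ord q ≡ i) (Below i) θ → ExTerm W w θ q′ → ord q′ ≡ i
    exT-comp (cor a b)  (inj₁ t)   = exT-comp a t
    exT-comp (cor a b)  (inj₂ t)   = exT-comp b t
    exT-comp (term c l) (refl , _) = c

    unT-comp : ∀ {θ q′} → UnForm (λ q → ord q ≡ i) (Below i) θ → UnTerm W w θ q′ → ord q′ ≡ i
    unT-comp (cand a b) (inj₁ t)   = unT-comp a t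
    unT-comp (cand a b) (inj₂ t)   = unT-comp b t
    unT-comp (term c l) (refl , _) = c

    module _ {W′ : Fin k → List D → Set} where

      exT-mono : (∀ {q v} → Below i q → W q v → W′ q v) → ∀ {θ q′} →
                 ExForm (λ q → ord q ≡ i) (Below i) θ → ExTerm W w θ q′ → ExTerm W′ w θ q′
      exT-mono f (cor a b)  (inj₁ t)   = inj₁ (exT-mono f a t)
      exT-mono f (cor a b)  (inj₂ t)   = inj₂ (exT-mono f b t)
      exT-mono f (term c l) (refl , h) = refl , conW-mono f (conj→all l) h

      unT-mono : (∀ {q v} → Below i q → W′ q v → W q v) → ∀ {θ q′} →
                 UnForm (λ q → ord q ≡ i) (Below i) θ → UnTerm W w θ q′ → UnTerm W′ w θ q′
      unT-mono f (cand a b) (inj₁ t)   = inj₁ (unT-mono f a t)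
      unT-mono f (cand a b) (inj₂ t)   = inj₂ (unT-mono f b t)
      unT-mono f (term c l) (refl , n) = refl , λ h → n (conW-mono f (disj→all l) h)

  module _ (W : Fin k → List D → Set) {w : List D} (I : D → Subset k) where

    satW : List D → Con k → Set
    satW w θ = satCon (Σ D λ d → T (w ∷ʳ d)) (λ s → I (proj₁ s)) θ

    module _ {P : Fin k → Set} (from : ∀ {q d} → P q → T (w ∷ʳ d) → q ∈ˢ I d → W q (w ∷ʳ d)) where
      pb→ : ∀ {d α} → AllPB P α → T (w ∷ʳ d) → satPB (I d) α → pbW W (w ∷ʳ d) α
      pb→ (atom p)   Td h        = from p Td h
      pb→ ptt        Td h        = h
      pb→ (pand a b) Td (h , h′) = pb→ a Td h , pb→ b Td h′
      pb→ (por a b)  Td (inj₁ h) = inj₁ (pb→ a Td h)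
      pb→ (por a b)  Td (inj₂ h) = inj₂ (pb→ b Td h)

      con→ : ∀ {θ} → AllCon P θ → satW w θ → conW W w θ
      con→ c⊤         h              = h
      con→ (cor a b)  (inj₁ h)       = inj₁ (con→ a h)
      con→ (cor a b)  (inj₂ h)       = inj₂ (con→ b h)
      con→ (cand a b) (h , h′)       = con→ a h , con→ b h′
      con→ (◇ a)      ((d , Td) , h) = d , Td , pb→ a Td h
      con→ (□ a)      h              = λ d Td → pb→ a Td (h (d , Td))

    module _ {P : Fin k → Set} (to : ∀ {q d} → P q → T (w ∷ʳ d) → W q (w ∷ʳ d) → q ∈ˢ I d) where
      pb← : ∀ {d α} → AllPB P α → T (w ∷ʳ d) → pbW W (w ∷ʳ d) α → satPB (I d) α
      pb← (atom p)   Td h        = to p Td h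
      pb← ptt        Td h        = h
      pb← (pand a b) Td (h , h′) = pb← a Td h , pb← b Td h′
      pb← (por a b)  Td (inj₁ h) = inj₁ (pb← a Td h)
      pb← (por a b)  Td (inj₂ h) = inj₂ (pb← b Td h)

      con← : ∀ {θ} → AllCon P θ → conW W w θ → satW w θ
      con← c⊤         h            = h
      con← (cor a b)  (inj₁ h)     = inj₁ (con← a h)
      con← (cor a b)  (inj₂ h)     = inj₂ (con← b h)
      con← (cand a b) (h , h′)     = con← a h , con← b h′
      con← (◇ a)      (d , Td , h) = (d , Td) , pb← a Td h
      con← (□ a)      h            = λ (d , Td) → pb← a Td (h d Td)

  parity-odd : ∀ {m} → Odd m → ¬ Even m
  parity-odd (h , refl) (h′ , eq) = go h h′ eq
    where
    go : ∀ h h′ → ¬ suc (h + h) ≡ h′ + h′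
    go h zero ()
    go zero (suc h′) eq with trans (ℕₚ.suc-injective eq) (ℕₚ.+-suc h′ h′)
    ... | ()
    go (suc h) (suc h′) eq = go h h′ (ℕₚ.suc-injective (trans (sym (cong suc (ℕₚ.+-suc h h)))
      (trans (ℕₚ.suc-injective eq) (ℕₚ.+-suc h′ h′))))

  pred-even : ∀ {m} → Odd m → Even (m ∸ 1)
  pred-even (h , refl) = h , refl

  pred-odd : ∀ {m} → Even (suc m) → Odd m
  pred-odd {m} (suc h , eq) = h , trans (ℕₚ.suc-injective eq) (ℕₚ.+-suc h h)

  -- From an accepting run to the characterisation.

  module Char (W : Fin k → List D → Set) (char : ∀ q w → T w → CharAt W q w (hesitant (ord q))) where

    module FromRun (ρ : Run A K) where
      open Run ρ

      state : List R → Fin k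
      state x = proj₁ (lab x)

      node : List R → List D
      node x = proj₂ (lab x)

      AcceptFrom : List R → Set
      AcceptFrom x = (β : ℕ → List R) → β 0 ≡ x → (∀ i → Tr (β i)) → (∀ i → Σ R λ r → β (suc i) ≡ β i ∷ʳ r) →
                     Max (λ l → state (β l))

      accept-child : ∀ x r → Tr x → AcceptFrom x → AcceptFrom (x ∷ʳ r)
      accept-child x r Tx acc β β0 βT βs = untail (acc γ refl γT γs)
        where
        γ : ℕ → List R
        γ zero    = x
        γ (suc l) = β l
        γT : ∀ i → Tr (γ i)
        γT zero    = Tx
        γT (suc l) = βT l
        γs : ∀ i → Σ R λ r → γ (suc i) ≡ γ i ∷ʳ r
        γs zero    = r , β0
        γs (suc l) = βs l
        untail : Max (λ l → state (γ l)) → Max (λ l → state (β l))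
        untail (m , ev , ub , i , le) = m , ev , ub′ , i , λ j i≤j → le (suc j) (ℕₚ.m≤n⇒m≤1+n i≤j)
          where
          ub′ : Unbounded (λ l → Ω (state (β l)) ≡ m)
          ub′ l with ub (suc l)
          ... | suc j , s≤s l≤j , e = j , l≤j , e

      record Good (x : List R) (q : Fin k) (w : List D) : Set where
        field
          Tx   : Tr x
          labx : lab x ≡ (q , w)
          acc  : AcceptFrom x

      module _ {x : List R} {q : Fin k} {w : List D} (g : Good x q w) where
        open Good g
        I : D → Subset k
        I = proj₁ (step x Tx)

        holds : satW W {w} I w (δ q (Lab w))
        holds = subst (λ (q , w) → satW W {w} I w (δ q (Lab w))) labx (proj₁ (proj₂ (step x Tx)))

        child-good : ∀ {d q′} → T (w ∷ʳ d) → q′ ∈ˢ I d → Σ R λ r → Good (x ∷ʳ r) q′ (w ∷ʳ d)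
        child-good {d} {q′} Td m =
          let (r , Tr′ , eq) = subst (λ (q , w) → T (w ∷ʳ d) → q′ ∈ˢ I d →
                                 Σ R λ r → Tr (x ∷ʳ r) × lab (x ∷ʳ r) ≡ (q′ , w ∷ʳ d))
                                 labx (proj₂ (proj₂ (proj₂ (step x Tx))) d q′) Td m
          in r , record { Tx = Tr′ ; labx = eq ; acc = accept-child x r Tx acc }

      branch-max : (xs : ℕ → List R) (q : ℕ → Fin k) (w : ℕ → List D) → (∀ l → Good (xs l) (q l) (w l)) →
                   (∀ l → Σ R λ r → xs (suc l) ≡ xs l ∷ʳ r) → Max q
      branch-max xs q w g s =
        let (m , ev , ub , i , le) = Good.acc (g 0) xs refl (λ l → Good.Tx (g l)) s
            eq = λ l → cong Ω (cong proj₁ (Good.labx (g l)))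
        in m , ev , (λ l → let (j , l≤j , e) = ub l in j , l≤j , trans (sym (eq j)) e) ,
           i , λ j i≤j → subst (_≤ m) (eq j) (le j i≤j)

      max-even : ∀ {m} q → Even m → (∀ l → (Ω (q l) ≡ m ∸ 1) ⊎ (Ω (q l) ≡ m)) → Max q → Unbounded (λ l → Ω (q l) ≡ m)
      max-even {m} q ev col (m′ , ev′ , ub , _) = compare m ev (value (proj₁ (ub 0)) (proj₂ (proj₂ (ub 0))))
        where
        value : ∀ l → Ω (q l) ≡ m′ → (m′ ≡ m ∸ 1) ⊎ (m′ ≡ m)
        value l e = [ (λ e′ → inj₁ (trans (sym e) e′)) , (λ e′ → inj₂ (trans (sym e) e′)) ]′ (col l)
        compare : ∀ m → Even m → (m′ ≡ m ∸ 1) ⊎ (m′ ≡ m) → Unbounded (λ l → Ω (q l) ≡ m)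
        compare m       _  (inj₂ refl) = ub
        -- For `m` equal to 0 both admissible colours are 0, since `m ∸ 1` is 0 as well.
        compare zero    _  (inj₁ refl) = ub
        compare (suc m) ev (inj₁ refl) = ⊥-elim (parity-odd (pred-odd ev) ev′)

      max-odd : ∀ {m} q → Odd m → (∀ l → (Ω (q l) ≡ m ∸ 1) ⊎ (Ω (q l) ≡ m)) → Max q → ¬ Unbounded (λ l → Ω (q l) ≡ m)
      max-odd {m} q od col (m′ , ev′ , ub , i , le) ub′ =
          compare od (value (proj₁ (ub 0)) (proj₂ (proj₂ (ub 0))))
        where
        value : ∀ l → Ω (q l) ≡ m′ → (m′ ≡ m ∸ 1) ⊎ (m′ ≡ m)
        value l e = [ (λ e′ → inj₁ (trans (sym e) e′)) , (λ e′ → inj₂ (trans (sym e) e′)) ]′ (col l)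
        m≤m′ : m ≤ m′
        m≤m′ = let (j , i≤j , e) = ub′ i in subst (_≤ m′) e (le j i≤j)
        compare : Odd m → (m′ ≡ m ∸ 1) ⊎ (m′ ≡ m) → ⊥
        compare od         (inj₂ refl) = parity-odd od ev′
        compare (h , refl) (inj₁ refl) = ℕₚ.1+n≰n m≤m′

      exT : ∀ {i w θ} (J : D → Subset k) → (∀ {q d} → toℕ (ord q) < toℕ i → T (w ∷ʳ d) → q ∈ˢ J d → W q (w ∷ʳ d)) →
            ExForm (λ q → ord q ≡ i) (λ q → toℕ (ord q) < toℕ i) θ → satW W {w} J w θ →
            Σ (Fin k) λ q′ → Σ D λ d → T (w ∷ʳ d) × q′ ∈ˢ J d × ord q′ ≡ i × ExTerm W w θ q′
      exT J low (cor a b) (inj₁ h) = let (q′ , d , Td , m , c , t) = exT J low a h in q′ , d , Td , m , c , inj₁ t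
      exT J low (cor a b) (inj₂ h) = let (q′ , d , Td , m , c , t) = exT J low b h in q′ , d , Td , m , c , inj₂ t
      exT J low (term {q′} c l) (((d , Td) , m) , h) = q′ , d , Td , m , c , refl , con→ W J low (conj→all l) h

      unT : ∀ {i w θ q′} (J : D → Subset k) → (∀ {q d} → toℕ (ord q) < toℕ i → T (w ∷ʳ d) → q ∈ˢ J d → W q (w ∷ʳ d)) →
            UnForm (λ q → ord q ≡ i) (λ q → toℕ (ord q) < toℕ i) θ → satW W {w} J w θ → UnTerm W w θ q′ →
            ∀ d → T (w ∷ʳ d) → q′ ∈ˢ J d × ord q′ ≡ i
      unT J low (cand a b) (h , _) (inj₁ t) d Td = unT J low a h t d Td
      unT J low (cand a b) (_ , h) (inj₂ t) d Td = unT J low b h t d Td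
      unT J low (term c l) (inj₁ h) (refl , n) d Td = h (d , Td) , c
      unT J low (term c l) (inj₂ h) (refl , n) d Td = ⊥-elim (n (con→ W J low (disj→all l) h))

      -- Induction on the rank takes care of lower states. In an existential component the run
      -- itself picks a true term at every node, and iterating the choice yields the required path.
      -- In a universal component a bad path cannot exist: along it the lower disjunct always fails,
      -- so the run has to send the next state to every child and in particular follows the path, on
      -- a branch that violates acceptance.
      sound : ∀ i {x q w} → rank q < i → T w → Good x q w → W q w
      sound (suc i) {x} {q} {w} (s≤s lt) Tw g = by (hesitant (ord q)) (char q w Tw)
        where
        below : ∀ {x₁ q₁ w₁} (g₁ : Good x₁ q₁ w₁) → ∀ {q′ d} → toℕ (ord q′) < toℕ (ord q) →
                T (w₁ ∷ʳ d) → q′ ∈ˢ I g₁ d → W q′ (w₁ ∷ʳ d)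
        below g₁ lt′ Td m = sound i (ℕₚ.<-≤-trans lt′ lt) Td (proj₂ (child-good g₁ Td m))
        by : ∀ c → CharAt W q w c → W q w
        by (inj₁ tr) ch = proj₂ ch (con→ W (I g) (below g) (tr q (Lab w) refl) (holds g))
        by (inj₂ (inj₁ (_ , form , m , ev , col))) ch = proj₂ ch
            (π , st-q , refl , (λ l → proj₂ (proj₂ (nx (at l)))) ,
             max-even st-q ev (λ l → col (st-q l) (At.same (at l)))
               (branch-max (λ l → At.xx (at l)) st-q (λ l → At.ww (at l)) (λ l → At.good (at l))
                 (λ l → proj₁ (proj₂ (nx (at l))))))
          where
          record At : Set where
            field
              xx   : List R
              qq   : Fin k
              ww   : List D
              Tww  : T ww
              same : Same q qq
              good : Good xx qq ww
          nx : (a : At) → Σ At λ b → (Σ R λ r → At.xx b ≡ At.xx a ∷ʳ r) ×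
               ExTerm W (At.ww a) (δ (At.qq a) (Lab (At.ww a))) (At.qq b)
          nx a =
            let open At a
                (q′ , d , Td , m , c , t) = exT (I good) (below good) (form qq (Lab ww) same) (holds good)
                (r , g′) = child-good good Td m
            in record { xx = xx ∷ʳ r ; qq = q′ ; ww = ww ∷ʳ d ; Tww = Td ; same = c ; good = g′ } , (r , refl) , t
          at : ℕ → At
          at = iterate (record { xx = x ; qq = q ; ww = w ; Tww = Tw ; same = refl ; good = g }) λ _ a → proj₁ (nx a)
          st-q : ℕ → Fin k
          st-q l = At.qq (at l)
          child-of : ∀ a → Σ D λ d → At.ww (proj₁ (nx a)) ≡ At.ww a ∷ʳ d
          child-of a = proj₁ (proj₂ (exT (I (At.good a)) (below (At.good a)) (form (At.qq a) (Lab (At.ww a)) (At.same a))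
                         (holds (At.good a)))) , refl
          π : Path K w
          π = record { π = λ l → At.ww (at l) ; start = refl ; inT = λ l → At.Tww (at l) ; step = λ l → child-of (at l) }
        by (inj₂ (inj₂ (_ , form , m , od , col))) ch = proj₂ ch refute
          where
          refute : ¬ UnRun W m q w
          refute (π , r , refl , re , rΩ) = max-odd r od (λ l → col (r l) (proj₂ (proj₂ (at l))))
              (branch-max (λ l → proj₁ (at l)) r (Path.π π) (λ l → proj₁ (proj₂ (at l))) (λ l → proj₂ (nx l (at l)))) rΩ
            where
            At : ℕ → Set
            At l = Σ (List R) λ x → Good x (r l) (Path.π π l) × Same q (r l)
            nx : ∀ l (a : At l) → Σ (At (suc l)) λ b → Σ R λ r → proj₁ b ≡ proj₁ a ∷ʳ r
            nx l (x , g , same) =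
              let (d , eq) = Path.step π l
                  Td = subst T eq (Path.inT π (suc l))
                  (m , c) = unT (I g) (below g) (form (r l) (Lab (Path.π π l)) same) (holds g) (re l) d Td
                  (r′ , g′) = child-good g Td m
              in (x ∷ʳ r′ , subst (Good (x ∷ʳ r′) (r (suc l))) (sym eq) g′ , c) , r′ , refl
            at : ∀ l → At l
            at = iterate (x , subst (Good x (r 0)) (sym (Path.start π)) g , refl) (λ l a → proj₁ (nx l a))

    LHGTA→W : LHGTA A K → W q₀ []
    LHGTA→W (ρ , acc) = sound (suc (rank q₀)) ℕₚ.≤-refl root
        record { Tx = Run.rootR ρ ; labx = Run.rootLab ρ ; acc = λ β β0 βT βs → acc β β0 βT βs }
      where open FromRun ρ

stabilise : EM → (f : ℕ → ℕ) → (∀ i → f (suc i) ≤ f i) → Σ ℕ λ i → ∀ l → f (l + i) ≡ f i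
stabilise em f dec′ = go (f 0) 0 ℕₚ.≤-refl
  where
  mono : ∀ i l → f (l + i) ≤ f i
  mono i zero    = ℕₚ.≤-refl
  mono i (suc l) = ℕₚ.≤-trans (dec′ (l + i)) (mono i l)
  go : ∀ v i → f i ≤ v → Σ ℕ λ i → ∀ l → f (l + i) ≡ f i
  go zero i le = i , λ l → trans (ℕₚ.n≤0⇒n≡0 (ℕₚ.≤-trans (mono i l) le)) (sym (ℕₚ.n≤0⇒n≡0 le))
  go (suc v) i le with em {Σ ℕ λ l → f (l + i) < f i}
  ... | yes (l , lt) = go v (l + i) (ℕₚ.≤-pred (ℕₚ.≤-trans lt le))
  ... | no n = i , λ l → ℕₚ.≤-antisym (mono i l) (ℕₚ.≮⇒≥ λ lt → n (l , lt))

-- From the characterisation to an accepting run.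

module BuildRun (em : EM) {n : ℕ} (A : HGTA n) (K : KTree n)
                (W : Fin (HGTA.k A) → List (KTree.D K) → Set)
                (char : ∀ q w → KTree.T K w → Acceptance.CharAt em A K W q w (HGTA.hesitant A (HGTA.ord A q))) where
  open HGTA A
  open KTree K
  open Semantics K
  open Acceptance em A K

  ExI UnI : Fin c → ℕ → Set
  ExI i m = (∀ q a → ord q ≡ i → ExForm (λ q → ord q ≡ i) (Below i) (δ q a)) × Even m × Cols i m
  UnI i m = (∀ q a → ord q ≡ i → UnForm (λ q → ord q ≡ i) (Below i) (δ q a)) × Odd m × Cols i m

  -- Configurations carry evidence because mere acceptance of every successor is not enough: in an
  -- existential component one could keep switching to new good paths and postpone the colour `m`
  -- forever. The evidence fixes the path to be followed.
  data Ev (q : Fin k) (w : List D) : Set where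
    tr : Transient δ ord hE Ω (ord q) → conW W w (δ q (Lab w)) → Ev q w
    ex : ∀ m → ExI (ord q) m → ExRun W m q w → Ev q w
    un : ∀ m → UnI (ord q) m → ¬ UnRun W m q w → Ev q w

  toEv : ∀ {q w} → T w → W q w → Ev q w
  toEv {q} {w} Tw h = by (hesitant (ord q)) (char q w Tw)
    where
    by : ∀ c → CharAt W q w c → Ev q w
    by (inj₁ t) ch                                   = tr t (proj₁ ch h)
    by (inj₂ (inj₁ (_ , form , m , ev , col))) ch = ex m (form , ev , col) (proj₁ ch h)
    by (inj₂ (inj₂ (_ , form , m , od , col))) ch = un m (form , od , col) (proj₁ ch h)

  -- In an existential component the new evidence continues the old state sequence; states are what
  -- is compared, as the colours depend on them alone. In a universal component the step has to be a
  -- term, so that a branch staying there forms a candidate for the excluded bad run.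
  Stay : ∀ {q w} → Ev q w → ∀ {q′ w′} → Ev q′ w′ → Set
  Stay {q} {w} (ex m _ (π , r , _)) {q′} {w′} (ex m′ _ (π′ , r′ , _)) = m′ ≡ m × (∀ l → r′ l ≡ r (suc l))
  Stay {q} {w} (un m _ _) {q′} (un m′ _ _) = m′ ≡ m × UnTerm W w (δ q (Lab w)) q′
  Stay _ _ = ⊥

  Moves : ∀ {q w} → Ev q w → ∀ {q′ w′} → Ev q′ w′ → Set
  Moves {q} e {q′} e′ = Low q q′ ⊎ (Same q q′ × Stay e e′)

  record Config : Set where
    constructor config
    field
      cq : Fin k
      cw : List D
      cT : T cw
      ce : Ev cq cw

  open Config

  Step : Config → Config → Set
  Step x y = (Σ D λ d → cw y ≡ cw x ∷ʳ d) × Moves (ce x) (ce y)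

  module _ {q : Fin k} {w : List D} (Tw : T w) (e : Ev q w) where

    -- The largest admissible choice, namely all states that some evidence reaches by a legal move.
    -- Low states that are accepted belong to it by construction, and illegal continuations never
    -- appear in the run.
    choice : D → Subset k
    choice d = tabulate λ q′ → truth em (Σ (Ev q′ (w ∷ʳ d)) (Moves e))

    choice⟺ : ∀ q′ d → q′ ∈ˢ choice d ⟺ Σ (Ev q′ (w ∷ʳ d)) (Moves e)
    choice⟺ q′ d = ∈ˢ⟺ q′ (choice d) ⟫ ≡→⟺ (cong (_≡ true) (Vecₚ.lookup∘tabulate _ q′)) ⟫ truth⟺ em _

    low∈ : ∀ {q′ d} → Low q q′ → T (w ∷ʳ d) → W q′ (w ∷ʳ d) → q′ ∈ˢ choice d
    low∈ {q′} {d} lt Td h = proj₂ (choice⟺ q′ d) (toEv Td h , inj₁ lt)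

  exT← : ∀ {i w θ q′} (J : D → Subset k) → (∀ {q d} → Below i q → T (w ∷ʳ d) → W q (w ∷ʳ d) → q ∈ˢ J d) →
         ExForm (λ q → ord q ≡ i) (Below i) θ → ExTerm W w θ q′ → ∀ d → T (w ∷ʳ d) → q′ ∈ˢ J d → satW W {w} J w θ
  exT← J low (cor a b)  (inj₁ t)   d Td m = inj₁ (exT← J low a t d Td m)
  exT← J low (cor a b)  (inj₂ t)   d Td m = inj₂ (exT← J low b t d Td m)
  exT← J low (term c l) (refl , h) d Td m = ((d , Td) , m) , con← W J low (conj→all l) h

  unT← : ∀ {i w θ} (J : D → Subset k) → (∀ {q d} → Below i q → T (w ∷ʳ d) → W q (w ∷ʳ d) → q ∈ˢ J d) →
         UnForm (λ q → ord q ≡ i) (Below i) θ →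
         (∀ q′ → ord q′ ≡ i → UnTerm W w θ q′ → ∀ d → T (w ∷ʳ d) → q′ ∈ˢ J d) → satW W {w} J w θ
  unT← J low c⊤         h = tt
  unT← J low (cand a b) h = unT← J low a (λ q′ c t → h q′ c (inj₁ t)) , unT← J low b (λ q′ c t → h q′ c (inj₂ t))
  unT← {w = w} J low (term {q′} {θ} c l) h with em {conW W w θ}
  ... | yes p = inj₂ (con← W J low (disj→all l) p)
  ... | no n  = inj₁ λ (d , Td) → h q′ c (refl , n) d Td

  holds : ∀ {q w} (Tw : T w) (e : Ev q w) → satW W {w} (choice Tw e) w (δ q (Lab w))
  holds {q} {w} Tw e@(tr t h) = con← W (choice Tw e) (low∈ Tw e) (t q (Lab w) refl) h
  holds {q} {w} Tw e@(ex m (form , ev , col) (π , r , r0 , re , rΩ)) =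
    exT← (choice Tw e) (low∈ Tw e) (form q (Lab w) refl) t d (subst T eq (Path.inT π 1))
      (proj₂ (choice⟺ Tw e (r 1) d) (e′ , inj₂ (same , refl , λ _ → refl)))
    where
    d : D
    d = proj₁ (Path.step π 0)
    eq : Path.π π 1 ≡ w ∷ʳ d
    eq = trans (proj₂ (Path.step π 0)) (cong (_∷ʳ d) (Path.start π))
    t : ExTerm W w (δ q (Lab w)) (r 1)
    t = subst₂ (λ v q → ExTerm W v (δ q (Lab v)) (r 1)) (Path.start π) r0 (re 0)
    same : Same q (r 1)
    same = exT-comp (form q (Lab w) refl) t
    tail-Ω : Unbounded (λ l → Ω (r (suc l)) ≡ m)
    tail-Ω l with rΩ (suc l)
    ... | suc j , s≤s le , h = j , le , h
    e′ : Ev (r 1) (w ∷ʳ d)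
    e′ = ex m (subst (λ i → ExI i m) (sym same) (form , ev , col))
      ( record { π = λ l → Path.π π (suc l) ; start = eq ; inT = λ l → Path.inT π (suc l) ; step = λ l → Path.step π (suc l) }
      , (λ l → r (suc l)) , refl , (λ l → re (suc l)) , tail-Ω )
  holds {q} {w} Tw e@(un m (form , od , col) nb) =
    unT← (choice Tw e) (low∈ Tw e) (form q (Lab w) refl) λ q′ same t d Td →
      proj₂ (choice⟺ Tw e q′ d) (un m (subst (λ i → UnI i m) (sym same) (form , od , col)) (extend q′ t d) ,
        inj₂ (same , refl , t))
    where
    extend : ∀ q′ → UnTerm W w (δ q (Lab w)) q′ → ∀ d → ¬ UnRun W m q′ (w ∷ʳ d)
    extend q′ t d (π , r , r0 , re , rΩ) = nb (cons-path K Tw d π , s , refl , se ,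
        λ l → let (j , le , h) = rΩ l in suc j , ℕₚ.m≤n⇒m≤1+n le , h)
      where
      s : ℕ → Fin k
      s zero    = q
      s (suc l) = r l
      se : ∀ l → UnTerm W (Path.π (cons-path K Tw d π) l) (δ (s l) (Lab (Path.π (cons-path K Tw d π) l))) (s (suc l))
      se zero    = subst (UnTerm W w (δ q (Lab w))) (sym r0) t
      se (suc l) = re l

  last : Config → List Config → Config
  last x []       = x
  last x (y ∷ ys) = last y ys

  Walk : Config → List Config → Set
  Walk x []       = ⊤
  Walk x (y ∷ ys) = Step x y × Walk y ys

  last-∷ʳ : ∀ x ys y → last x (ys ∷ʳ y) ≡ y
  last-∷ʳ x []       y = refl
  last-∷ʳ x (z ∷ ys) y = last-∷ʳ z ys y

  walk-∷ʳ : ∀ x ys y → Walk x (ys ∷ʳ y) ⟺ (Walk x ys × Step (last x ys) y)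
  walk-∷ʳ x []       y = (λ (s , _) → tt , s) , λ (_ , s) → s , tt
  walk-∷ʳ x (z ∷ ys) y = ×-⟺ ⟺-refl (walk-∷ʳ z ys y) ⟫ ((λ (s , w , s′) → (s , w) , s′) , λ ((s , w) , s′) → s , w , s′)

  walk-prefix : ∀ x ys zs → Walk x (ys ++ zs) → Walk x ys
  walk-prefix x []       zs _       = tt
  walk-prefix x (y ∷ ys) zs (s , w) = s , walk-prefix y ys zs w

  start : W q₀ [] → Config
  start h = config q₀ [] root (toEv root h)

  label : Config → Fin k × List D
  label x = cq x , cw x

  -- The tree of all legal walks. The same state and node may occur in several children with
  -- different evidence, which is permitted because a run prescribes only which labels occur.
  run : W q₀ [] → Run A K
  run h = record
    { R = Config ; Tr = Walk c₀ ; rootR = tt ; prefR = walk-prefix c₀ ; lab = λ x → label (last c₀ x) ; rootLab = refl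
    ; step = λ x Wx → choice (cT (last c₀ x)) (ce (last c₀ x)) , holds (cT (last c₀ x)) (ce (last c₀ x)) ,
        (λ y Wy → into x y (proj₂ (proj₁ (walk-∷ʳ c₀ x y) Wy))) , λ d q′ Td m → out x Wx d q′ Td m }
    where
    c₀ : Config
    c₀ = start h
    into : ∀ x y → Step (last c₀ x) y → Σ D λ d → Σ (Fin k) λ q′ → T (cw (last c₀ x) ∷ʳ d) ×
           q′ ∈ˢ choice (cT (last c₀ x)) (ce (last c₀ x)) d × label (last c₀ (x ∷ʳ y)) ≡ (q′ , cw (last c₀ x) ∷ʳ d)
    into x (config q _ Ty e) ((d , refl) , mv) = d , q , Ty ,
      proj₂ (choice⟺ (cT (last c₀ x)) (ce (last c₀ x)) q d) (e , mv) , cong label (last-∷ʳ c₀ x (config q _ Ty e))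
    out : ∀ x → Walk c₀ x → ∀ d q′ → T (cw (last c₀ x) ∷ʳ d) → q′ ∈ˢ choice (cT (last c₀ x)) (ce (last c₀ x)) d →
          Σ Config λ y → Walk c₀ (x ∷ʳ y) × label (last c₀ (x ∷ʳ y)) ≡ (q′ , cw (last c₀ x) ∷ʳ d)
    out x Wx d q′ Td m =
      let (e , mv) = proj₁ (choice⟺ (cT (last c₀ x)) (ce (last c₀ x)) q′ d) m
          y = config q′ (cw (last c₀ x) ∷ʳ d) Td e
      in y , proj₂ (walk-∷ʳ c₀ x y) (Wx , (d , refl) , mv) , cong label (last-∷ʳ c₀ x y)

  shift-max : ∀ i (q : ℕ → Fin k) → Max (λ l → q (l + i)) → Max q
  shift-max i q (m , ev , ub , i′ , le) = m , ev ,
    (λ l → let (j , l≤j , e) = ub l in j + i , ℕₚ.≤-trans l≤j (ℕₚ.m≤m+n j i) , e) , i′ + i ,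
    λ j ge → subst (λ j → Ω (q j) ≤ m) (ℕₚ.m∸n+n≡m (ℕₚ.≤-trans (ℕₚ.m≤n+m i i′) ge))
      (le (j ∸ i) (ℕₚ.+-cancelʳ-≤ i _ _ (subst (i′ + i ≤_) (sym (ℕₚ.m∸n+n≡m (ℕₚ.≤-trans (ℕₚ.m≤n+m i i′) ge))) ge)))

  module _ (x : ℕ → Config) (steps : ∀ l → Σ D λ d → cw (x (suc l)) ≡ cw (x l) ∷ʳ d)
           (same : ∀ l → Same (cq (x l)) (cq (x (suc l)))) (stay : ∀ l → Stay (ce (x l)) (ce (x (suc l)))) where

    comp : ∀ l → ord (cq (x l)) ≡ ord (cq (x 0))
    comp zero    = refl
    comp (suc l) = trans (same l) (comp l)

    ExWith : ∀ {q w} → ℕ → (ℕ → Fin k) → Ev q w → Set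
    ExWith m s (ex m′ _ (_ , r , _)) = m′ ≡ m × (∀ j → r j ≡ s j)
    ExWith m s _                     = ⊥

    ex-next : ∀ {q w q′ w′} (e : Ev q w) (e′ : Ev q′ w′) {m s} → Stay e e′ → ExWith m s e → ExWith m (s ∘ suc) e′
    ex-next (ex _ _ _) (ex _ _ _) (refl , eq) (refl , eq′) = refl , λ j → trans (eq j) (eq′ (suc j))

    ex-cong : ∀ {q w m s s′} (e : Ev q w) → (∀ j → s j ≡ s′ j) → ExWith m s e → ExWith m s′ e
    ex-cong (ex _ _ _) h (eq , eq′) = eq , λ j → trans (eq′ j) (h j)

    ex-state : ∀ {q w m s} (e : Ev q w) → ExWith m s e → q ≡ s 0
    ex-state (ex _ _ (_ , r , r0 , _)) (_ , eq) = trans (sym r0) (eq 0)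

    UnWith : ∀ {q w} → ℕ → Ev q w → Set
    UnWith m (un m′ _ _) = m′ ≡ m
    UnWith m _           = ⊥

    un-next : ∀ {q w q′ w′} (e : Ev q w) (e′ : Ev q′ w′) {m} → Stay e e′ → UnWith m e →
              UnWith m e′ × UnTerm W w (δ q (Lab w)) q′
    un-next (un _ _ _) (un _ _ _) (refl , t) refl = refl , t

    -- A transient component cannot be stayed in. In an existential one the states are those of the
    -- first evidence, in which `m` recurs. In a universal one the branch itself is a path of terms,
    -- so the first evidence excludes that `m` recurs, and the even colour `m ∸ 1` is eventually
    -- constant.
    stay-max : Max (λ l → cq (x l))
    stay-max = by (ce (x 0)) refl
      where
      by : (e : Ev (cq (x 0)) (cw (x 0))) → ce (x 0) ≡ e → Max (λ l → cq (x l))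
      by (tr _ _) eq = ⊥-elim (subst (λ e → Stay e (ce (x 1))) eq (stay 0))
      by (ex m (_ , ev , col) R@(_ , r , r0 , _ , rΩ)) eq = m , ev ,
          (λ l → let (j , le , h) = rΩ l in j , le , trans (cong Ω (state j)) h) ,
          0 , λ j _ → [ (λ h → subst (_≤ m) (sym h) (ℕₚ.m∸n≤m m 1)) , (λ h → ℕₚ.≤-reflexive h) ]′ (col (cq (x j)) (comp j))
        where
        with-r : ∀ l → ExWith m (λ j → r (j + l)) (ce (x l))
        with-r zero    = subst (ExWith m (λ j → r (j + 0))) (sym eq) (refl , λ j → cong r (sym (ℕₚ.+-identityʳ j)))
        with-r (suc l) = ex-cong (ce (x (suc l))) (λ j → cong r (sym (ℕₚ.+-suc j l)))
                           (ex-next (ce (x l)) (ce (x (suc l))) (stay l) (with-r l))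
        state : ∀ l → cq (x l) ≡ r l
        state l = ex-state (ce (x l)) (with-r l)
      by (un m (_ , od , col) nb) eq =
          m ∸ 1 , pred-even od , (λ l → l + j₀ , ℕₚ.m≤m+n l j₀ , colour (l + j₀) (ℕₚ.m≤n+m j₀ l)) ,
          j₀ , λ j ge → ℕₚ.≤-reflexive (colour j ge)
        where
        with-u : ∀ l → UnWith m (ce (x l))
        with-u zero    = subst (UnWith m) (sym eq) refl
        with-u (suc l) = proj₁ (un-next (ce (x l)) (ce (x (suc l))) (stay l) (with-u l))
        rare : ¬ Unbounded (λ l → Ω (cq (x l)) ≡ m)
        rare ub = nb (record { π = λ l → cw (x l) ; start = refl ; inT = λ l → cT (x l) ; step = steps } ,
          (λ l → cq (x l)) , refl , (λ l → proj₂ (un-next (ce (x l)) (ce (x (suc l))) (stay l) (with-u l))) , ub)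
        j₀ : ℕ
        j₀ = proj₁ (¬∀→∃¬ em rare)
        colour : ∀ j → j₀ ≤ j → Ω (cq (x j)) ≡ m ∸ 1
        colour j ge = [ id , (λ h → ⊥-elim (proj₂ (¬∀→∃¬ em rare) (j , ge , h))) ]′ (col (cq (x j)) (comp j))

  -- Moves never increase the rank. Hence it is eventually constant, from where on every move is a
  -- `Stay`, and the parity condition ignores the initial part.
  sequence-max : (x : ℕ → Config) → (∀ l → Step (x l) (x (suc l))) → Max (λ l → cq (x l))
  sequence-max x st-x = shift-max i _ (stay-max (λ l → x (l + i)) (λ l → proj₁ (st-x (l + i)))
      (λ l → proj₁ (stays l)) (λ l → proj₂ (stays l)))
    where
    Rk : ℕ → ℕ
    Rk l = rank (cq (x l))
    down : ∀ l → Rk (suc l) ≤ Rk l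
    down l = [ ℕₚ.<⇒≤ , (λ (e , _) → ℕₚ.≤-reflexive (cong toℕ e)) ]′ (proj₂ (st-x l))
    S = stabilise em Rk down
    i : ℕ
    i = proj₁ S
    stays : ∀ l → Same (cq (x (l + i))) (cq (x (suc l + i))) × Stay (ce (x (l + i))) (ce (x (suc l + i)))
    stays l = [ (λ lt → ⊥-elim (ℕₚ.<-irrefl (trans (proj₂ S (suc l)) (sym (proj₂ S l))) lt)) , id ]′ (proj₂ (st-x (l + i)))

  W→LHGTA : W q₀ [] → LHGTA A K
  W→LHGTA h = run h , λ β β0 βT βs → sequence-max (λ l → last c₀ (β l)) λ l →
      let (y , eq) = βs l
          (_ , s) = proj₁ (walk-∷ʳ c₀ (β l) y) (subst (Walk c₀) eq (βT (suc l)))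
      in subst (Step (last c₀ (β l))) (sym (trans (cong (last c₀) eq) (last-∷ʳ c₀ (β l) y))) s
    where
    c₀ : Config
    c₀ = start h

-- `W` is arbitrary: the order of the components makes the equivalences determine acceptance. The
-- same statement therefore serves both directions, with `W` read off the formulas of a given
-- automaton and with `W` read off a given formula.
LHGTA⟺ : (em : EM) {n : ℕ} (A : HGTA n) (K : KTree n) (W : Fin (HGTA.k A) → List (KTree.D K) → Set) →
  (∀ q w → KTree.T K w → Acceptance.CharAt em A K W q w (HGTA.hesitant A (HGTA.ord A q))) →
  LHGTA A K ⟺ W (HGTA.q₀ A) []
LHGTA⟺ em A K W char = Acceptance.Char.LHGTA→W em A K W char , BuildRun.W→LHGTA em A K W char

-- Hesitant automata into the hub logic

module FromHGTA {n : ℕ} (A : HGTA n) where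
  open HGTA A
  open Tests (YTests (Fin n)) using (ffᵍ; _∨ᵍ_)

  module _ (G : Fin k → Y (Fin n)) where

    pbY : PB k → Y (Fin n)
    pbY (atom q)   = G q
    pbY ptt        = topY
    pbY pff        = ffᵍ
    pbY (pand α β) = andY (pbY α) (pbY β)
    pbY (por α β)  = pbY α ∨ᵍ pbY β

    conY : Con k → Y (Fin n)
    conY c⊤         = topY
    conY c⊥         = ffᵍ
    conY (cor θ η)  = conY θ ∨ᵍ conY η
    conY (cand θ η) = andY (conY θ) (conY η)
    conY (◇ α)      = EX (pbY α)
    conY (□ α)      = negY (EX (negY (pbY α)))

    exY unY : Con k → Fin k → Y (Fin n)
    exY (cor θ η) q′             = exY θ q′ ∨ᵍ exY η q′
    exY (cand (◇ (atom q)) θ) q′ = if does (q Finₚ.≟ q′) then conY θ else ffᵍ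
    exY _ q′                     = ffᵍ
    unY (cand θ η) q′            = unY θ q′ ∨ᵍ unY η q′
    unY (cor (□ (atom q)) θ) q′  = if does (q Finₚ.≟ q′) then negY (conY θ) else ffᵍ
    unY _ q′                     = ffᵍ

    colour : ℕ → Fin k → Bool
    colour m p = does (Ω p ℕₚ.≟ m)

    -- The transitions of the hesitant automaton are reused for a Büchi automaton along one path: a
    -- term is a transition, its lower part (negated in the universal case) is the test, and `m` is
    -- the accepting colour.
    runY : (Con k → Fin k → Y (Fin n)) → ℕ → Fin k → Y (Fin n)
    runY t m q = EY k q (λ p p′ → caseLab λ a → t (δ p a) p′) (colour m)

    stateAt : ∀ q → Transient δ ord hE Ω (ord q) ⊎ (hE (ord q) ≡ true × Existential δ ord hE Ω (ord q)) ⊎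
              (hE (ord q) ≡ false × Universal δ ord hE Ω (ord q)) → Y (Fin n)
    stateAt q (inj₁ _)                      = caseLab λ a → conY (δ q a)
    stateAt q (inj₂ (inj₁ (_ , _ , m , _))) = runY exY m q
    stateAt q (inj₂ (inj₂ (_ , _ , m , _))) = negY (runY unY m q)

  -- The formulas of the states of order below i are final in stage i.
  stage : ℕ → Fin k → Y (Fin n)
  stage zero    q = topY
  stage (suc i) q = if does (toℕ (ord q) ℕₚ.≟ i) then stateAt (stage i) q (hesitant (ord q)) else stage i q

  formula : Fin k → Y (Fin n)
  formula = stage c

  stage-here : ∀ q → stage (suc (toℕ (ord q))) q ≡ stateAt (stage (toℕ (ord q))) q (hesitant (ord q))
  stage-here q = cong (λ b → if b then stateAt (stage i) q (hesitant (ord q)) else stage i q) (dec-true (i ℕₚ.≟ i) refl)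
    where
    i : ℕ
    i = toℕ (ord q)

  stage-final : ∀ q {i j} → toℕ (ord q) < i → i ≤′ j → stage j q ≡ stage i q
  stage-final q lt ≤′-refl = refl
  stage-final q {i} lt (≤′-step {j} le) =
    trans (cong (λ b → if b then stateAt (stage j) q (hesitant (ord q)) else stage j q)
            (dec-false (toℕ (ord q) ℕₚ.≟ j) λ e → ℕₚ.<⇒≱ lt (subst (i ≤_) (sym e) (ℕₚ.≤′⇒≤ le))))
          (stage-final q lt le)

  module Correct (em : EM) (K : KTree n) where
    open KTree K
    open ModelProps em (YModel K (Val K))
    open Semantics K
    open Acceptance em A K

    ⟦_⟧ : (Fin k → Y (Fin n)) → Fin k → List D → Set
    ⟦ G ⟧ q v = satY K (Val K) v (G q)

    module _ (G : Fin k → Y (Fin n)) where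

      pbY⟺ : ∀ α v → satY K (Val K) v (pbY G α) ⟺ pbW ⟦ G ⟧ v α
      pbY⟺ (atom q)   v = ⟺-refl
      pbY⟺ ptt        v = ⟺-refl
      pbY⟺ pff        v = (λ h → h tt) , λ ()
      pbY⟺ (pand α β) v = ×-⟺ (pbY⟺ α v) (pbY⟺ β v)
      pbY⟺ (por α β)  v = ⊨∨ v (pbY G α) (pbY G β) ⟫ ⊎-⟺ (pbY⟺ α v) (pbY⟺ β v)

      conY⟺ : ∀ θ {w} → T w → satY K (Val K) w (conY G θ) ⟺ conW ⟦ G ⟧ w θ
      conY⟺ c⊤         Tw = ⟺-refl
      conY⟺ c⊥         Tw = (λ h → h tt) , λ ()
      conY⟺ (cor θ η)  {w} Tw = ⊨∨ w (conY G θ) (conY G η) ⟫ ⊎-⟺ (conY⟺ θ Tw) (conY⟺ η Tw)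
      conY⟺ (cand θ η) Tw = ×-⟺ (conY⟺ θ Tw) (conY⟺ η Tw)
      conY⟺ (◇ α)      {w} Tw = EX⟺ em K (Val K) (pbY G α) Tw ⟫ Σ-⟺ λ d → ×-⟺ ⟺-refl (pbY⟺ α (w ∷ʳ d))
      conY⟺ (□ α)      {w} Tw = ¬-⟺ (EX⟺ em K (Val K) (negY (pbY G α)) Tw) ⟫
        ((λ h d Td → proj₁ (pbY⟺ α (w ∷ʳ d)) (¬¬-elim em λ n → h (d , Td , n))) ,
         λ h (d , Td , n) → n (proj₂ (pbY⟺ α (w ∷ʳ d)) (h d Td)))

      ⊨≟ : ∀ (q q′ : Fin k) φ w → satY K (Val K) w (if does (q Finₚ.≟ q′) then φ else ffᵍ) ⟺ (q ≡ q′ × satY K (Val K) w φ)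
      ⊨≟ q q′ φ w = ⊨if w (does (q Finₚ.≟ q′)) φ ⟫ ×-⟺ (does⟺ (q Finₚ.≟ q′)) ⟺-refl

      none : ∀ w → satY K (Val K) w ffᵍ ⟺ ⊥
      none w = (λ h → h tt) , λ ()

      exY⟺ : ∀ θ q′ {w} → T w → satY K (Val K) w (exY G θ q′) ⟺ ExTerm ⟦ G ⟧ w θ q′
      exY⟺ c⊤ q′ {w} Tw = none w
      exY⟺ c⊥ q′ {w} Tw = none w
      exY⟺ (cor θ η) q′ {w} Tw = ⊨∨ w (exY G θ q′) (exY G η q′) ⟫ ⊎-⟺ (exY⟺ θ q′ Tw) (exY⟺ η q′ Tw)
      exY⟺ (cand (◇ (atom q)) θ) q′ {w} Tw = ⊨≟ q q′ (conY G θ) w ⟫ ×-⟺ ⟺-refl (conY⟺ θ Tw)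
      exY⟺ (cand c⊤ _) q′ {w} Tw = none w
      exY⟺ (cand c⊥ _) q′ {w} Tw = none w
      exY⟺ (cand (cor _ _) _) q′ {w} Tw = none w
      exY⟺ (cand (cand _ _) _) q′ {w} Tw = none w
      exY⟺ (cand (□ _) _) q′ {w} Tw = none w
      exY⟺ (cand (◇ ptt) _) q′ {w} Tw = none w
      exY⟺ (cand (◇ pff) _) q′ {w} Tw = none w
      exY⟺ (cand (◇ (pand _ _)) _) q′ {w} Tw = none w
      exY⟺ (cand (◇ (por _ _)) _) q′ {w} Tw = none w
      exY⟺ (◇ _) q′ {w} Tw = none w
      exY⟺ (□ _) q′ {w} Tw = none w

      unY⟺ : ∀ θ q′ {w} → T w → satY K (Val K) w (unY G θ q′) ⟺ UnTerm ⟦ G ⟧ w θ q′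
      unY⟺ c⊤ q′ {w} Tw = none w
      unY⟺ c⊥ q′ {w} Tw = none w
      unY⟺ (cand θ η) q′ {w} Tw = ⊨∨ w (unY G θ q′) (unY G η q′) ⟫ ⊎-⟺ (unY⟺ θ q′ Tw) (unY⟺ η q′ Tw)
      unY⟺ (cor (□ (atom q)) θ) q′ {w} Tw = ⊨≟ q q′ (negY (conY G θ)) w ⟫ ×-⟺ ⟺-refl (¬-⟺ (conY⟺ θ Tw))
      unY⟺ (cor c⊤ _) q′ {w} Tw = none w
      unY⟺ (cor c⊥ _) q′ {w} Tw = none w
      unY⟺ (cor (cor _ _) _) q′ {w} Tw = none w
      unY⟺ (cor (cand _ _) _) q′ {w} Tw = none w
      unY⟺ (cor (◇ _) _) q′ {w} Tw = none w
      unY⟺ (cor (□ ptt) _) q′ {w} Tw = none w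
      unY⟺ (cor (□ pff) _) q′ {w} Tw = none w
      unY⟺ (cor (□ (pand _ _)) _) q′ {w} Tw = none w
      unY⟺ (cor (□ (por _ _)) _) q′ {w} Tw = none w
      unY⟺ (◇ _) q′ {w} Tw = none w
      unY⟺ (□ _) q′ {w} Tw = none w

      runY⟺ : (t : Con k → Fin k → Y (Fin n)) (Term : (Fin k → List D → Set) → List D → Con k → Fin k → Set) →
              (∀ θ q′ {w} → T w → satY K (Val K) w (t θ q′) ⟺ Term ⟦ G ⟧ w θ q′) → ∀ m q w →
              satY K (Val K) w (runY G t m q) ⟺ Σ (Path K w) λ π → Σ (ℕ → Fin k) (Runs Term ⟦ G ⟧ m q w π)
      runY⟺ t Term eq m q w = Σ-⟺ λ π → Σ-⟺ λ r → ×-⟺ ⟺-refl (×-⟺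
        (Π-⟺ λ l → caseLab⟺ em K (λ a → t (δ (r l) a) (r (suc l))) (Path.π π l) ⟫ eq _ (r (suc l)) (Path.inT π l))
        (Π-⟺ λ l → Σ-⟺ λ j → ×-⟺ ⟺-refl (does⟺ (Ω (r j) ℕₚ.≟ m))))

    stable : ∀ {i q} → toℕ (ord q) < i → i ≤ c → formula q ≡ stage i q
    stable {q = q} lt le = stage-final q lt (ℕₚ.≤⇒≤′ le)

    module _ (q : Fin k) where
      private
        i : ℕ
        i = toℕ (ord q)
        i<c : i < c
        i<c = Finₚ.toℕ<n (ord q)
        W₀ W : Fin k → List D → Set
        W₀ = ⟦ stage i ⟧
        W  = ⟦ formula ⟧

      up : ∀ {q′ v} → Below (ord q) q′ → W₀ q′ v → W q′ v
      up {q′} {v} lt = subst (satY K (Val K) v) (sym (stable lt (ℕₚ.<⇒≤ i<c)))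

      down : ∀ {q′ v} → Below (ord q) q′ → W q′ v → W₀ q′ v
      down {q′} {v} lt = subst (satY K (Val K) v) (stable lt (ℕₚ.<⇒≤ i<c))

      -- By induction along the sequence, all its states stay in the component of `q`. The lower
      -- parts of their terms then mention only states whose formulas are already final in stage
      -- `i`.
      transport : ∀ {V V′ : Fin k → List D → Set} (Term : (Fin k → List D → Set) → List D → Con k → Fin k → Set) m w →
        (∀ p v q′ → ord p ≡ ord q → Term V v (δ p (Lab v)) q′ → Term V′ v (δ p (Lab v)) q′ × ord q′ ≡ ord q) →
        (Σ (Path K w) λ π → Σ (ℕ → Fin k) (Runs Term V m q w π)) →
        Σ (Path K w) λ π → Σ (ℕ → Fin k) (Runs Term V′ m q w π)
      transport Term m w f (π , r , r0 , re , rΩ) = π , r , r0 ,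
        (λ l → proj₁ (f (r l) (Path.π π l) (r (suc l)) (comp l) (re l))) , rΩ
        where
        comp : ∀ l → ord (r l) ≡ ord q
        comp zero    = cong ord r0
        comp (suc l) = proj₂ (f (r l) (Path.π π l) (r (suc l)) (comp l) (re l))

      charAt : ∀ w → T w → ∀ x → satY K (Val K) w (stateAt (stage i) q x) ⟺ satY K (Val K) w (formula q) →
               CharAt W q w x
      charAt w Tw (inj₁ t) e = ⟺-sym e ⟫ caseLab⟺ em K (λ a → conY (stage i) (δ q a)) w ⟫ conY⟺ (stage i) (δ q (Lab w)) Tw ⟫
        (conW-mono up (t q (Lab w) refl) , conW-mono down (t q (Lab w) refl))
      charAt w Tw (inj₂ (inj₁ (_ , form , m , _))) e = ⟺-sym e ⟫ runY⟺ (stage i) (exY (stage i)) ExTerm (exY⟺ (stage i)) m q w ⟫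
        ( transport ExTerm m w (λ p v q′ s t → exT-mono up (form p (Lab v) s) t , exT-comp (form p (Lab v) s) t)
        , transport ExTerm m w (λ p v q′ s t → exT-mono down (form p (Lab v) s) t , exT-comp (form p (Lab v) s) t) )
      charAt w Tw (inj₂ (inj₂ (_ , form , m , _))) e = ⟺-sym e ⟫ ¬-⟺ (runY⟺ (stage i) (unY (stage i)) UnTerm (unY⟺ (stage i)) m q w ⟫
        ( transport UnTerm m w (λ p v q′ s t → unT-mono down (form p (Lab v) s) t , unT-comp (form p (Lab v) s) t)
        , transport UnTerm m w (λ p v q′ s t → unT-mono up (form p (Lab v) s) t , unT-comp (form p (Lab v) s) t) ))

    formula⟺ : satY K (Val K) [] (formula q₀) ⟺ LHGTA A K
    formula⟺ = ⟺-sym (LHGTA⟺ em A K ⟦ formula ⟧ λ q w Tw → charAt q w Tw (hesitant (ord q))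
      (≡→⟺ (cong (satY K (Val K) w) (sym (trans (stable (ℕₚ.n<1+n _) (Finₚ.toℕ<n (ord q))) (stage-here q))))))

-- The hub logic into hesitant automata

-- Beside `◇ q` an existential transition admits only conjunctions of low atoms, and beside `□ q` a
-- universal one only disjunctions. The constraints of the tests are therefore distributed into this
-- shape first.
dnf cnf : ∀ {N} → Con N → List (Con N)
dnf c⊤         = c⊤ ∷ []
dnf c⊥         = []
dnf (cor θ η)  = dnf θ ++ dnf η
dnf (cand θ η) = cartesianProductWith cand (dnf θ) (dnf η)
dnf (◇ α)      = ◇ α ∷ []
dnf (□ α)      = □ α ∷ []
cnf c⊤         = []
cnf c⊥         = c⊥ ∷ []
cnf (cor θ η)  = cartesianProductWith cor (cnf θ) (cnf η)
cnf (cand θ η) = cnf θ ++ cnf η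
cnf (◇ α)      = ◇ α ∷ []
cnf (□ α)      = □ α ∷ []

exSum unProd : ∀ {N} → List (Fin N × Con N) → Con N
exSum []             = c⊥
exSum ((q , θ) ∷ l)  = cor (cand (◇ (atom q)) θ) (exSum l)
unProd []            = c⊤
unProd ((q , θ) ∷ l) = cand (cor (□ (atom q)) θ) (unProd l)

exTr unTr : ∀ {N} k → (Fin k → Fin N) → (Fin k → Con N) → Con N
exTr k t g = exSum (concatMap (λ q → map (t q ,_) (dnf (g q))) (allFin k))
unTr k t g = unProd (concatMap (λ q → map (t q ,_) (cnf (g q))) (allFin k))

module _ {N : ℕ} {P : Fin N → Set} where

  dnf-low : ∀ {θ} → AllCon P θ → All (ConjLow P) (dnf θ)
  dnf-low c⊤         = c⊤ ∷ []
  dnf-low c⊥         = []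
  dnf-low (cor a b)  = Allₚ.++⁺ (dnf-low a) (dnf-low b)
  dnf-low {cand θ η} (cand a b) = Allₚ.cartesianProductWith⁺ (≡-setoid _) (≡-setoid _) cand (dnf θ) (dnf η)
    λ x∈ y∈ → cand (All.lookup (dnf-low a) x∈) (All.lookup (dnf-low b) y∈)
  dnf-low (◇ a)      = ◇ a ∷ []
  dnf-low (□ a)      = □ a ∷ []

  cnf-low : ∀ {θ} → AllCon P θ → All (DisjLow P) (cnf θ)
  cnf-low c⊤         = []
  cnf-low c⊥         = c⊥ ∷ []
  cnf-low {cor θ η} (cor a b) = Allₚ.cartesianProductWith⁺ (≡-setoid _) (≡-setoid _) cor (cnf θ) (cnf η)
    λ x∈ y∈ → cor (All.lookup (cnf-low a) x∈) (All.lookup (cnf-low b) y∈)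
  cnf-low (cand a b) = Allₚ.++⁺ (cnf-low a) (cnf-low b)
  cnf-low (◇ a)      = ◇ a ∷ []
  cnf-low (□ a)      = □ a ∷ []

  module _ {C : Fin N → Set} where

    exTr-form : ∀ k {t g} → (∀ q → C (t q)) → (∀ q → AllCon P (g q)) → ExForm C P (exTr k t g)
    exTr-form k {t} {g} cur low = sum (Allₚ.concat⁺ (Allₚ.map⁺ (All.universal
        (λ q → Allₚ.map⁺ (All.map (cur q ,_) (dnf-low (low q)))) (allFin k))))
      where
      sum : ∀ {l} → All (λ (q , θ) → C q × ConjLow P θ) l → ExForm C P (exSum l)
      sum []            = c⊥
      sum ((c , a) ∷ l) = cor (term c a) (sum l)

    unTr-form : ∀ k {t g} → (∀ q → C (t q)) → (∀ q → AllCon P (g q)) → UnForm C P (unTr k t g)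
    unTr-form k {t} {g} cur low = prod (Allₚ.concat⁺ (Allₚ.map⁺ (All.universal
        (λ q → Allₚ.map⁺ (All.map (cur q ,_) (cnf-low (low q)))) (allFin k))))
      where
      prod : ∀ {l} → All (λ (q , θ) → C q × DisjLow P θ) l → UnForm C P (unProd l)
      prod []            = c⊤
      prod ((c , a) ∷ l) = cand (term c a) (prod l)

ex→all : ∀ {N} {P Q R : Fin N → Set} → (∀ {q} → P q → R q) → (∀ {q} → Q q → R q) → ∀ {θ} → ExForm P Q θ → AllCon R θ
ex→all f g c⊥         = c⊥
ex→all f g (cor a b)  = cor (ex→all f g a) (ex→all f g b)
ex→all f g (term c l) = cand (◇ (atom (f c))) (AllCon-map g (conj→all l))

un→all : ∀ {N} {P Q R : Fin N → Set} → (∀ {q} → P q → R q) → (∀ {q} → Q q → R q) → ∀ {θ} → UnForm P Q θ → AllCon R θ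
un→all f g c⊤         = c⊤
un→all f g (cand a b) = cand (un→all f g a) (un→all f g b)
un→all f g (term c l) = cor (□ (atom (f c))) (AllCon-map g (disj→all l))

module FormSemantics (em : EM) {n : ℕ} (K : KTree n) {N : ℕ} (W : Fin N → List (KTree.D K) → Set)
                     (w : List (KTree.D K)) where
  open KTree K
  open Semantics K

  dnf⟺ : ∀ θ → conW W w θ ⟺ Any (conW W w) (dnf θ)
  dnf⟺ c⊤         = here , (λ _ → tt)
  dnf⟺ c⊥         = (λ ()) , (λ ())
  dnf⟺ (cor θ η)  = ⊎-⟺ (dnf⟺ θ) (dnf⟺ η) ⟫ ([ Anyₚ.++⁺ˡ , Anyₚ.++⁺ʳ (dnf θ) ]′ , Anyₚ.++⁻ (dnf θ))
  dnf⟺ (cand θ η) = ×-⟺ (dnf⟺ θ) (dnf⟺ η) ⟫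
    ((λ (a , b) → Anyₚ.cartesianProductWith⁺ cand _,_ a b) ,
     Anyₚ.cartesianProductWith⁻ cand id (dnf θ) (dnf η))
  dnf⟺ (◇ α)      = here , λ { (here h) → h }
  dnf⟺ (□ α)      = here , λ { (here h) → h }

  -- Stated for falsity, the form that `UnTerm` asks for: it turns the conjunction of clauses into
  -- the search for one false clause, dually to `dnf⟺`.
  cnf⟺ : ∀ θ → (¬ conW W w θ) ⟺ Any (λ η → ¬ conW W w η) (cnf θ)
  cnf⟺ c⊤         = (λ n → ⊥-elim (n tt)) , (λ ())
  cnf⟺ c⊥         = (λ n → here n) , (λ _ ())
  cnf⟺ (cor θ η)  = ((λ n → n ∘ inj₁ , n ∘ inj₂) , λ (a , b) → [ a , b ]′) ⟫ ×-⟺ (cnf⟺ θ) (cnf⟺ η) ⟫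
    ((λ (a , b) → Anyₚ.cartesianProductWith⁺ cor (λ a b → [ a , b ]′) a b) ,
     Anyₚ.cartesianProductWith⁻ cor (λ n → n ∘ inj₁ , n ∘ inj₂) (cnf θ) (cnf η))
  cnf⟺ (cand θ η) = ¬×⟺ em ⟫ ⊎-⟺ (cnf⟺ θ) (cnf⟺ η) ⟫
    ([ Anyₚ.++⁺ˡ , Anyₚ.++⁺ʳ (cnf θ) ]′ , Anyₚ.++⁻ (cnf θ))
  cnf⟺ (◇ α)      = (λ n → here n) , λ { (here n) → n }
  cnf⟺ (□ α)      = (λ n → here n) , λ { (here n) → n }

  module _ (k : ℕ) (t : Fin k → Fin N) (g : Fin k → Con N) where

    any-pairs : (f : Con N → List (Con N)) {Q : Fin N → Con N → Set} →
                Any (λ (q , θ) → Q q θ) (concatMap (λ q → map (t q ,_) (f (g q))) (allFin k)) ⟺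
                Σ (Fin k) λ q → Any (Q (t q)) (f (g q))
    any-pairs f = (λ h → let (q , m) = Any.satisfied (Anyₚ.concatMap⁻ (λ q → map (t q ,_) (f (g q))) {xs = allFin k} h) in q , Anyₚ.map⁻ m) ,
      λ (q , h) → Anyₚ.concatMap⁺ (λ q → map (t q ,_) (f (g q))) (lose (∈-allFin q) (Anyₚ.map⁺ h))

    exTerm⟺ : ∀ q′ → ExTerm W w (exTr k t g) q′ ⟺ Σ (Fin k) λ q → t q ≡ q′ × conW W w (g q)
    exTerm⟺ q′ = sum _ ⟫ any-pairs dnf ⟫ Σ-⟺ λ q → (pull , push) ⟫ ×-⟺ ⟺-refl (⟺-sym (dnf⟺ (g q)))
      where
      sum : ∀ l → ExTerm W w (exSum l) q′ ⟺ Any (λ (q , θ) → q ≡ q′ × conW W w θ) l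
      sum []      = (λ ()) , (λ ())
      sum (_ ∷ l) = ⊎-⟺ ⟺-refl (sum l) ⟫ ([ here , there ]′ , λ { (here h) → inj₁ h ; (there h) → inj₂ h })
      pull : ∀ {A : Set} {l} → Any (λ θ → A × conW W w θ) l → A × Any (conW W w) l
      pull (here (a , h)) = a , here h
      pull (there m)      = let (a , h) = pull m in a , there h
      push : ∀ {A : Set} {l} → A × Any (conW W w) l → Any (λ θ → A × conW W w θ) l
      push (a , h) = Any.map (a ,_) h

    unTerm⟺ : ∀ q′ → UnTerm W w (unTr k t g) q′ ⟺ Σ (Fin k) λ q → t q ≡ q′ × ¬ conW W w (g q)
    unTerm⟺ q′ = prod _ ⟫ any-pairs cnf ⟫ Σ-⟺ λ q → (pull , push) ⟫ ×-⟺ ⟺-refl (⟺-sym (cnf⟺ (g q)))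
      where
      prod : ∀ l → UnTerm W w (unProd l) q′ ⟺ Any (λ (q , θ) → q ≡ q′ × ¬ conW W w θ) l
      prod []      = (λ ()) , (λ ())
      prod (_ ∷ l) = ⊎-⟺ ⟺-refl (prod l) ⟫ ([ here , there ]′ , λ { (here h) → inj₁ h ; (there h) → inj₂ h })
      pull : ∀ {A : Set} {l} → Any (λ θ → A × ¬ conW W w θ) l → A × Any (λ θ → ¬ conW W w θ) l
      pull (here (a , h)) = a , here h
      pull (there m)      = let (a , h) = pull m in a , there h
      push : ∀ {A : Set} {l} → A × Any (λ θ → ¬ conW W w θ) l → Any (λ θ → A × ¬ conW W w θ) l
      push (a , h) = Any.map (a ,_) h

    exCon⟺ : conW W w (exTr k t g) ⟺
             Σ (Fin k) λ q → conW W w (g q) × Σ D λ d → T (w ∷ʳ d) × W (t q) (w ∷ʳ d)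
    exCon⟺ = sum _ ⟫ any-pairs dnf ⟫ Σ-⟺ λ q → (pull , push) ⟫ ×-⟺ (⟺-sym (dnf⟺ (g q))) ⟺-refl
      where
      sum : ∀ l → conW W w (exSum l) ⟺ Any (λ (q , θ) → (Σ D λ d → T (w ∷ʳ d) × W q (w ∷ʳ d)) × conW W w θ) l
      sum []      = (λ ()) , (λ ())
      sum (_ ∷ l) = ⊎-⟺ ⟺-refl (sum l) ⟫ ([ here , there ]′ , λ { (here h) → inj₁ h ; (there h) → inj₂ h })
      pull : ∀ {A : Set} {l} → Any (λ θ → A × conW W w θ) l → Any (conW W w) l × A
      pull (here (a , h)) = here h , a
      pull (there m)      = let (h , a) = pull m in there h , a
      push : ∀ {A : Set} {l} → Any (conW W w) l × A → Any (λ θ → A × conW W w θ) l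
      push (h , a) = Any.map (a ,_) h

    unCon⟺ : (¬ conW W w (unTr k t g)) ⟺
             Σ (Fin k) λ q → (¬ conW W w (g q)) × Σ D λ d → T (w ∷ʳ d) × ¬ W (t q) (w ∷ʳ d)
    unCon⟺ = prod _ ⟫ any-pairs cnf ⟫ Σ-⟺ λ q → (pull , push) ⟫ ×-⟺ (⟺-sym (cnf⟺ (g q))) ⟺-refl
      where
      Fails : Fin N → Set
      Fails q = Σ D λ d → T (w ∷ʳ d) × ¬ W q (w ∷ʳ d)
      box : ∀ q θ → (¬ conW W w (cor (□ (atom q)) θ)) ⟺ (Fails q × ¬ conW W w θ)
      box q θ = (λ n → ¬¬-elim em (λ nf → n (inj₁ λ d Td → ¬¬-elim em λ nw → nf (d , Td , nw))) , n ∘ inj₂) ,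
                λ ((d , Td , nw) , nt) → [ (λ h → nw (h d Td)) , nt ]′
      prod : ∀ l → (¬ conW W w (unProd l)) ⟺ Any (λ (q , θ) → Fails q × ¬ conW W w θ) l
      prod []            = (λ n → ⊥-elim (n tt)) , (λ ())
      prod ((q , θ) ∷ l) = ¬×⟺ em ⟫ ⊎-⟺ (box q θ) (prod l) ⟫
          ([ here , there ]′ , λ { (here h) → inj₁ h ; (there h) → inj₂ h })
      pull : ∀ {A : Set} {l} → Any (λ θ → A × ¬ conW W w θ) l → Any (λ θ → ¬ conW W w θ) l × A
      pull (here (a , h)) = here h , a
      pull (there m)      = let (h , a) = pull m in there h , a
      push : ∀ {A : Set} {l} → Any (λ θ → ¬ conW W w θ) l × A → Any (λ θ → A × ¬ conW W w θ) l
      push (h , a) = Any.map (a ,_) h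

-- A position is an occurrence of `EY` together with a state of its automaton. With a sign added,
-- the positions are the proper states of the hesitant automaton.
Pos : ∀ {P} → Y P → Set
Pos topY         = ⊥
Pos (propY p)    = ⊥
Pos (negY φ)     = Pos φ
Pos (andY φ ψ)   = Pos φ ⊎ Pos ψ
Pos (EY k i δ F) = Fin k ⊎ Σ (Fin k × Fin k) λ (p , q) → Pos (δ p q)

finPos : ∀ {P} (φ : Y P) → Finite (Pos φ)
finPos topY         = finite [] λ ()
finPos (propY p)    = finite [] λ ()
finPos (negY φ)     = finPos φ
finPos (andY φ ψ)   = fin⊎ (finPos φ) (finPos ψ)
finPos (EY k i δ F) = fin⊎ (finFin k) (finΣ (fin× (finFin k) (finFin k)) λ (p , q) → finPos (δ p q))

ht : ∀ {P} → Y P → ℕ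
ht topY         = 0
ht (propY p)    = 0
ht (negY φ)     = ht φ
ht (andY φ ψ)   = ht φ ⊔ⁿ ht ψ
ht (EY k i δ F) = suc (sup λ p → sup λ q → ht (δ p q))

height : ∀ {P} (φ : Y P) → Pos φ → ℕ
height (negY φ)     x                    = height φ x
height (andY φ ψ)   (inj₁ x)             = height φ x
height (andY φ ψ)   (inj₂ x)             = height ψ x
height (EY k i δ F) (inj₁ _)             = sup λ p → sup λ q → ht (δ p q)
height (EY k i δ F) (inj₂ ((p , q) , x)) = height (δ p q) x

ht≤sup : ∀ {P k} (δ : Fin k → Fin k → Y P) p q → ht (δ p q) ≤ sup λ p → sup λ q → ht (δ p q)
ht≤sup δ p q = ℕₚ.≤-trans (≤sup (λ q → ht (δ p q)) q) (≤sup (λ p → sup λ q → ht (δ p q)) p)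

height< : ∀ {P} (φ : Y P) x → height φ x < ht φ
height< (negY φ)     x                    = height< φ x
height< (andY φ ψ)   (inj₁ x)             = ℕₚ.≤-trans (height< φ x) (ℕₚ.m≤m⊔n _ _)
height< (andY φ ψ)   (inj₂ x)             = ℕₚ.≤-trans (height< ψ x) (ℕₚ.m≤n⊔m (ht φ) _)
height< (EY k i δ F) (inj₁ _)             = ℕₚ.≤-refl
height< (EY k i δ F) (inj₂ ((p , q) , x)) = ℕₚ.m≤n⇒m≤1+n (ℕₚ.≤-trans (height< (δ p q) x) (ht≤sup δ p q))

formulaAt : ∀ {P} (φ : Y P) → Pos φ → Y P
formulaAt (negY φ)     x                    = formulaAt φ x
formulaAt (andY φ ψ)   (inj₁ x)             = formulaAt φ x
formulaAt (andY φ ψ)   (inj₂ x)             = formulaAt ψ x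
formulaAt (EY k i δ F) (inj₁ p)             = EY k p δ F
formulaAt (EY k i δ F) (inj₂ ((p , q) , x)) = formulaAt (δ p q) x

finalAt : ∀ {P} (φ : Y P) → Pos φ → Bool
finalAt (negY φ)     x                    = finalAt φ x
finalAt (andY φ ψ)   (inj₁ x)             = finalAt φ x
finalAt (andY φ ψ)   (inj₂ x)             = finalAt ψ x
finalAt (EY k i δ F) (inj₁ p)             = F p
finalAt (EY k i δ F) (inj₂ ((p , q) , x)) = finalAt (δ p q) x

-- The number of the component formed by all states of a given height and sign.
num : ℕ → Bool → ℕ
num h true  = h + h
num h false = suc (h + h)

Signed : Bool → Set → Set
Signed true  X = X
Signed false X = ¬ X

-- The state e x true (resp. false) stands for the formula at position x (resp. its negation).
module Constraints {n N : ℕ} where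

  -- Boolean connectives and tests are evaluated at the current node and hence unfolded at once;
  -- only `EY` sends states to children, by the one-step unfolding of `E-unfold` and its dual. The
  -- negation of a formula is pushed down to the sign of the states.
  con : (φ : Y (Fin n)) → (Pos φ → Bool → Fin N) → Bool → Subset n → Con N
  con topY         e true  a = c⊤
  con topY         e false a = c⊥
  con (propY p)    e s     a = if does (vlookup a p ≟ᵇ s) then c⊤ else c⊥
  con (negY φ)     e s     a = con φ e (not s) a
  con (andY φ ψ)   e true  a = cand (con φ (e ∘ inj₁) true a) (con ψ (e ∘ inj₂) true a)
  con (andY φ ψ)   e false a = cor (con φ (e ∘ inj₁) false a) (con ψ (e ∘ inj₂) false a)
  con (EY k i δ F) e true  a = exTr k (λ q → e (inj₁ q) true) λ q → con (δ i q) (λ x → e (inj₂ ((i , q) , x))) true a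
  con (EY k i δ F) e false a = unTr k (λ q → e (inj₁ q) false) λ q → con (δ i q) (λ x → e (inj₂ ((i , q) , x))) false a

  transitions : (φ : Y (Fin n)) → (Pos φ → Bool → Fin N) → Pos φ → Bool → Subset n → Con N
  transitions (negY φ)     e x s a = transitions φ e x s a
  transitions (andY φ ψ)   e (inj₁ x) s a = transitions φ (e ∘ inj₁) x s a
  transitions (andY φ ψ)   e (inj₂ x) s a = transitions ψ (e ∘ inj₂) x s a
  transitions (EY k i δ F) e (inj₁ p) true a =
    exTr k (λ q → e (inj₁ q) true) λ q → con (δ p q) (λ x → e (inj₂ ((p , q) , x))) true a
  transitions (EY k i δ F) e (inj₁ p) false a =
    unTr k (λ q → e (inj₁ q) false) λ q → con (δ p q) (λ x → e (inj₂ ((p , q) , x))) false a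
  transitions (EY k i δ F) e (inj₂ ((p , q) , x)) s a = transitions (δ p q) (λ x → e (inj₂ ((p , q) , x))) x s a

  module _ (rk : Fin N → ℕ) where

    Ranked : (φ : Y (Fin n)) → (Pos φ → Bool → Fin N) → Set
    Ranked φ e = ∀ x s → rk (e x s) ≡ num (height φ x) s

    -- Unfolding `φ` reaches positions of height below `ht φ` only, and even the negative ones among
    -- them have numbers at most `2 * ht φ - 1`. This is what allows both signs of a height to use
    -- tests of either sign.
    con-low : ∀ φ e → Ranked φ e → ∀ s a → AllCon (λ q → rk q < ht φ + ht φ) (con φ e s a)
    con-low topY         e he true  a = c⊤
    con-low topY         e he false a = c⊥
    con-low (propY p)    e he s     a with does (vlookup a p ≟ᵇ s)
    ... | true  = c⊤
    ... | false = c⊥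
    con-low (negY φ)     e he s     a = con-low φ e he (not s) a
    con-low (andY φ ψ)   e he true  a = cand (AllCon-map (λ lt → ℕₚ.≤-trans lt (ℕₚ.+-mono-≤ l l)) (con-low φ _ (he ∘ inj₁) true a))
                                             (AllCon-map (λ lt → ℕₚ.≤-trans lt (ℕₚ.+-mono-≤ r r)) (con-low ψ _ (he ∘ inj₂) true a))
      where l = ℕₚ.m≤m⊔n (ht φ) (ht ψ)
            r = ℕₚ.m≤n⊔m (ht φ) (ht ψ)
    con-low (andY φ ψ)   e he false a = cor (AllCon-map (λ lt → ℕₚ.≤-trans lt (ℕₚ.+-mono-≤ l l)) (con-low φ _ (he ∘ inj₁) false a))
                                            (AllCon-map (λ lt → ℕₚ.≤-trans lt (ℕₚ.+-mono-≤ r r)) (con-low ψ _ (he ∘ inj₂) false a))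
      where l = ℕₚ.m≤m⊔n (ht φ) (ht ψ)
            r = ℕₚ.m≤n⊔m (ht φ) (ht ψ)
    con-low (EY k i δ F) e he true  a = ex→all id (λ lt → ℕₚ.≤-trans lt (ℕₚ.+-mono-≤ (ℕₚ.n≤1+n S) (ℕₚ.n≤1+n S)))
        (exTr-form k (λ q → subst (_< suc S + suc S) (sym (he (inj₁ q) true)) (ℕₚ.+-mono-< (ℕₚ.n<1+n S) (ℕₚ.n<1+n S)))
          λ q → AllCon-map (λ lt → ℕₚ.≤-trans lt (ℕₚ.+-mono-≤ (ht≤sup δ i q) (ht≤sup δ i q)))
                  (con-low (δ i q) _ (λ x → he (inj₂ ((i , q) , x))) true a))
      where S = sup λ p → sup λ q → ht (δ p q)
    con-low (EY k i δ F) e he false a = un→all id (λ lt → ℕₚ.≤-trans lt (ℕₚ.+-mono-≤ (ℕₚ.n≤1+n S) (ℕₚ.n≤1+n S)))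
        (unTr-form k (λ q → subst (_< suc S + suc S) (sym (he (inj₁ q) false))
                              (s≤s (ℕₚ.≤-reflexive (sym (ℕₚ.+-suc S S)))))
          λ q → AllCon-map (λ lt → ℕₚ.≤-trans lt (ℕₚ.+-mono-≤ (ht≤sup δ i q) (ht≤sup δ i q)))
                  (con-low (δ i q) _ (λ x → he (inj₂ ((i , q) , x))) false a))
      where S = sup λ p → sup λ q → ht (δ p q)

    module _ {C P : Fin N → Set} where

      transitions-ex : ∀ φ e → Ranked φ e → ∀ x a → (∀ {q} → rk q ≡ num (height φ x) true → C q) →
                       (∀ {q} → rk q < num (height φ x) true → P q) → ExForm C P (transitions φ e x true a)
      transitions-ex (negY φ)     e he x a cur low = transitions-ex φ e he x a cur low
      transitions-ex (andY φ ψ)   e he (inj₁ x) a cur low = transitions-ex φ _ (he ∘ inj₁) x a cur low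
      transitions-ex (andY φ ψ)   e he (inj₂ x) a cur low = transitions-ex ψ _ (he ∘ inj₂) x a cur low
      transitions-ex (EY k i δ F) e he (inj₁ p) a cur low = exTr-form k (λ q → cur (he (inj₁ q) true)) λ q →
        AllCon-map (λ lt → low (ℕₚ.≤-trans lt (ℕₚ.+-mono-≤ (ht≤sup δ p q) (ht≤sup δ p q))))
          (con-low (δ p q) _ (λ x → he (inj₂ ((p , q) , x))) true a)
      transitions-ex (EY k i δ F) e he (inj₂ ((p , q) , x)) a cur low =
        transitions-ex (δ p q) _ (λ x → he (inj₂ ((p , q) , x))) x a cur low

      transitions-un : ∀ φ e → Ranked φ e → ∀ x a → (∀ {q} → rk q ≡ num (height φ x) false → C q) →
                       (∀ {q} → rk q < num (height φ x) false → P q) → UnForm C P (transitions φ e x false a)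
      transitions-un (negY φ)     e he x a cur low = transitions-un φ e he x a cur low
      transitions-un (andY φ ψ)   e he (inj₁ x) a cur low = transitions-un φ _ (he ∘ inj₁) x a cur low
      transitions-un (andY φ ψ)   e he (inj₂ x) a cur low = transitions-un ψ _ (he ∘ inj₂) x a cur low
      transitions-un (EY k i δ F) e he (inj₁ p) a cur low = unTr-form k (λ q → cur (he (inj₁ q) false)) λ q →
        AllCon-map (λ lt → low (ℕₚ.m≤n⇒m≤1+n (ℕₚ.≤-trans lt (ℕₚ.+-mono-≤ (ht≤sup δ p q) (ht≤sup δ p q)))))
          (con-low (δ p q) _ (λ x → he (inj₂ ((p , q) , x))) false a)
      transitions-un (EY k i δ F) e he (inj₂ ((p , q) , x)) a cur low =
        transitions-un (δ p q) _ (λ x → he (inj₂ ((p , q) , x))) x a cur low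

  module _ (em : EM) (K : KTree n) (W : Fin N → List (KTree.D K) → Set) where
    open KTree K
    open Semantics K

    Denotes : (φ : Y (Fin n)) → (Pos φ → Bool → Fin N) → Set
    Denotes φ e = ∀ x s v → T v → W (e x s) v ⟺ Signed s (satY K (Val K) v (formulaAt φ x))

    ¬¬⟺ : {X : Set} → X ⟺ (¬ ¬ X)
    ¬¬⟺ = (λ x n → n x) , ¬¬-elim em

    con⟺ : ∀ φ e → Denotes φ e → ∀ s {w} → T w → conW W w (con φ e s (Lab w)) ⟺ Signed s (satY K (Val K) w φ)
    con⟺ topY         e hW true  Tw = ⟺-refl
    con⟺ topY         e hW false Tw = (λ ()) , λ n → n tt
    con⟺ (propY p)    e hW s {w} Tw = bit (vlookup (Lab w) p) s refl
      where
      bit : ∀ b s → vlookup (Lab w) p ≡ b → conW W w (if does (b ≟ᵇ s) then c⊤ else c⊥) ⟺ Signed s (p ∈ˢ Lab w)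
      bit true  true  eq = (λ _ → proj₂ (∈ˢ⟺ p (Lab w)) eq) , λ _ → tt
      bit true  false eq = (λ ()) , λ n → n (proj₂ (∈ˢ⟺ p (Lab w)) eq)
      bit false true  eq = (λ ()) , λ h → ⊥-elim (true≢false (trans (sym (proj₁ (∈ˢ⟺ p (Lab w)) h)) eq))
      bit false false eq = (λ _ h → true≢false (trans (sym (proj₁ (∈ˢ⟺ p (Lab w)) h)) eq)) , λ _ → tt
    con⟺ (negY φ)     e hW true  Tw = con⟺ φ e hW false Tw
    con⟺ (negY φ)     e hW false Tw = con⟺ φ e hW true Tw ⟫ ¬¬⟺
    con⟺ (andY φ ψ)   e hW true  Tw = ×-⟺ (con⟺ φ _ (hW ∘ inj₁) true Tw) (con⟺ ψ _ (hW ∘ inj₂) true Tw)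
    con⟺ (andY φ ψ)   e hW false {w} Tw = ⊎-⟺ (con⟺ φ _ (hW ∘ inj₁) false Tw) (con⟺ ψ _ (hW ∘ inj₂) false Tw) ⟫
      ⟺-sym (¬×⟺ em)
    con⟺ (EY k i δ F) e hW true  {w} Tw = FormSemantics.exCon⟺ em K W w k _ _ ⟫
      (Σ-⟺ λ q → ×-⟺ (con⟺ (δ i q) _ (λ x → hW (inj₂ ((i , q) , x))) true Tw)
        (Σ-⟺ λ d → (λ (Td , h) → Td , proj₁ (hW (inj₁ q) true _ Td) h) , λ (Td , h) → Td , proj₂ (hW (inj₁ q) true _ Td) h)) ⟫
      ⟺-sym (E-unfold K (Val K) i δ F Tw)
    con⟺ (EY k i δ F) e hW false {w} Tw = ¬¬⟺ ⟫ ¬-⟺ (FormSemantics.unCon⟺ em K W w k _ _ ⟫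
      (Σ-⟺ λ q → ×-⟺ (¬-⟺ (con⟺ (δ i q) _ (λ x → hW (inj₂ ((i , q) , x))) false Tw) ⟫ ⟺-sym ¬¬⟺)
        (Σ-⟺ λ d → (λ (Td , h) → Td , ¬¬-elim em λ n → h (proj₂ (hW (inj₁ q) false _ Td) n)) ,
                   λ (Td , h) → Td , λ h′ → proj₁ (hW (inj₁ q) false _ Td) h′ h)) ⟫
      ⟺-sym (E-unfold K (Val K) i δ F Tw))

  module _ (em : EM) (K : KTree n) (δA : Fin N → Subset n → Con N) (ΩA : Fin N → ℕ)
           (W : Fin N → List (KTree.D K) → Set) where
    open KTree K
    open Semantics K

    StateRun : ((Fin N → List D → Set) → List D → Con N → Fin N → Set) → ℕ → Fin N → List D → Set
    StateRun Term m q w = Σ (Path K w) λ π → Σ (ℕ → Fin N) λ r → r 0 ≡ q ×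
      (∀ l → Term W (Path.π π l) (δA (r l) (Lab (Path.π π l))) (r (suc l))) × Unbounded (λ l → ΩA (r l) ≡ m)

    -- By the assumption `hδ` on terms, a sequence starting in `t p` never leaves the image of `t`;
    -- it is read back state by state, with the truth of each lower part being that of the
    -- corresponding test.
    own-run : ∀ {k} (δ : Fin k → Fin k → Y (Fin n)) F (t : Fin k → Fin N) Term m →
      (∀ q → ΩA (t q) ≡ m ⟺ F q ≡ true) →
      (∀ p {w} q′ → T w → Term W w (δA (t p) (Lab w)) q′ ⟺ Σ (Fin k) λ q → t q ≡ q′ × satY K (Val K) w (δ p q)) →
      ∀ p w → satY K (Val K) w (EY k p δ F) ⟺ StateRun Term m (t p) w
    own-run {k} δ F t Term m hΩ hδ p w = to , from
      where
      to : satY K (Val K) w (EY k p δ F) → StateRun Term m (t p) w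
      to (π , q , q0 , qe , qF) = π , t ∘ q , cong t q0 ,
        (λ l → proj₂ (hδ (q l) (t (q (suc l))) (Path.inT π l)) (q (suc l) , refl , qe l)) ,
        λ l → let (j , le , h) = qF l in j , le , proj₂ (hΩ (q j)) h
      from : StateRun Term m (t p) w → satY K (Val K) w (EY k p δ F)
      from (π , r , r0 , re , rΩ) = π , (λ l → proj₁ (at l)) , refl , (λ l → proj₂ (nx l (at l))) ,
          λ l → let (j , le , h) = rΩ l in j , le , proj₁ (hΩ (proj₁ (at j))) (trans (cong ΩA (sym (proj₂ (at j)))) h)
        where
        At : ℕ → Set
        At l = Σ (Fin k) λ q → r l ≡ t q
        nx : ∀ l (x : At l) → Σ (At (suc l)) λ y → satY K (Val K) (Path.π π l) (δ (proj₁ x) (proj₁ y))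
        nx l (q , eq) =
          let (q′ , e , h) = proj₁ (hδ q (r (suc l)) (Path.inT π l))
                               (subst (λ x → Term W (Path.π π l) (δA x (Lab (Path.π π l))) (r (suc l))) eq (re l))
          in (q′ , sym e) , h
        at : ∀ l → At l
        at = iterate (p , r0) λ l x → proj₁ (nx l x)

    runs⟺ : ∀ φ e → Denotes em K W φ e → (∀ x s a → δA (e x s) a ≡ transitions φ e x s a) →
            (∀ x → (ΩA (e x true) ≡ 2 ⟺ finalAt φ x ≡ true) × (ΩA (e x false) ≡ 1 ⟺ finalAt φ x ≡ true)) → ∀ x w →
            (satY K (Val K) w (formulaAt φ x) ⟺ StateRun ExTerm 2 (e x true) w) ×
            (satY K (Val K) w (formulaAt φ x) ⟺ StateRun UnTerm 1 (e x false) w)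
    runs⟺ (negY φ)     e hW hδ hΩ x w = runs⟺ φ e hW hδ hΩ x w
    runs⟺ (andY φ ψ)   e hW hδ hΩ (inj₁ x) w = runs⟺ φ _ (hW ∘ inj₁) (hδ ∘ inj₁) (hΩ ∘ inj₁) x w
    runs⟺ (andY φ ψ)   e hW hδ hΩ (inj₂ x) w = runs⟺ ψ _ (hW ∘ inj₂) (hδ ∘ inj₂) (hΩ ∘ inj₂) x w
    runs⟺ (EY k i δ F) e hW hδ hΩ (inj₂ ((p , q) , x)) w =
      runs⟺ (δ p q) _ (λ x → hW (inj₂ ((p , q) , x))) (λ x → hδ (inj₂ ((p , q) , x))) (λ x → hΩ (inj₂ ((p , q) , x))) x w
    runs⟺ (EY k i δ F) e hW hδ hΩ (inj₁ p) w =
      own-run δ F (λ q → e (inj₁ q) true) ExTerm 2 (λ q → proj₁ (hΩ (inj₁ q))) (λ p {w} q′ Tw →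
        ≡→⟺ (cong (λ θ → ExTerm W w θ q′) (hδ (inj₁ p) true (Lab w))) ⟫
        FormSemantics.exTerm⟺ em K W w k _ _ q′ ⟫ Σ-⟺ λ q → ×-⟺ ⟺-refl
          (con⟺ em K W (δ p q) _ (λ x → hW (inj₂ ((p , q) , x))) true Tw)) p w ,
      own-run δ F (λ q → e (inj₁ q) false) UnTerm 1 (λ q → proj₂ (hΩ (inj₁ q))) (λ p {w} q′ Tw →
        ≡→⟺ (cong (λ θ → UnTerm W w θ q′) (hδ (inj₁ p) false (Lab w))) ⟫
        FormSemantics.unTerm⟺ em K W w k _ _ q′ ⟫ Σ-⟺ λ q → ×-⟺ ⟺-refl
          (¬-⟺ (con⟺ em K W (δ p q) _ (λ x → hW (inj₂ ((p , q) , x))) false Tw) ⟫ ⟺-sym (¬¬⟺ em K W))) p w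

even? : ℕ → Bool
even? zero    = true
even? (suc m) = not (even? m)

even?-double : ∀ h → even? (h + h) ≡ true
even?-double zero    = refl
even?-double (suc h) = trans (cong (not ∘ even?) (ℕₚ.+-suc h h)) (trans (not-involutive (even? (h + h))) (even?-double h))

-- Component 2h + s collects the states of height h and sign s, the last component is that of the
-- initial state.  A dummy state in every component makes all of them nonempty.
module ToHGTA {n : ℕ} (φ : Y (Fin n)) where
  H c N : ℕ
  H = ht φ
  c = suc (H + H)

  State : Set
  State = Fin c ⊎ Maybe (Pos φ × Bool)

  finState : Finite State
  finState = fin⊎ (finFin c) (finMaybe (fin× (finPos φ) finBool))

  N = size finState

  open Constraints {n} {N}

  abstract
    code : State → Fin N
    code = enc finState

    -- Indices that are not codes are interpreted as the dummy state of component 0. This makes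
    -- `code-view` available: every other state has exactly one index.
    view : Fin N → State
    view q = if does (code (dec finState q) Finₚ.≟ q) then dec finState q else inj₁ zero

    view-code : ∀ y → view (code y) ≡ y
    view-code y = trans (cong (λ b → if b then dec finState (code y) else inj₁ zero)
      (dec-true (code (dec finState (code y)) Finₚ.≟ code y) (cong code (dec-enc finState y)))) (dec-enc finState y)

    code-view : ∀ q {y} → view q ≡ inj₂ y → q ≡ code (inj₂ y)
    code-view q eq with code (dec finState q) Finₚ.≟ q
    ... | yes e = trans (sym e) (cong code eq)

  e : Pos φ → Bool → Fin N
  e x s = code (inj₂ (just (x , s)))

  num<c : ∀ x s → num (height φ x) s < H + H
  num<c x s = ℕₚ.≤-trans (s≤s (num≤ (height φ x) s)) (ℕₚ.≤-trans
    (s≤s (ℕₚ.≤-reflexive (sym (ℕₚ.+-suc (height φ x) (height φ x))))) (ℕₚ.+-mono-≤ (height< φ x) (height< φ x)))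
    where
    num≤ : ∀ h s → num h s ≤ suc (h + h)
    num≤ h true  = ℕₚ.n≤1+n _
    num≤ h false = ℕₚ.≤-refl

  ordS : State → Fin c
  ordS (inj₁ j)              = j
  ordS (inj₂ nothing)        = fromℕ (H + H)
  ordS (inj₂ (just (x , s))) = fromℕ< (ℕₚ.m≤n⇒m≤1+n (num<c x s))

  -- A dummy has the empty disjunction in an existential component and the empty conjunction in a
  -- universal one, the trivial transitions of the respective shape. The last component is transient
  -- and admits either.
  δS : State → Subset n → Con N
  δS (inj₁ j)              a = if even? (toℕ j) then c⊥ else c⊤
  δS (inj₂ nothing)        a = con φ e true a
  δS (inj₂ (just (x , s))) a = transitions φ e x s a

  -- Existential components use the colours 1 and 2, with 2 for accepting states, so recurrence is
  -- accepting. Universal components use 0 and 1, with 1 for accepting states: a run of the negated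
  -- automaton that visits them infinitely often is a violation.
  ΩS : State → ℕ
  ΩS (inj₁ j)                  = if even? (toℕ j) then 2 else 0
  ΩS (inj₂ nothing)            = 0
  ΩS (inj₂ (just (x , true)))  = if finalAt φ x then 2 else 1
  ΩS (inj₂ (just (x , false))) = if finalAt φ x then 1 else 0

  δ : Fin N → Subset n → Con N
  δ q = δS (view q)

  ord : Fin N → Fin c
  ord q = ordS (view q)

  Ω : Fin N → ℕ
  Ω q = ΩS (view q)

  hE : Fin c → Bool
  hE i = even? (toℕ i)

  ord-root : toℕ (ordS (inj₂ nothing)) ≡ H + H
  ord-root = Finₚ.toℕ-fromℕ (H + H)

  ord-just : ∀ x s → toℕ (ordS (inj₂ (just (x , s)))) ≡ num (height φ x) s
  ord-just x s = Finₚ.toℕ-fromℕ< (ℕₚ.m≤n⇒m≤1+n (num<c x s))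

  ranked : Ranked (λ q → toℕ (ord q)) φ e
  ranked x s = trans (cong (toℕ ∘ ordS) (view-code (inj₂ (just (x , s))))) (ord-just x s)

  even-sign : ∀ h s → even? (num h s) ≡ s
  even-sign h true  = even?-double h
  even-sign h false = cong not (even?-double h)

  sign : ∀ x s {i b} → ordS (inj₂ (just (x , s))) ≡ i → even? (toℕ i) ≡ b → s ≡ b
  sign x s refl eb = trans (sym (even-sign (height φ x) s)) (trans (cong even? (sym (ord-just x s))) eb)

  not-root : ∀ {i} → toℕ i ≢ H + H → ordS (inj₂ nothing) ≢ i
  not-root n refl = n ord-root

  Below : Fin c → Fin N → Set
  Below i q = toℕ (ord q) < toℕ i

  trForm : ∀ i → toℕ i ≡ H + H → ∀ y a → ordS y ≡ i → AllCon (Below i) (δS y a)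
  trForm i eq (inj₁ j) a _ with even? (toℕ j)
  ... | true  = c⊥
  ... | false = c⊤
  trForm i eq (inj₂ nothing) a _ =
    AllCon-map (λ lt → ℕₚ.<-≤-trans lt (ℕₚ.≤-reflexive (sym eq))) (con-low (λ q → toℕ (ord q)) φ e ranked true a)
  trForm i eq (inj₂ (just (x , s))) a refl =
    ⊥-elim (ℕₚ.<-irrefl (trans (sym (ord-just x s)) eq) (num<c x s))

  exForm : ∀ i → toℕ i ≢ H + H → even? (toℕ i) ≡ true → ∀ y a → ordS y ≡ i →
           ExForm (λ q → ord q ≡ i) (Below i) (δS y a)
  exForm i ne ev (inj₁ j) a refl = subst (λ b → ExForm (λ q → ord q ≡ i) (Below i) (if b then c⊥ else c⊤)) (sym ev) c⊥
  exForm i ne ev (inj₂ nothing) a eq = ⊥-elim (not-root ne eq)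
  exForm i ne ev (inj₂ (just (x , false))) a eq = ⊥-elim (true≢false (sym (sign x false eq ev)))
  exForm i ne ev (inj₂ (just (x , true))) a refl = transitions-ex (λ q → toℕ (ord q)) φ e ranked x a
    (λ h → Finₚ.toℕ-injective (trans h (sym (ord-just x true)))) (λ {q} lt → subst (toℕ (ord q) <_) (sym (ord-just x true)) lt)

  unForm : ∀ i → toℕ i ≢ H + H → even? (toℕ i) ≡ false → ∀ y a → ordS y ≡ i →
           UnForm (λ q → ord q ≡ i) (Below i) (δS y a)
  unForm i ne od (inj₁ j) a refl = subst (λ b → UnForm (λ q → ord q ≡ i) (Below i) (if b then c⊥ else c⊤)) (sym od) c⊤
  unForm i ne od (inj₂ nothing) a eq = ⊥-elim (not-root ne eq)
  unForm i ne od (inj₂ (just (x , true))) a eq = ⊥-elim (true≢false (sign x true eq od))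
  unForm i ne od (inj₂ (just (x , false))) a refl = transitions-un (λ q → toℕ (ord q)) φ e ranked x a
    (λ h → Finₚ.toℕ-injective (trans h (sym (ord-just x false)))) (λ {q} lt → subst (toℕ (ord q) <_) (sym (ord-just x false)) lt)

  exCol : ∀ i → toℕ i ≢ H + H → even? (toℕ i) ≡ true → ∀ y → ordS y ≡ i → (ΩS y ≡ 1) ⊎ (ΩS y ≡ 2)
  exCol i ne ev (inj₁ j) refl = inj₂ (cong (λ b → if b then 2 else 0) ev)
  exCol i ne ev (inj₂ nothing) eq = ⊥-elim (not-root ne eq)
  exCol i ne ev (inj₂ (just (x , false))) eq = ⊥-elim (true≢false (sym (sign x false eq ev)))
  exCol i ne ev (inj₂ (just (x , true))) eq with finalAt φ x
  ... | true  = inj₂ refl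
  ... | false = inj₁ refl

  unCol : ∀ i → toℕ i ≢ H + H → even? (toℕ i) ≡ false → ∀ y → ordS y ≡ i → (ΩS y ≡ 0) ⊎ (ΩS y ≡ 1)
  unCol i ne od (inj₁ j) refl = inj₁ (cong (λ b → if b then 2 else 0) od)
  unCol i ne od (inj₂ nothing) eq = ⊥-elim (not-root ne eq)
  unCol i ne od (inj₂ (just (x , true))) eq = ⊥-elim (true≢false (sign x true eq od))
  unCol i ne od (inj₂ (just (x , false))) eq with finalAt φ x
  ... | true  = inj₂ refl
  ... | false = inj₁ refl

  Classes : Fin c → Set
  Classes i = Transient δ ord hE Ω i ⊎ (hE i ≡ true × Existential δ ord hE Ω i) ⊎ (hE i ≡ false × Universal δ ord hE Ω i)

  -- Both decisions are arguments so that the case distinction of `CharAt` can be resolved by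
  -- matching on them in `char`.
  classify : ∀ i → Dec (toℕ i ≡ H + H) → ∀ b → even? (toℕ i) ≡ b → Classes i
  classify i (yes eq) _     _  = inj₁ λ q a → trForm i eq (view q) a
  classify i (no ne)  true  ev = inj₂ (inj₁ (ev , (λ q a → exForm i ne ev (view q) a) ,
                                   2 , (1 , refl) , λ q → exCol i ne ev (view q)))
  classify i (no ne)  false od = inj₂ (inj₂ (od , (λ q a → unForm i ne od (view q) a) ,
                                   1 , (0 , refl) , λ q → unCol i ne od (view q)))

  automaton : HGTA n
  automaton = record
    { k = N ; δ = δ ; q₀ = code (inj₂ nothing) ; c = c ; ord = ord
    ; ordSurj = λ i → code (inj₁ i) , cong ordS (view-code (inj₁ i))
    ; hE = hE ; Ω = Ω ; hesitant = λ i → classify i (toℕ i ℕₚ.≟ H + H) (even? (toℕ i)) refl }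

  module Correct (em : EM) (K : KTree n) where
    open KTree K
    open Semantics K
    open Acceptance em automaton K using (CharAt; ExRun; UnRun)

    WS : State → List D → Set
    WS (inj₁ j)              v = even? (toℕ j) ≡ false
    WS (inj₂ nothing)        v = satY K (Val K) v φ
    WS (inj₂ (just (x , s))) v = Signed s (satY K (Val K) v (formulaAt φ x))

    W : Fin N → List D → Set
    W q = WS (view q)

    denotes : Denotes em K W φ e
    denotes x s v _ = ≡→⟺ (cong (λ y → WS y v) (view-code (inj₂ (just (x , s)))))

    value : ∀ x → (Ω (e x true) ≡ 2 ⟺ finalAt φ x ≡ true) × (Ω (e x false) ≡ 1 ⟺ finalAt φ x ≡ true)
    value x = (≡→⟺ (cong (λ y → ΩS y ≡ 2) (view-code (inj₂ (just (x , true))))) ⟫ pos) ,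
              (≡→⟺ (cong (λ y → ΩS y ≡ 1) (view-code (inj₂ (just (x , false))))) ⟫ neg′)
      where
      pos : (if finalAt φ x then 2 else 1) ≡ 2 ⟺ finalAt φ x ≡ true
      pos with finalAt φ x
      ... | true  = (λ _ → refl) , λ _ → refl
      ... | false = (λ ()) , λ ()
      neg′ : (if finalAt φ x then 1 else 0) ≡ 1 ⟺ finalAt φ x ≡ true
      neg′ with finalAt φ x
      ... | true  = (λ _ → refl) , λ _ → refl
      ... | false = (λ ()) , λ ()

    runs : ∀ x w → (satY K (Val K) w (formulaAt φ x) ⟺ ExRun W 2 (e x true) w) ×
                   (satY K (Val K) w (formulaAt φ x) ⟺ UnRun W 1 (e x false) w)
    runs = runs⟺ em K δ Ω W φ e denotes
      (λ x s a → cong (λ y → δS y a) (view-code (inj₂ (just (x , s))))) value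

    trChar : ∀ y {w} → T w → toℕ (ordS y) ≡ H + H → WS y w ⟺ conW W w (δS y (Lab w))
    trChar (inj₁ j) {w} Tw eq = dummy (even? (toℕ j)) (trans (cong even? eq) (even?-double H))
      where
      dummy : ∀ b → b ≡ true → (b ≡ false) ⟺ conW W w (if b then c⊥ else c⊤)
      dummy true _ = (λ ()) , λ ()
    trChar (inj₂ nothing) Tw eq = ⟺-sym (con⟺ em K W φ e denotes true Tw)
    trChar (inj₂ (just (x , s))) Tw eq = ⊥-elim (ℕₚ.<-irrefl (trans (sym (ord-just x s)) eq) (num<c x s))

    exChar : ∀ q y → view q ≡ y → ∀ w → toℕ (ordS y) ≢ H + H → even? (toℕ (ordS y)) ≡ true → WS y w ⟺ ExRun W 2 q w
    exChar q (inj₁ j) eq w ne ev = (λ od → ⊥-elim (true≢false (trans (sym ev) od))) , λ (π , r , r0 , re , _) →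
      ⊥-elim (subst (λ b → ExTerm W (Path.π π 0) (if b then c⊥ else c⊤) (r 1)) ev
        (subst (λ y → ExTerm W (Path.π π 0) (δS y (Lab (Path.π π 0))) (r 1)) (trans (cong view r0) eq) (re 0)))
    exChar q (inj₂ nothing) eq w ne ev = ⊥-elim (not-root ne refl)
    exChar q (inj₂ (just (x , true))) eq w ne ev = subst (λ q → _ ⟺ ExRun W 2 q w) (sym (code-view q eq)) (proj₁ (runs x w))
    exChar q (inj₂ (just (x , false))) eq w ne ev = ⊥-elim (true≢false (sym (sign x false refl ev)))

    unChar : ∀ q y → view q ≡ y → ∀ w → toℕ (ordS y) ≢ H + H → even? (toℕ (ordS y)) ≡ false → WS y w ⟺ (¬ UnRun W 1 q w)
    unChar q (inj₁ j) eq w ne od = (λ _ (π , r , r0 , re , _) →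
      subst (λ b → UnTerm W (Path.π π 0) (if b then c⊥ else c⊤) (r 1)) od
        (subst (λ y → UnTerm W (Path.π π 0) (δS y (Lab (Path.π π 0))) (r 1)) (trans (cong view r0) eq) (re 0))) , λ _ → od
    unChar q (inj₂ nothing) eq w ne od = ⊥-elim (not-root ne refl)
    unChar q (inj₂ (just (x , false))) eq w ne od =
      subst (λ q → _ ⟺ (¬ UnRun W 1 q w)) (sym (code-view q eq)) (¬-⟺ (proj₂ (runs x w)))
    unChar q (inj₂ (just (x , true))) eq w ne od = ⊥-elim (true≢false (sign x true refl od))

    char : ∀ q w → T w → ∀ d b ev → CharAt W q w (classify (ord q) d b ev)
    char q w Tw (yes eq) b     ev = trChar (view q) Tw eq
    char q w Tw (no ne)  true  ev = exChar q (view q) refl w ne ev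
    char q w Tw (no ne)  false od = unChar q (view q) refl w ne od

    automaton⟺ : LHGTA automaton K ⟺ satY K (Val K) [] φ
    automaton⟺ = LHGTA⟺ em automaton K W (λ q w Tw → char q w Tw _ _ refl) ⟫
      ≡→⟺ (cong (λ y → WS y []) (view-code (inj₂ nothing)))

-- The translations that close the cycle.

module _ {n : ℕ} where

  CDL→HGTA : CDL n → HGTA n
  CDL→HGTA ψ = ToHGTA.automaton (toY ψ)

  CDL→HGTA⟺ : EM → (ψ : CDL n) → LHGTA (CDL→HGTA ψ) ≐ LCDL ψ
  CDL→HGTA⟺ em ψ K = ToHGTA.Correct.automaton⟺ (toY ψ) em K ⟫ ⟺-sym (ToY.toY⟺ em K ψ (KTree.root K))

  -- The root is singled out as the least node.
  HGTA→MCL : HGTA n → MCLSentence n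
  HGTA→MCL A = ex1 (and (neg (ex1 (neg (leq (suc zero) zero)))) (toMCL (FromHGTA.formula A (HGTA.q₀ A)) zero))

  HGTA→MCL⟺ : ExcludedMiddle (lsuc 0ℓ) → (A : HGTA n) → (K : KTree n) →
              LMCL (HGTA→MCL A) K ⟺ satY K (Val K) [] (FromHGTA.formula A (HGTA.q₀ A))
  HGTA→MCL⟺ em₁ A K = to , from
    where
    φ : Y (Fin n)
    φ = FromHGTA.formula A (HGTA.q₀ A)
    to : LMCL (HGTA→MCL A) K → satY K (Val K) [] φ
    to (w , lift Tw , least , h) = subst (λ u → satY K (Val K) u φ) (least≡[] w (decidable-stable em₁ λ n → least ([] , lift (KTree.root K) , n)))
      (proj₁ (ToMCL.toMCL⟺ em₁ K φ (w ∷ᶠ λ ()) (λ ()) zero) h)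
      where
      least≡[] : ∀ w → Lift (lsuc 0ℓ) (w ≼ []) → w ≡ []
      least≡[] [] _ = refl
    from : satY K (Val K) [] φ → LMCL (HGTA→MCL A) K
    from h = [] , lift (KTree.root K) , (λ (u , _ , n) → n (lift (u , refl))) ,
      proj₂ (ToMCL.toMCL⟺ em₁ K φ ([] ∷ᶠ λ ()) (λ ()) zero) h

  -- The sentence is equivalent on every tree to a formula of the hub logic, from which it inherits
  -- bisimulation closure.
  HGTA→MCL-correct : ExcludedMiddle (lsuc 0ℓ) → (A : HGTA n) →
                     BisimClosed (LMCL (HGTA→MCL A)) × (LMCL (HGTA→MCL A) ≐ LHGTA A)
  HGTA→MCL-correct em₁ A =
    (λ K K′ B → proj₁ (HGTA→MCL⟺ em₁ A K ⟫ bisim-invariant (fromBisim B) (FromHGTA.formula A (HGTA.q₀ A)) (Bisim.root B) ⟫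
                       ⟺-sym (HGTA→MCL⟺ em₁ A K′))) ,
    λ K → HGTA→MCL⟺ em₁ A K ⟫ FromHGTA.Correct.formula⟺ A (em-lower em₁) K

theorem21 : (n : ℕ) →
    Σ (MCLSentence n → CDL n)
    (λ f → ExcludedMiddle (lsuc 0ℓ) → (φ : MCLSentence n) →
    BisimClosed (LMCL φ) → LCDL (f φ) ≐ LMCL φ) ×
    Σ (CDL n → HGTA n)
    (λ g → ExcludedMiddle (lsuc 0ℓ) → (ψ : CDL n) → LHGTA (g ψ) ≐ LCDL ψ) ×
    Σ (HGTA n → MCLSentence n)
    (λ h → ExcludedMiddle (lsuc 0ℓ) → (A : HGTA n) →
    BisimClosed (LMCL (h A)) × (LMCL (h A) ≐ LHGTA A))
theorem21 n = (MCL→CDL , λ em φ → MCL→CDL⟺ (em-lower em) φ) ,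
              (CDL→HGTA , λ em → CDL→HGTA⟺ (em-lower em)) ,
              (HGTA→MCL , HGTA→MCL-correct)
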